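{- Let $n\ge5$ and $s$ be integers with $1<s<n/2$, let $q=\lfloor n/s\rfloor$ and $r=n-qs$. For an integer $x$ let $\epsilon(x)=1$ if $x$ is odd and $0$ if $x$ is even, and let $\kappa(a)=a+\frac{\epsilon(s)+\epsilon(q)}{2}$. Then: (a) if $2\le s\le \sqrt{n-r+(\kappa(-2))^2}+\kappa(-2)$, then $$\frac{n^2-\epsilon(n)}{8(s+1)}\le \overrightarrow{w}(C_n(1,s))\le \frac{s+2}{24}\Big(6q^2+3q(s+4)+s(4s+10)+\epsilon(q)(2q+3s+3)\Big);$$ (b) if $\sqrt{n-r+(\kappa(-1))^2}+\kappa(-1)\le s\le \sqrt{n-r+(\kappa(0))^2}+\kappa(0)$, then $$\frac{n^2-\epsilon(n)}{8(s+1)}\le \overrightarrow{w}(C_n(1,s))\le \frac{q(q+2)(5q+2)}{24}+\frac{s(s+2)(2s+5)}{6}+\epsilon(q)\frac{5q^2+13q+7}{8};$$ (c) if $\sqrt{n-r+(\kappa(1))^2}+\kappa(1)\le s<n/2$, then $$\max\left\{\frac{n^2-\epsilon(n)}{8(s+1)},\frac{(n-1)(\sqrt{2n}-7)^3}{24n}\right\}\le \overrightarrow{w}(C_n(1,s))\le \frac{q(q+2)(q+10)}{24}+\frac{s(s+2)(q+1)}{2}+\epsilon(q)\frac{(q+5)^2+4(s+1)^2}{8}.$$ Moreover, in each of (a), (b), (c) the same lower and upper bounds hold with $\overrightarrow{w}(C_n(1,s))$ replaced by $w(C_n(1,s))/2$.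
   Context: The circulant graph $C_n(1,s)$ has vertex set $\mathbb{Z}_n$, with $i,j$ adjacent iff $i-j\in\{\pm1,\pm s\}$ mod $n$. An arc is an ordered pair of adjacent vertices. An all-to-all routing $R$ of a graph $G$ is a set of oriented paths with exactly one path from $x$ to $y$ for each ordered pair of distinct vertices. A colouring of the paths of $R$ is edge-conflict-free if any two paths sharing an edge (regardless of orientation) get distinct colours, and arc-conflict-free if any two paths traversing a common arc in the same direction get distinct colours. $w(G,R)$ (resp. $\overrightarrow{w}(G,R)$) is the minimum number of colours in an edge-conflict-free (resp. arc-conflict-free) colouring of $R$; the undirected optical index is $w(G)=\min_R w(G,R)$ and the directed optical index is $\overrightarrow{w}(G)=\min_R\overrightarrow{w}(G,R)$, minima over all all-to-all routings $R$. -}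

module Defs where

open import Data.Nat using (ℕ; _+_; _*_; _∸_; _≤_; _%_)
open import Data.Integer as ℤ using (ℤ; +_; -[1+_])
open import Data.Fin using (Fin; toℕ)
open import Data.List using (List; []; _∷_; head; last)
open import Data.List.Relation.Unary.Linked using (Linked)
open import Data.List.Relation.Unary.Unique.Propositional using (Unique)
open import Data.Maybe using (just)
open import Data.Product using (Σ; ∃₂; _×_)
open import Data.Sum using (_⊎_)
open import Relation.Binary.PropositionalEquality using (_≡_; _≢_)
open import Relation.Nullary using (¬_)

ε : ℕ → ℕ
ε x = x % 2

-- Step n d i j  :⇔  j ≡ i + d (mod n), for i j < n and 0 < d < n.
Step : (n d : ℕ) → Fin n → Fin n → Set
Step n d i j = (toℕ i + d ≡ toℕ j) ⊎ (toℕ i + d ≡ toℕ j + n)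

Adj : (n s : ℕ) → Fin n → Fin n → Set
Adj n s i j = Step n 1 i j ⊎ Step n 1 j i ⊎ Step n s i j ⊎ Step n s j i

IsPath : (n s : ℕ) → Fin n → Fin n → List (Fin n) → Set
IsPath n s x y p =
  (head p ≡ just x) × (last p ≡ just y) × Linked (Adj n s) p × Unique p

-- An all-to-all routing: one path R x y from x to y for each ordered
-- pair of distinct vertices (values on the diagonal are irrelevant).
Routing : (n s : ℕ) → Set
Routing n s = Σ (Fin n → Fin n → List (Fin n))
                (λ R → ∀ x y → x ≢ y → IsPath n s x y (R x y))

data ArcIn {A : Set} (u v : A) : List A → Set where
  here  : ∀ {xs} → ArcIn u v (u ∷ v ∷ xs)
  there : ∀ {w xs} → ArcIn u v xs → ArcIn u v (w ∷ xs)

SharesArc : {A : Set} → List A → List A → Set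
SharesArc p p' = ∃₂ λ u v → ArcIn u v p × ArcIn u v p'

SharesEdge : {A : Set} → List A → List A → Set
SharesEdge p p' = ∃₂ λ u v → ArcIn u v p × (ArcIn u v p' ⊎ ArcIn v u p')

ConflictFree : {n k : ℕ} → (List (Fin n) → List (Fin n) → Set) →
               (Fin n → Fin n → List (Fin n)) → (Fin n → Fin n → Fin k) → Set
ConflictFree {n} Conf R c =
  ∀ (x y x' y' : Fin n) → x ≢ y → x' ≢ y' → ¬ (x ≡ x' × y ≡ y') →
  Conf (R x y) (R x' y') → c x y ≢ c x' y'

DirColourable : (n s k : ℕ) → Set
DirColourable n s k = Σ (Routing n s) λ R →
  Σ (Fin n → Fin n → Fin k) λ c → ConflictFree SharesArc (Σ.proj₁ R) c
  where open Data.Product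

UndirColourable : (n s k : ℕ) → Set
UndirColourable n s k = Σ (Routing n s) λ R →
  Σ (Fin n → Fin n → Fin k) λ c → ConflictFree SharesEdge (Σ.proj₁ R) c
  where open Data.Product

IsLeast : (ℕ → Set) → ℕ → Set
IsLeast P W = P W × (∀ k → P k → W ≤ k)

IsDirOpticalIndex : (n s W : ℕ) → Set
IsDirOpticalIndex n s W = IsLeast (DirColourable n s) W

IsUndirOpticalIndex : (n s W : ℕ) → Set
IsUndirOpticalIndex n s W = IsLeast (UndirColourable n s) W

-- LeSqrt x m  :⇔  x ≤ √m   (for integers x, m with m ≥ 0)
LeSqrt : ℤ → ℤ → Set
LeSqrt x m = (x ℤ.≤ + 0) ⊎ (x ℤ.* x ℤ.≤ m)

-- SqrtLe m x  :⇔  √m ≤ x   (for integers x, m with m ≥ 0)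
SqrtLe : ℤ → ℤ → Set
SqrtLe m x = (+ 0 ℤ.≤ x) × (m ℤ.≤ x ℤ.* x)

-- MulSqrtLe c m x  :⇔  c · √m ≤ x   (for naturals c, m, x)
MulSqrtLe : ℕ → ℕ → ℕ → Set
MulSqrtLe c m x = c * c * m ≤ x * x

-- The parameters of the theorem.  q = ⌊n/s⌋, r = n - q s are passed in.

-- κ₂ s q a = 2·κ(a) = 2a + ε(s) + ε(q)   (κ(a) itself is a half-integer)
κ₂ : (s q : ℕ) → ℤ → ℤ
κ₂ s q a = (+ 2) ℤ.* a ℤ.+ + (ε s + ε q)

-- 4·(n - r + κ(a)²) = 4(n - r) + (2κ(a))²
Y₄ : (n s q r : ℕ) → ℤ → ℤ
Y₄ n s q r a = + (4 * (n ∸ r)) ℤ.+ κ₂ s q a ℤ.* κ₂ s q a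

-- s ≤ √(n - r + κ(a)²) + κ(a)   ⇔   2s - 2κ(a) ≤ √(4(n - r + κ(a)²))
SLeRoot : (n s q r : ℕ) → ℤ → Set
SLeRoot n s q r a = LeSqrt (+ (2 * s) ℤ.- κ₂ s q a) (Y₄ n s q r a)

-- √(n - r + κ(a)²) + κ(a) ≤ s   ⇔   √(4(n - r + κ(a)²)) ≤ 2s - 2κ(a)
RootLeS : (n s q r : ℕ) → ℤ → Set
RootLeS n s q r a = SqrtLe (Y₄ n s q r a) (+ (2 * s) ℤ.- κ₂ s q a)

CondA CondB CondC : (n s q r : ℕ) → Set
CondA n s q r = (2 ≤ s) × SLeRoot n s q r -[1+ 1 ]
CondB n s q r = RootLeS n s q r -[1+ 0 ] × SLeRoot n s q r (+ 0)
CondC n s q r = RootLeS n s q r (+ 1)   -- s < n/2 is a standing hypothesis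

-- The bounds, for a quantity v = T / D (T, D naturals, D > 0).
-- (v = W⃗ uses D = 1; v = w / 2 uses T = w, D = 2.)

-- (n² - ε(n)) / (8(s+1)) ≤ T/D
Lower₁ : (n s T D : ℕ) → Set
Lower₁ n s T D = D * (n * n ∸ ε n) ≤ 8 * (s + 1) * T

-- (n-1)(√(2n) - 7)³ / (24 n) ≤ T/D.
-- Since (y - 7)³ = y(y² + 147) - 21y² - 343 and y² = 2n for y = √(2n),
-- this is  D(n-1)(2n+147)·√(2n) ≤ 24 n T + D(n-1)(42n+343).
Lower₂ : (n T D : ℕ) → Set
Lower₂ n T D = MulSqrtLe (D * (n ∸ 1) * (2 * n + 147)) (2 * n)
                         (24 * n * T + D * (n ∸ 1) * (42 * n + 343))

-- T/D ≤ (s+2)/24 · (6q² + 3q(s+4) + s(4s+10) + ε(q)(2q+3s+3))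
UpperA : (s q T D : ℕ) → Set
UpperA s q T D = 24 * T ≤ D * ((s + 2) *
  (6 * q * q + 3 * q * (s + 4) + s * (4 * s + 10) + ε q * (2 * q + 3 * s + 3)))

-- T/D ≤ q(q+2)(5q+2)/24 + s(s+2)(2s+5)/6 + ε(q)(5q²+13q+7)/8
UpperB : (s q T D : ℕ) → Set
UpperB s q T D = 24 * T ≤ D * (q * (q + 2) * (5 * q + 2)
  + 4 * (s * (s + 2) * (2 * s + 5)) + 3 * (ε q * (5 * q * q + 13 * q + 7)))

-- T/D ≤ q(q+2)(q+10)/24 + s(s+2)(q+1)/2 + ε(q)((q+5)² + 4(s+1)²)/8
UpperC : (s q T D : ℕ) → Set
UpperC s q T D = 24 * T ≤ D * (q * (q + 2) * (q + 10)
  + 12 * (s * (s + 2) * (q + 1))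
  + 3 * (ε q * ((q + 5) * (q + 5) + 4 * ((s + 1) * (s + 1)))))

Bounds : (n s q r T D : ℕ) → Set
Bounds n s q r T D =
    (CondA n s q r → Lower₁ n s T D × UpperA s q T D)
  × (CondB n s q r → Lower₁ n s T D × UpperB s q T D)
  × (CondC n s q r → (Lower₁ n s T D × Lower₂ n T D) × UpperC s q T D)

{-# OPTIONS --safe #-}

-- Lower bounds.  The cut between {0, …, h - 1} and the rest, h = ⌊n/2⌋, has 2 (s + 1) edges and
-- must carry h (n - h) paths in each direction.  Counting all arcs instead, a ball of radius r
-- has at most 2 (r + 1)² vertices, so for every K the paths leaving a vertex have total length at
-- least n K - Σ_{r<K} 2 (r + 1)²; K ≈ √(n/2) gives the second bound.
--
-- Upper bounds.  Write a displacement 1 ≤ d ≤ n/2 as j s ± a with a ≤ s/2, and route it by j long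
-- steps followed by a short steps; the displacement -d takes the reversed path, which may reuse
-- the same colours in the directed case and gets a second copy of them in the undirected one.
-- The n translates of such a path are coloured with 2 max (2, 2a, j) colours, one palette for the
-- bases in each half of the cycle: within a half the translates behave as on the line, where only
-- differences t < a and t s with t < j clash.  Summing over d gives a number of colours below each
-- of the three bounds.
module Submission where

open import Defs
open import Data.Bool using (Bool; true; false)
open import Data.Empty using (⊥; ⊥-elim)
open import Data.Fin as Fin using (Fin; zero; suc; toℕ; fromℕ<; combine; remQuot; join)
open import Data.Fin.Properties using (toℕ-fromℕ<; toℕ-injective; toℕ<n; fromℕ<-injective;
  combine-injective; combine-remQuot; injective⇒≤; splitAt-join)
open import Data.List using (List; []; _∷_; head; last)
open import Data.List.Relation.Unary.All using (All; []; _∷_)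
open import Data.List.Relation.Unary.AllPairs using ([]; _∷_)
open import Data.List.Relation.Unary.Linked using (Linked; [-]; _∷_)
open import Data.List.Relation.Unary.Unique.Propositional using (Unique)
open import Data.Maybe using (just)
open import Data.Nat
open import Data.Nat.DivMod
open import Data.Nat.Properties
open import Data.Nat.Tactic.RingSolver using (solve-∀)
open import Data.Product using (Σ; ∃; ∃₂; _×_; _,_; proj₁; proj₂)
open import Data.Sum using (_⊎_; inj₁; inj₂)
open import Data.Sum.Properties using (inj₁-injective; inj₂-injective)
open import Function using (_∘_)
open import Relation.Nullary using (¬_; yes; no; Dec; recompute)
open import Relation.Unary using (Decidable)
open import Relation.Binary.Definitions using (tri<; tri≈; tri>)
open import Relation.Binary.PropositionalEquality

-- Finite sums and congruences

-- The halves are there because the cycle has a seam: a colouring built on rows of length `s` breaks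
-- down where vertex n - 1 meets vertex 0. Two bases in one half are less than n/2 apart and the
-- shifts at which translates clash are at most n/2, so each clash congruence modulo `n` is an
-- equality of integers. Division by `s` rounds down, whereas j should be the nearest quotient;
-- hence the parameter e = d + m with m = ⌊s/2⌋, which centres the rows. Row j ≥ 1 costs at most 2 s
-- j + (s - j)² + 3 colours, the square being read as 0 once j > s. The estimate 2 s j + (s - j)² ≤
-- s² + j² is exact for j ≤ s but too generous in many rows beyond `s`. It yields (b), (c), and (a)
-- up to q = 4 s; for larger `q` the squares in (a) are summed by telescoping cubes instead. Balls
-- are counted in rotated coordinates: P counts the steps +1 and +s, Q the steps +1 and -s. With the
-- length these determine the displacement, and both lie in [0, r], so a ball becomes a square; the
-- factor 2 records a parity.

sum< : (ℕ → ℕ) → ℕ → ℕ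
sum< f zero    = 0
sum< f (suc n) = sum< f n + f n

sum<-mono-range : ∀ f {m n} → m ≤ n → sum< f m ≤ sum< f n
sum<-mono-range f {m} {n} m≤n = go (≤⇒≤′ m≤n)
  where
  go : ∀ {n} → m ≤′ n → sum< f m ≤ sum< f n
  go (≤′-reflexive refl) = ≤-refl
  go (≤′-step p) = ≤-trans (go p) (m≤m+n _ _)

sum<-mono : ∀ {f g} n → (∀ k → k < n → f k ≤ g k) → sum< f n ≤ sum< g n
sum<-mono zero    h = z≤n
sum<-mono (suc n) h =
  +-mono-≤ (sum<-mono n (λ k k<n → h k (m<n⇒m<1+n k<n))) (h n ≤-refl)

sum<-* : ∀ c f n → sum< (λ k → c * f k) n ≡ c * sum< f n
sum<-* c f zero    = sym (*-zeroʳ c)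
sum<-* c f (suc n) =
  trans (cong (_+ c * f n) (sum<-* c f n)) (sym (*-distribˡ-+ c (sum< f n) (f n)))

sum<-split : ∀ f m k → sum< f (m + k) ≡ sum< f m + sum< (λ i → f (m + i)) k
sum<-split f m zero    = trans (cong (sum< f) (+-identityʳ m)) (sym (+-identityʳ _))
sum<-split f m (suc k) = begin
  sum< f (m + suc k)                                   ≡⟨ cong (sum< f) (+-suc m k) ⟩
  sum< f (m + k) + f (m + k)                           ≡⟨ cong (_+ f (m + k)) (sum<-split f m k) ⟩
  sum< f m + sum< (λ i → f (m + i)) k + f (m + k)      ≡⟨ +-assoc (sum< f m) _ _ ⟩
  sum< f m + (sum< (λ i → f (m + i)) k + f (m + k))    ∎
  where open ≡-Reasoning

sum<-blocks : ∀ f s p →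
  sum< f (p * s) ≡ sum< (λ j → sum< (λ u → f (j * s + u)) s) p
sum<-blocks f s zero    = refl
sum<-blocks f s (suc p) = begin
  sum< f (s + p * s)                                ≡⟨ cong (sum< f) (+-comm s (p * s)) ⟩
  sum< f (p * s + s)                                ≡⟨ sum<-split f (p * s) s ⟩
  sum< f (p * s) + sum< (λ u → f (p * s + u)) s     ≡⟨ cong (_+ sum< (λ u → f (p * s + u)) s) (sum<-blocks f s p) ⟩
  sum< (λ j → sum< (λ u → f (j * s + u)) s) (suc p) ∎
  where open ≡-Reasoning

-- sum< f d + c is the position of the c-th element of the d-th block in a
-- concatenation of blocks of sizes f 0, f 1, ….
block-< : ∀ f {d N c} → d < N → c < f d → sum< f d + c < sum< f N
block-< f {d} d<N c<fd = <-≤-trans (+-monoʳ-< (sum< f d) c<fd) (sum<-mono-range f d<N)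

block-injective : ∀ f {d d' c c'} → c < f d → c' < f d' →
  sum< f d + c ≡ sum< f d' + c' → d ≡ d' × c ≡ c'
block-injective f {d} {d'} {c} {c'} c< c'< eq with <-cmp d d'
... | tri≈ _ refl _ = refl , +-cancelˡ-≡ (sum< f d) c c' eq
... | tri< d<d' _ _ = ⊥-elim (<⇒≢ (<-≤-trans (block-< f d<d' c<) (m≤m+n _ c')) eq)
... | tri> _ _ d'<d = ⊥-elim (<⇒≢ (<-≤-trans (block-< f d'<d c'<) (m≤m+n _ c)) (sym eq))

-- Multiples of `n` are allowed on both sides, so that congruences are handled without subtraction.
Cong : ℕ → ℕ → ℕ → Set
Cong n a b = ∃₂ λ k l → a + k * n ≡ b + l * n

module _ {n : ℕ} where

  Cong-refl : ∀ {a b} → a ≡ b → Cong n a b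
  Cong-refl refl = 0 , 0 , refl

  Cong-sym : ∀ {a b} → Cong n a b → Cong n b a
  Cong-sym (k , l , eq) = l , k , sym eq

  Cong-+ : ∀ {a b c d} → Cong n a b → Cong n c d → Cong n (a + c) (b + d)
  Cong-+ {a} {b} {c} {d} (k , l , eq) (k' , l' , eq') = k + k' , l + l' ,
    trans (lem a c k k' n) (trans (cong₂ _+_ eq eq') (sym (lem b d l l' n)))
    where
    lem : ∀ a c k k' n → a + c + (k + k') * n ≡ (a + k * n) + (c + k' * n)
    lem = solve-∀

  Cong-cancel : ∀ c d {a b} → c ≡ d → Cong n (c + a) (d + b) → Cong n a b
  Cong-cancel c .c {a} {b} refl (k , l , eq) = k , l ,
    +-cancelˡ-≡ c _ _ (trans (sym (+-assoc c a _)) (trans eq (+-assoc c b _)))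

  Cong-trans : ∀ {a b c} → Cong n a b → Cong n b c → Cong n a c
  Cong-trans {a} {b} {c} p r = Cong-cancel b b refl
    (subst (λ t → Cong n t (b + c)) (+-comm a b) (Cong-+ p r))

  -- If the two multiples differed, `a` and `b` would be at least `n` apart. This is the passage
  -- from the cycle back to the integers.
  Cong⇒≡ : ∀ {a b} → a < b + n → b < a + n → Cong n a b → a ≡ b
  Cong⇒≡ {a} {b} a< b< (k , l , eq) with <-cmp k l
  ... | tri≈ _ refl _ = +-cancelʳ-≡ (k * n) a b eq
  ... | tri< k<l _ _ = ⊥-elim (<⇒≱ (+-monoˡ-< (k * n) a<) (begin
      b + n + k * n   ≡⟨ +-assoc b n _ ⟩
      b + suc k * n   ≤⟨ +-monoʳ-≤ b (*-monoˡ-≤ n k<l) ⟩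
      b + l * n       ≡⟨ eq ⟨
      a + k * n       ∎))
    where open ≤-Reasoning
  ... | tri> _ _ l<k = ⊥-elim (<⇒≱ (+-monoˡ-< (l * n) b<) (begin
      a + n + l * n   ≡⟨ +-assoc a n _ ⟩
      a + suc l * n   ≤⟨ +-monoʳ-≤ a (*-monoˡ-≤ n l<k) ⟩
      a + k * n       ≡⟨ eq ⟩
      b + l * n       ∎))
    where open ≤-Reasoning

%-Cong : ∀ n .{{_ : NonZero n}} a → Cong n (a % n) a
%-Cong n a = a / n , 0 , trans (sym (m≡m%n+[m/n]*n a n)) (sym (+-identityʳ a))

%≡⇒Cong : ∀ {n} .{{_ : NonZero n}} {a b} → a % n ≡ b % n → Cong n a b
%≡⇒Cong {n} {a} {b} eq = Cong-trans (Cong-sym (%-Cong n a)) (Cong-trans (Cong-refl eq) (%-Cong n b))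

/%-unique : ∀ s .{{_ : NonZero s}} {v w} → w < s → (v * s + w) / s ≡ v × (v * s + w) % s ≡ w
/%-unique s {v} {w} w<s = quot , rem
  where
  rem : (v * s + w) % s ≡ w
  rem = trans (cong (_% s) (+-comm (v * s) w)) (trans ([m+kn]%n≡m%n w v s) (m<n⇒m%n≡m w<s))
  quot : (v * s + w) / s ≡ v
  quot = *-cancelʳ-≡ _ v s (+-cancelˡ-≡ w _ _ (begin
      w + (v * s + w) / s * s                 ≡⟨ cong (_+ (v * s + w) / s * s) rem ⟨
      (v * s + w) % s + (v * s + w) / s * s   ≡⟨ m≡m%n+[m/n]*n (v * s + w) s ⟨
      v * s + w                               ≡⟨ +-comm (v * s) w ⟩
      w + v * s                               ∎))
    where open ≡-Reasoning

-- Walks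

module _ {A : Set} where

  walk : (ℕ → A) → ℕ → List A
  walk f zero    = f 0 ∷ []
  walk f (suc L) = f 0 ∷ walk (f ∘ suc) L

  walk-head : ∀ f L → head (walk f L) ≡ just (f 0)
  walk-head f zero    = refl
  walk-head f (suc L) = refl

  walk-last : ∀ f L → last (walk f L) ≡ just (f L)
  walk-last f zero          = refl
  walk-last f (suc zero)    = refl
  walk-last f (suc (suc L)) = walk-last (f ∘ suc) (suc L)

  walk-linked : ∀ {R : A → A → Set} f L →
    (∀ k → k < L → R (f k) (f (suc k))) → Linked R (walk f L)
  walk-linked f zero          h = [-]
  walk-linked f (suc zero)    h = h 0 (s≤s z≤n) ∷ [-]
  walk-linked f (suc (suc L)) h =
    h 0 (s≤s z≤n) ∷ walk-linked (f ∘ suc) (suc L) (λ k k< → h (suc k) (s≤s k<))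

  walk-all : ∀ {P : A → Set} f L → (∀ k → k ≤ L → P (f k)) → All P (walk f L)
  walk-all f zero    h = h 0 z≤n ∷ []
  walk-all f (suc L) h = h 0 z≤n ∷ walk-all (f ∘ suc) L (λ k k≤ → h (suc k) (s≤s k≤))

  walk-unique : ∀ f L → (∀ k l → k < l → l ≤ L → f k ≢ f l) → Unique (walk f L)
  walk-unique f zero    h = [] ∷ []
  walk-unique f (suc L) h =
    walk-all (f ∘ suc) L (λ k k≤ → h 0 (suc k) (s≤s z≤n) (s≤s k≤))
    ∷ walk-unique (f ∘ suc) L (λ k l k<l l≤ → h (suc k) (suc l) (s≤s k<l) (s≤s l≤))

  walk-arc : ∀ {u v} f L → ArcIn u v (walk f L) →
    ∃ λ k → k < L × f k ≡ u × f (suc k) ≡ v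
  walk-arc f (suc zero)    here      = 0 , s≤s z≤n , refl , refl
  walk-arc f (suc (suc L)) here      = 0 , s≤s z≤n , refl , refl
  walk-arc f (suc L)       (there a) with walk-arc (f ∘ suc) L a
  ... | k , k<L , eq , eq' = suc k , s≤s k<L , eq , eq'
  walk-arc f zero          (there ())

-- Colouring the line

-- Colours of the line such that points at distance t < i, and points at
-- distance t * s with t < M, get distinct colours.  Each row [v s, (v+1) s) is cut into blocks
-- of length i, the last one prolonged by the remainder; the colour is the position in the
-- block, shifted down by one from each row to the next.
module LineColouring (s : ℕ) .{{_ : NonZero s}} (i M : ℕ) .{{_ : NonZero i}} .{{_ : NonZero M}}
                     (2i≤s : 2 * i ≤ s) (2i≤M : 2 * i ≤ M) where

  private
    top M-1 : ℕ
    M-1 = pred M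
    top = s / i * i

  tailShift : ∀ w → Dec (top ≤ w) → ℕ
  tailShift w (yes _) = i
  tailShift w (no _)  = 0

  rowPosition : ℕ → ℕ
  rowPosition w = w % i + tailShift w (top ≤? w)

  -- Modulo `M` the factor `M-1` is -1, which gives the downward shift without subtraction.
  lineColour : ℕ → ℕ
  lineColour x = (rowPosition (x % s) + x / s * M-1) % M

  lineColour<M : ∀ x → lineColour x < M
  lineColour<M x = m%n<n _ M

  private
    0<i : 0 < i
    0<i = >-nonZero⁻¹ i

    0<M : 0 < M
    0<M = >-nonZero⁻¹ M

    *M≡ : ∀ v → v * M ≡ v + v * M-1
    *M≡ v = trans (cong (v *_) (sym (suc-pred M))) (*-suc v M-1)

    2i≡ : 2 * i ≡ i + i
    2i≡ = cong (i +_) (+-identityʳ i)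

    i≤top : i ≤ top
    i≤top = ≤-trans (≤-reflexive (sym (+-identityʳ i)))
      (*-monoˡ-≤ i (m≥n⇒m/n>0 (≤-trans (m≤m+n i _) 2i≤s)))

    s≡ : top + s % i ≡ s
    s≡ = trans (+-comm top _) (sym (m≡m%n+[m/n]*n s i))

    rowPosition<2i : ∀ w → rowPosition w < 2 * i
    rowPosition<2i w with top ≤? w
    ... | yes _ = <-≤-trans (+-monoˡ-< i (m%n<n w i)) (≤-reflexive (sym 2i≡))
    ... | no _  = <-≤-trans (+-monoˡ-< 0 (m%n<n w i)) (+-monoʳ-≤ i z≤n)

    rowPosition<M : ∀ w → rowPosition w < M
    rowPosition<M w = <-≤-trans (rowPosition<2i w) 2i≤M

    -- Positions in the tail are at least `i` and all others are below `i`, so an equality cannot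
    -- mix the two kinds.
    rowPosition-%  : ∀ w w' → rowPosition w ≡ rowPosition w' → w % i ≡ w' % i
    rowPosition-% w w' eq with top ≤? w | top ≤? w'
    ... | yes _ | yes _ = +-cancelʳ-≡ i _ _ eq
    ... | no _  | no _  = +-cancelʳ-≡ 0 _ _ eq
    ... | yes _ | no _  = ⊥-elim (<⇒≱ (m%n<n w' i)
      (≤-trans (m≤n+m i (w % i)) (≤-reflexive (trans eq (+-identityʳ _)))))
    ... | no _  | yes _ = ⊥-elim (<⇒≱ (m%n<n w i)
      (≤-trans (m≤n+m i (w' % i)) (≤-reflexive (trans (sym eq) (+-identityʳ _)))))

    -- Adding `v + v'` to both sides turns each `v * M-1` into a multiple of `M`, leaving only the
    -- positions and the row numbers.
    unshift : ∀ G G' v v' → (G + v * M-1) % M ≡ (G' + v' * M-1) % M → Cong M (G + v') (G' + v)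
    unshift G G' v v' eq = add-rows (%≡⇒Cong {M} {G + v * M-1} {G' + v' * M-1} eq)
      where
      lem₁ : ∀ M G v v' k → G + v' + (k + v) * M ≡ G + v' + k * M + v * M
      lem₁ = solve-∀
      lem₂ : ∀ a b c d v → a + b + c + (v + d) ≡ (a + d + c) + (v + b)
      lem₂ = solve-∀
      lem : ∀ G v v' k → G + v' + (k + v) * M ≡ (G + v * M-1 + k * M) + (v + v')
      lem G v v' k = trans (lem₁ M G v v' k)
        (trans (cong (G + v' + k * M +_) (*M≡ v)) (lem₂ G v' (k * M) (v * M-1) v))
      add-rows : Cong M (G + v * M-1) (G' + v' * M-1) → Cong M (G + v') (G' + v)
      add-rows (k , l , eq') = k + v , l + v' ,
        trans (lem G v v' k) (trans (cong₂ _+_ eq' (+-comm v v')) (sym (lem G' v' v l)))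

    row-coords : ∀ x v w → w < s → x ≡ v * s + w → x / s ≡ v × x % s ≡ w
    row-coords x v w w<s refl = /%-unique s w<s

    x≡ : ∀ x → x ≡ x / s * s + x % s
    x≡ x = trans (m≡m%n+[m/n]*n x s) (+-comm (x % s) _)

  lineColour-column : ∀ x t → 0 < t → t < M → lineColour x ≢ lineColour (x + t * s)
  lineColour-column x t 0<t t<M eq
    with row-coords (x + t * s) (x / s + t) (x % s) (m%n<n x s)
           (trans (cong (_+ t * s) (x≡ x)) (lem (x / s) s (x % s) t))
    where
    lem : ∀ v s w t → v * s + w + t * s ≡ (v + t) * s + w
    lem = solve-∀
  ... | v≡ , w≡ = <⇒≢ 0<t (sym (Cong⇒≡ (<-≤-trans t<M ≤-refl) (≤-trans 0<M (m≤n+m M t))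
          (Cong-cancel (g + v) (g + v) refl
            (subst₂ (Cong M) (sym (+-assoc g v t)) (sym (+-identityʳ (g + v))) G≅))))
    where
    g v : ℕ
    g = rowPosition (x % s)
    v = x / s
    G≅ : Cong M (g + (v + t)) (g + v)
    G≅ = unshift g g v (v + t)
      (trans eq (cong₂ (λ a b → (rowPosition b + a * M-1) % M) v≡ w≡))

  private
    same-row : ∀ w t → 0 < t → t < i → rowPosition w ≢ rowPosition (w + t)
    same-row w t 0<t t<i eq = <⇒≢ 0<t (Cong⇒≡ (≤-trans 0<i (m≤n+m i t)) t<i
      (Cong-cancel w w refl (subst (λ a → Cong i a (w + t)) (sym (+-identityʳ w))
        (%≡⇒Cong {i} (rowPosition-% w (w + t) eq)))))

    -- Since the next row is shifted down by one, a clash needs `w'` to be one more than the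
    -- position of `w`. Outside the tail, t < i forces w' < w % i, which excludes this; a shift in
    -- the other direction would need w' = w % i - 1, which can occur.
    next-row : ∀ w w' t → w < s → t < i → w + t ≡ s + w' → ¬ Cong M (rowPosition w + 1) (rowPosition w')
    next-row w w' t w<s t<i eq cg with w'<i
      where
      w'<i : w' < i
      w'<i = ≤-<-trans (+-cancelˡ-≤ s w' t (≤-trans (≤-reflexive (sym eq)) (+-monoˡ-≤ t (<⇒≤ w<s)))) t<i
    ... | w'<i with top ≤? w' | top ≤? w
    ... | yes top≤w' | _ = <⇒≱ w'<i (≤-trans i≤top top≤w')
    ... | no _ | yes top≤w = <⇒≱ w'<i (≤-trans (m≤n+m i _) (≤-trans (m≤m+n _ 1) (≤-reflexive G≡)))
      where
      w%i< : w % i < s % i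
      w%i< = +-cancelˡ-< top _ _ (begin-strict
        top + w % i          ≡⟨ +-comm top _ ⟩
        w % i + s / i * i    ≤⟨ +-monoʳ-≤ (w % i) (≤-reflexive (cong (_* i) (sym /≡))) ⟩
        w % i + w / i * i    ≡⟨ m≡m%n+[m/n]*n w i ⟨
        w                    <⟨ w<s ⟩
        s                    ≡⟨ s≡ ⟨
        top + s % i          ∎)
        where
        open ≤-Reasoning
        /≡ : w / i ≡ s / i
        /≡ = ≤-antisym (/-monoˡ-≤ i (<⇒≤ w<s))
               (≤-trans (≤-reflexive (sym (m*n/n≡m (s / i) i))) (/-monoˡ-≤ i top≤w))
      -- The prolonged block has length i + s % i < 2 i ≤ M, so raising the position by one does not
      -- wrap around modulo `M`.
      G+1<M : w % i + i + 1 < M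
      G+1<M = <-≤-trans (begin-strict
        w % i + i + 1     ≡⟨ +-comm (w % i + i) 1 ⟩
        suc (w % i) + i   ≤⟨ +-monoˡ-≤ i w%i< ⟩
        s % i + i         <⟨ +-monoˡ-< i (m%n<n s i) ⟩
        i + i             ≡⟨ 2i≡ ⟨
        2 * i             ∎) 2i≤M
        where open ≤-Reasoning
      G≡ : w % i + i + 1 ≡ w'
      G≡ = trans (Cong⇒≡ (<-≤-trans G+1<M (m≤n+m M _))
             (≤-trans (≤-<-trans (≤-reflexive (trans (+-identityʳ _) (m<n⇒m%n≡m w'<i)))
               (<-≤-trans w'<i (≤-trans (m≤m+n i _) 2i≤M))) (m≤n+m M _)) cg)
             (trans (+-identityʳ _) (m<n⇒m%n≡m w'<i))
    ... | no _ | no top≰w = <⇒≱ (+-cancelʳ-< t (w / i * i + w') w lower) upper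
      where
      G≡ : w % i + 1 ≡ w'
      G≡ = trans (cong (_+ 1) (sym (+-identityʳ (w % i))))
             (trans (Cong⇒≡ (≤-<-trans (≤-reflexive (trans (cong (_+ 1) (+-identityʳ _)) (+-comm _ 1)))
                       (≤-<-trans (m%n<n w i) (<-≤-trans (<-≤-trans (m<m+n i {i} 0<i)
                         (≤-trans (≤-reflexive (sym 2i≡)) 2i≤M)) (m≤n+m M _))))
                     (≤-trans (≤-<-trans (≤-reflexive (trans (+-identityʳ _) (m<n⇒m%n≡m w'<i)))
                       (<-≤-trans w'<i (≤-trans (m≤m+n i _) 2i≤M))) (m≤n+m M _)) cg)
               (trans (+-identityʳ _) (m<n⇒m%n≡m w'<i)))
      upper : w ≤ w / i * i + w'
      upper = begin
        w                    ≡⟨ m≡m%n+[m/n]*n w i ⟩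
        w % i + w / i * i    ≤⟨ +-monoˡ-≤ _ (≤-trans (m≤m+n _ 1) (≤-reflexive G≡)) ⟩
        w' + w / i * i       ≡⟨ +-comm w' _ ⟩
        w / i * i + w'       ∎
        where open ≤-Reasoning
      lower : w / i * i + w' + t < w + t
      lower = begin-strict
        w / i * i + w' + t     <⟨ +-monoʳ-< (w / i * i + w') t<i ⟩
        w / i * i + w' + i     ≡⟨ lem (w / i) w' i ⟩
        suc (w / i) * i + w'   ≤⟨ +-monoˡ-≤ w' (*-monoˡ-≤ i /<) ⟩
        top + w'               ≤⟨ +-monoˡ-≤ w' (m/n*n≤m s i) ⟩
        s + w'                 ≡⟨ eq ⟨
        w + t                  ∎
        where
        open ≤-Reasoning
        lem : ∀ a b c → a * c + b + c ≡ suc a * c + b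
        lem = solve-∀
        /< : w / i < s / i
        /< = *-cancelʳ-< i _ _ (≤-<-trans (m/n*n≤m w i) (≰⇒> top≰w))

  lineColour-row : ∀ x t → 0 < t → t < i → lineColour x ≢ lineColour (x + t)
  lineColour-row x t 0<t t<i eq with x % s + t <? s
  ... | yes w+t<s with row-coords (x + t) (x / s) (x % s + t) w+t<s
                         (trans (cong (_+ t) (x≡ x)) (+-assoc (x / s * s) _ t))
  ... | v≡ , w≡ = same-row (x % s) t 0<t t<i
        (Cong⇒≡ (<-≤-trans (rowPosition<M _) (m≤n+m M _)) (<-≤-trans (rowPosition<M _) (m≤n+m M _))
          (Cong-cancel (x / s) (x / s) refl
            (subst₂ (Cong M) (+-comm _ (x / s)) (+-comm _ (x / s))
              (unshift _ _ (x / s) (x / s)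
                (trans eq (cong₂ (λ a b → (rowPosition b + a * M-1) % M) v≡ w≡))))))
  lineColour-row x t 0<t t<i eq | no w+t≮s
    with row-coords (x + t) (suc (x / s)) (x % s + t ∸ s) w'<s
                         (trans (cong (_+ t) (x≡ x)) (trans (+-assoc (x / s * s) _ t)
                           (trans (cong (x / s * s +_) (sym (m+[n∸m]≡n (≮⇒≥ w+t≮s))))
                             (lem (x / s * s) s _))))
    where
    lem : ∀ a b c → a + (b + c) ≡ b + a + c
    lem = solve-∀
    t<s : t < s
    t<s = <-≤-trans t<i (≤-trans (m≤m+n i _) 2i≤s)
    w'<s : x % s + t ∸ s < s
    w'<s = +-cancelˡ-< s _ _ (≤-<-trans (≤-reflexive (m+[n∸m]≡n (≮⇒≥ w+t≮s)))
             (+-mono-< (m%n<n x s) t<s))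
  ... | v≡ , w≡ = next-row (x % s) (x % s + t ∸ s) t (m%n<n x s) t<i
        (sym (m+[n∸m]≡n (≮⇒≥ w+t≮s)))
        (Cong-cancel (x / s) (x / s) refl
          (subst₂ (Cong M) (lem1 _ (x / s)) (+-comm _ (x / s))
              (unshift _ _ (x / s) (suc (x / s))
                (trans eq (cong₂ (λ a b → (rowPosition b + a * M-1) % M) v≡ w≡)))))
    where
    lem1 : ∀ a b → a + suc b ≡ b + (a + 1)
    lem1 = solve-∀

-- Paths with one turn

module _ {n : ℕ} where

  Step⇒Cong : ∀ {d} {i j : Fin n} → Step n d i j → Cong n (toℕ i + d) (toℕ j)
  Step⇒Cong (inj₁ eq) = Cong-refl eq
  Step⇒Cong {j = j} (inj₂ eq) = 0 , 1 ,
    trans (+-identityʳ _) (trans eq (cong (toℕ j +_) (sym (+-identityʳ n))))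

  Cong⇒Step : ∀ {d} {i j : Fin n} → d < n → Cong n (toℕ i + d) (toℕ j) → Step n d i j
  Cong⇒Step {d} {i} {j} d<n c with toℕ i + d <? n
  ... | yes i+d<n = inj₁ (Cong⇒≡ (<-≤-trans i+d<n (m≤n+m n _)) (<-≤-trans (toℕ<n j) (m≤n+m n _)) c)
  ... | no i+d≮n = inj₂ (Cong⇒≡
      (<-≤-trans (+-mono-< (toℕ<n i) d<n) (≤-trans (m≤n+m (n + n) (toℕ j)) (≤-reflexive (sym (+-assoc (toℕ j) n n)))))
      (+-monoˡ-< n (<-≤-trans (toℕ<n j) (≮⇒≥ i+d≮n)))
      (Cong-trans c (1 , 0 , trans (cong (toℕ j +_) (+-identityʳ n)) (sym (+-identityʳ _)))))

  Adj-sym : ∀ {s i j} → Adj n s i j → Adj n s j i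
  Adj-sym (inj₁ p)               = inj₂ (inj₁ p)
  Adj-sym (inj₂ (inj₁ p))        = inj₁ p
  Adj-sym (inj₂ (inj₂ (inj₁ p))) = inj₂ (inj₂ (inj₂ p))
  Adj-sym (inj₂ (inj₂ (inj₂ p))) = inj₂ (inj₂ (inj₁ p))

module _ {n : ℕ} .{{_ : NonZero n}} where

  infixl 6 _⊕_

  _⊕_ : Fin n → ℕ → Fin n
  x ⊕ o = fromℕ< (m%n<n (toℕ x + o) n)

  ⊕-Cong : ∀ x o → Cong n (toℕ (x ⊕ o)) (toℕ x + o)
  ⊕-Cong x o = Cong-trans (Cong-refl (toℕ-fromℕ< (m%n<n (toℕ x + o) n))) (%-Cong n _)

  Cong⇒Fin≡ : ∀ {x y : Fin n} → Cong n (toℕ x) (toℕ y) → x ≡ y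
  Cong⇒Fin≡ {x} {y} c = toℕ-injective
    (Cong⇒≡ (<-≤-trans (toℕ<n x) (m≤n+m n _)) (<-≤-trans (toℕ<n y) (m≤n+m n _)) c)

  Cong-summand : ∀ {y y' : Fin n} {a b} → Cong n (toℕ y + a) b → Cong n (toℕ y' + a) b → y ≡ y'
  Cong-summand {y} {y'} {a} c c' = Cong⇒Fin≡ (Cong-cancel a a refl
    (subst₂ (Cong n) (+-comm (toℕ y) a) (+-comm (toℕ y') a) (Cong-trans c (Cong-sym c'))))

  ⊕-identityʳ : ∀ x → x ⊕ 0 ≡ x
  ⊕-identityʳ x = Cong⇒Fin≡ (Cong-trans (⊕-Cong x 0) (Cong-refl (+-identityʳ _)))

  ⊕-injective : ∀ x {o o'} → o < n → o' < n → x ⊕ o ≡ x ⊕ o' → o ≡ o'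
  ⊕-injective x {o} {o'} o< o'< eq = Cong⇒≡ (<-≤-trans o< (m≤n+m n _)) (<-≤-trans o'< (m≤n+m n _))
    (Cong-cancel (toℕ x) (toℕ x) refl
      (Cong-trans (Cong-sym (⊕-Cong x o)) (Cong-trans (Cong-refl (cong toℕ eq)) (⊕-Cong x o'))))

  ⊕-unique : ∀ {x y : Fin n} {o} → Cong n (toℕ x + o) (toℕ y) → x ⊕ o ≡ y
  ⊕-unique {x} {y} {o} c = Cong⇒Fin≡ (Cong-trans (⊕-Cong x o) c)

  ⊕-step : ∀ x o d → Cong n (toℕ (x ⊕ o) + d) (toℕ (x ⊕ (o + d)))
  ⊕-step x o d = Cong-trans (Cong-+ (⊕-Cong x o) (Cong-refl {a = d} refl))
    (Cong-trans (Cong-refl (+-assoc (toℕ x) o d)) (Cong-sym (⊕-Cong x (o + d))))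

module Routes (n s : ℕ) .{{_ : NonZero n}} .{{_ : NonZero s}} (1<s : 1 < s) (2s<n : 2 * s < n) where

  private
    0<n : 0 < n
    0<n = >-nonZero⁻¹ n
    2*≡ : ∀ a → 2 * a ≡ a + a
    2*≡ a = cong (a +_) (+-identityʳ a)
    s+s<n : s + s < n
    s+s<n = subst (_< n) (2*≡ s) 2s<n
    s+1<n : s + 1 < n
    s+1<n = <-trans (+-monoʳ-< s 1<s) s+s<n
    s<n : s < n
    s<n = ≤-<-trans (m≤m+n s s) s+s<n
    1<n : 1 < n
    1<n = <-trans 1<s s<n

  ¬Cong-0 : ∀ {c} → 0 < c → c < n → ¬ Cong n c 0
  ¬Cong-0 0<c c<n p = <⇒≢ 0<c (sym (Cong⇒≡ c<n (<-≤-trans 0<n (m≤n+m n _)) p))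

  ¬Cong-s-1 : ¬ Cong n s 1
  ¬Cong-s-1 p = <⇒≢ 1<s (sym (Cong⇒≡ (<-≤-trans s<n (m≤n+m n 1)) (<-≤-trans 1<n (m≤n+m n s)) p))

  ahead : Bool → ℕ → ℕ → ℕ
  ahead true  a b = a + b
  ahead false a b = a ∸ b

  -- The k-th vertex, relative to the base, of the path with j steps + s followed by steps + 1 if σ
  -- is true and - 1 otherwise.
  offset : Bool → ℕ → ℕ → ℕ
  offset σ j k = ahead σ ((k ⊓ j) * s) (k ∸ j)

  -- The bound `2js≤` combines d ≤ n/2 with the distance of at most s/2 between d and js. The last
  -- field gives js ≥ s > a when the short steps go back, so that the truncated subtraction in
  -- `ahead` is exact.
  record Turn (σ : Bool) (j a : ℕ) : Set where
    field
      2a≤s   : 2 * a ≤ s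
      2js≤   : 2 * (j * s) ≤ n + s
      back⇒j : σ ≡ false → 0 < j

  module Path {σ : Bool} {j a : ℕ} (turn : Turn σ j a) where
    open Turn turn

    private
      o : ℕ → ℕ
      o = offset σ j

      a<s : a < s
      a<s = ≰⇒> λ s≤a → <⇒≱ (<-≤-trans (m<m+n s {s} (<-trans (s≤s z≤n) 1<s)) (≤-reflexive (sym (2*≡ s))))
        (≤-trans (*-monoʳ-≤ 2 s≤a) 2a≤s)

      -- All offsets therefore stay below `n`, and distinct offsets give distinct vertices of the
      -- cycle.
      js+a<n : j * s + a < n
      js+a<n = *-cancelˡ-< 2 _ _ (begin-strict
        2 * (j * s + a)         ≡⟨ *-distribˡ-+ 2 (j * s) a ⟩
        2 * (j * s) + 2 * a     ≤⟨ +-mono-≤ 2js≤ 2a≤s ⟩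
        n + s + s               ≡⟨ +-assoc n s s ⟩
        n + (s + s)             <⟨ +-monoʳ-< n s+s<n ⟩
        n + n                   ≡⟨ 2*≡ n ⟨
        2 * n                   ∎)
        where open ≤-Reasoning

      back⇒s≤js : σ ≡ false → s ≤ j * s
      back⇒s≤js e = ≤-trans (≤-reflexive (sym (+-identityʳ s))) (*-monoˡ-≤ s (back⇒j e))

      o-up : ∀ {k} → k ≤ j → o k ≡ k * s
      o-up {k} k≤j = trans (cong₂ (λ a b → ahead σ (a * s) b) (m≤n⇒m⊓n≡m k≤j) (m≤n⇒m∸n≡0 k≤j)) (ahead-0 σ)
        where
        ahead-0 : ∀ σ → ahead σ (k * s) 0 ≡ k * s
        ahead-0 true  = +-identityʳ _
        ahead-0 false = refl

      o-turn : ∀ κ → o (j + κ) ≡ ahead σ (j * s) κ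
      o-turn κ = cong₂ (λ a b → ahead σ (a * s) b) (m≥n⇒m⊓n≡n (m≤m+n j κ)) (m+n∸m≡n j κ)

      data Leg : ℕ → Set where
        rising : ∀ {k} → k < j → Leg k
        turned : ∀ κ → Leg (j + κ)

      leg : ∀ k → Leg k
      leg k with k <? j
      ... | yes k<j = rising k<j
      ... | no k≮j  = subst Leg (m+[n∸m]≡n (≮⇒≥ k≮j)) (turned (k ∸ j))

      ahead≤ : ∀ σ a b → ahead σ a b ≤ a + b
      ahead≤ true  a b = ≤-refl
      ahead≤ false a b = ≤-trans (m∸n≤m a b) (m≤m+n a b)

      o<n : ∀ {k} → k ≤ j + a → o k < n
      o<n {k} k≤ with leg k
      ... | rising k<j = ≤-<-trans (≤-reflexive (o-up (<⇒≤ k<j)))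
              (≤-<-trans (≤-trans (*-monoˡ-≤ s (<⇒≤ k<j)) (m≤m+n _ a)) js+a<n)
      ... | turned κ = ≤-<-trans (≤-reflexive (o-turn κ)) (≤-<-trans (ahead≤ σ _ κ)
              (≤-<-trans (+-monoʳ-≤ (j * s) (+-cancelˡ-≤ j κ a k≤)) js+a<n))

      ahead-injective : ∀ σ' → σ ≡ σ' → ∀ {κ l} → κ < l → l ≤ a → ahead σ' (j * s) κ ≢ ahead σ' (j * s) l
      ahead-injective true  _ κ<l l≤a = <⇒≢ (+-monoʳ-< (j * s) κ<l)
      ahead-injective false e κ<l l≤a =
        ≢-sym (<⇒≢ (∸-monoʳ-< κ<l (≤-trans l≤a (≤-trans (<⇒≤ a<s) (back⇒s≤js e)))))

      rising<turned : ∀ σ' {k} κ → k < j → κ ≤ a → k * s < ahead σ' (j * s) κ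
      rising<turned true  κ k<j κ≤a = <-≤-trans (*-monoˡ-< s k<j) (m≤m+n _ κ)
      rising<turned false {k} κ k<j κ≤a = m+n≤o⇒m≤o∸n (suc (k * s)) (begin
        suc (k * s) + κ    ≡⟨ +-suc (k * s) κ ⟨
        k * s + suc κ      ≤⟨ +-monoʳ-≤ (k * s) (≤-<-trans κ≤a a<s) ⟩
        k * s + s          ≡⟨ +-comm (k * s) s ⟩
        suc k * s          ≤⟨ *-monoˡ-≤ s k<j ⟩
        j * s              ∎)
        where open ≤-Reasoning

      o-injective : ∀ k l → k < l → l ≤ j + a → o k ≢ o l
      o-injective k l k<l l≤ eq with leg k | leg l
      ... | rising k<j | rising l<j =
              <⇒≢ (*-monoˡ-< s k<l) (trans (sym (o-up (<⇒≤ k<j))) (trans eq (o-up (<⇒≤ l<j))))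
      ... | rising k<j | turned κ =
              <⇒≢ (rising<turned σ κ k<j (+-cancelˡ-≤ j κ a l≤))
                (trans (sym (o-up (<⇒≤ k<j))) (trans eq (o-turn κ)))
      ... | turned κ | rising l<j = <⇒≱ (<-trans k<l l<j) (m≤m+n j κ)
      ... | turned κ | turned κ' = ahead-injective σ refl (+-cancelˡ-< j κ κ' k<l) (+-cancelˡ-≤ j κ' a l≤)
                (trans (sym (o-turn κ)) (trans eq (o-turn κ')))

    data Arc (x u v : Fin n) : Set where
      long   : ∀ κ → κ < j → Cong n (toℕ x + κ * s) (toℕ u) → Cong n (toℕ u + s) (toℕ v) → Arc x u v
      short⁺ : ∀ κ → σ ≡ true → κ < a →
               Cong n (toℕ x + (j * s + κ)) (toℕ u) → Cong n (toℕ u + 1) (toℕ v) → Arc x u v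
      short⁻ : ∀ κ → σ ≡ false → κ < a →
               Cong n (toℕ x + j * s) (toℕ u + κ) → Cong n (toℕ v + 1) (toℕ u) → Arc x u v

    private
      ⊕-Cong′ : ∀ (x : Fin n) {p q} → p ≡ q → Cong n (toℕ x + q) (toℕ (x ⊕ p))
      ⊕-Cong′ x {p} refl = Cong-sym (⊕-Cong x p)

      turn-arc : ∀ σ' → σ ≡ σ' → ∀ (x : Fin n) κ → κ < a →
        o (j + κ) ≡ ahead σ' (j * s) κ → o (j + suc κ) ≡ ahead σ' (j * s) (suc κ) →
        Arc x (x ⊕ o (j + κ)) (x ⊕ o (j + suc κ))
      turn-arc true e x κ κ<a p q = short⁺ κ e κ<a (⊕-Cong′ x p)
        (Cong-trans (⊕-step x (o (j + κ)) 1) (Cong-refl (cong (λ t → toℕ (x ⊕ t)) (begin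
          o (j + κ) + 1      ≡⟨ cong (_+ 1) p ⟩
          j * s + κ + 1      ≡⟨ +-assoc (j * s) κ 1 ⟩
          j * s + (κ + 1)    ≡⟨ cong (j * s +_) (+-comm κ 1) ⟩
          j * s + suc κ      ≡⟨ q ⟨
          o (j + suc κ)      ∎))))
        where open ≡-Reasoning
      turn-arc false e x κ κ<a p q = short⁻ κ e κ<a
        (Cong-trans (Cong-refl (trans (cong (toℕ x +_) (sym (trans (cong (_+ κ) p) (m∸n+n≡m (<⇒≤ κ<js)))))
            (sym (+-assoc (toℕ x) (o (j + κ)) κ))))
          (Cong-+ (⊕-Cong′ x refl) (Cong-refl {a = κ} refl)))
        (Cong-trans (⊕-step x (o (j + suc κ)) 1) (Cong-refl (cong (λ t → toℕ (x ⊕ t)) (begin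
          o (j + suc κ) + 1      ≡⟨ cong (_+ 1) q ⟩
          j * s ∸ suc κ + 1      ≡⟨ +-∸-comm 1 κ<js ⟨
          j * s + 1 ∸ suc κ      ≡⟨ cong (_∸ suc κ) (+-comm (j * s) 1) ⟩
          j * s ∸ κ              ≡⟨ p ⟨
          o (j + κ)              ∎))))
        where
        open ≡-Reasoning
        κ<js : κ < j * s
        κ<js = <-≤-trans κ<a (≤-trans (<⇒≤ a<s) (back⇒s≤js e))

    arc : ∀ (x : Fin n) k → k < j + a → Arc x (x ⊕ o k) (x ⊕ o (suc k))
    arc x k k< with leg k
    ... | rising k<j = long k k<j (⊕-Cong′ x (o-up (<⇒≤ k<j)))
            (Cong-trans (⊕-step x (o k) s) (Cong-refl (cong (λ t → toℕ (x ⊕ t))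
              (trans (cong (_+ s) (o-up (<⇒≤ k<j))) (trans (+-comm (k * s) s) (sym (o-up k<j)))))))
    ... | turned κ = subst (λ t → Arc x (x ⊕ o (j + κ)) (x ⊕ o t)) (+-suc j κ)
            (turn-arc σ refl x κ (+-cancelˡ-< j κ a k<) (o-turn κ) (o-turn (suc κ)))

    Arc⇒Adj : ∀ {x u v} → Arc x u v → Adj n s u v
    Arc⇒Adj (long _ _ _ c)     = inj₂ (inj₂ (inj₁ (Cong⇒Step s<n c)))
    Arc⇒Adj (short⁺ _ _ _ _ c) = inj₁ (Cong⇒Step 1<n c)
    Arc⇒Adj (short⁻ _ _ _ _ c) = inj₂ (inj₁ (Cong⇒Step 1<n c))

    private
      steps-agree : ∀ {u v a b} → Cong n (u + a) v → Cong n (u + b) v → Cong n a b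
      steps-agree {u} p q = Cong-cancel u u refl (Cong-trans p (Cong-sym q))

      steps-cancel : ∀ {u v a b} → Cong n (u + a) v → Cong n (v + b) u → Cong n (a + b) 0
      steps-cancel {u} {v} {a} {b} p q = Cong-cancel u u refl
        (subst₂ (Cong n) (+-assoc u a b) (sym (+-identityʳ u))
          (Cong-trans (Cong-+ p (Cong-refl {a = b} refl)) q))

      0<s+ : ∀ t → 0 < s + t
      0<s+ t = <-≤-trans (<-trans (s≤s z≤n) 1<s) (m≤m+n s t)

      2<n : 2 < n
      2<n = <-trans (+-monoˡ-< 1 1<s) s+1<n

    -- Opposite use of an edge would make two of the steps 1, -1, s, -s coincide modulo `n`, or put
    -- both +1 and -1 into paths with the same σ. This is why a displacement and its negative may
    -- share colours in the directed case.
    Arc-reverse : ∀ {x x' u v} → Arc x u v → Arc x' v u → ⊥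
    Arc-reverse (long _ _ _ c)     (long _ _ _ c')      = ¬Cong-0 (0<s+ s) s+s<n (steps-cancel c c')
    Arc-reverse (long _ _ _ c)     (short⁺ _ _ _ _ c')  = ¬Cong-0 (0<s+ 1) s+1<n (steps-cancel c c')
    Arc-reverse (long _ _ _ c)     (short⁻ _ _ _ _ c')  = ¬Cong-s-1 (steps-agree c c')
    Arc-reverse (short⁺ _ _ _ _ c) (long _ _ _ c')      = ¬Cong-0 (0<s+ 1) s+1<n (steps-cancel c' c)
    Arc-reverse (short⁺ _ _ _ _ c) (short⁺ _ _ _ _ c')  = ¬Cong-0 (s≤s z≤n) 2<n (steps-cancel c c')
    Arc-reverse (short⁺ _ refl _ _ _) (short⁻ _ () _ _ _)
    Arc-reverse (short⁻ _ _ _ _ c) (long _ _ _ c')      = ¬Cong-s-1 (steps-agree c' c)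
    Arc-reverse (short⁻ _ refl _ _ _) (short⁺ _ () _ _ _)
    Arc-reverse (short⁻ _ _ _ _ c) (short⁻ _ _ _ _ c')  = ¬Cong-0 (s≤s z≤n) 2<n (steps-cancel c c')

    -- These are the differences that `LineColouring` separates, but still modulo `n`. Keeping κ and
    -- κ' instead of their difference lets each side be bounded by n/2 later.
    data Shift (x x' : Fin n) : Set where
      along : ∀ κ κ' → κ < j → κ' < j → Cong n (toℕ x + κ * s) (toℕ x' + κ' * s) → Shift x x'
      aside : ∀ κ κ' → κ < a → κ' < a → Cong n (toℕ x + κ) (toℕ x' + κ') → Shift x x'

    Arc-shared : ∀ {x x' u v} → Arc x u v → Arc x' u v → Shift x x'
    Arc-shared (long κ κ< p _) (long κ' κ'< p' _) = along κ κ' κ< κ'< (Cong-trans p (Cong-sym p'))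
    Arc-shared (long _ _ _ c)     (short⁺ _ _ _ _ c')  = ⊥-elim (¬Cong-s-1 (steps-agree c c'))
    Arc-shared (long _ _ _ c)     (short⁻ _ _ _ _ c')  = ⊥-elim (¬Cong-0 (0<s+ 1) s+1<n (steps-cancel c c'))
    Arc-shared (short⁺ _ _ _ _ c) (long _ _ _ c')      = ⊥-elim (¬Cong-s-1 (steps-agree c' c))
    Arc-shared (short⁻ _ _ _ _ c) (long _ _ _ c')      = ⊥-elim (¬Cong-0 (0<s+ 1) s+1<n (steps-cancel c' c))
    Arc-shared (short⁺ _ refl _ _ _) (short⁻ _ () _ _ _)
    Arc-shared (short⁻ _ refl _ _ _) (short⁺ _ () _ _ _)
    Arc-shared {x} {x'} (short⁺ κ _ κ< p _) (short⁺ κ' _ κ'< p' _) = aside κ κ' κ< κ'<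
      (Cong-cancel (j * s) (j * s) refl (subst₂ (Cong n) (lem (toℕ x) (j * s) κ) (lem (toℕ x') (j * s) κ')
        (Cong-trans p (Cong-sym p'))))
      where
      lem : ∀ a b c → a + (b + c) ≡ b + (a + c)
      lem = solve-∀
    -- Both paths go back from their turning points to `u`, so x + js ≡ u + κ and x' + js ≡ u + κ';
    -- comparing them exchanges κ and κ'.
    Arc-shared {x} {x'} {u} (short⁻ κ _ κ< p _) (short⁻ κ' _ κ'< p' _) = aside κ' κ κ'< κ<
      (Cong-cancel (toℕ u + j * s) (toℕ u + j * s) refl
        (subst₂ (Cong n) (lem (toℕ x) (j * s) (toℕ u) κ') (lem′ (toℕ x') (j * s) (toℕ u) κ)
          (Cong-+ p (Cong-sym p'))))
      where
      lem : ∀ x b u k → x + b + (u + k) ≡ u + b + (x + k)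
      lem = solve-∀
      lem′ : ∀ x b u k → u + k + (x + b) ≡ u + b + (x + k)
      lem′ = solve-∀

    forward backward : Fin n → List (Fin n)
    forward x  = walk (λ k → x ⊕ o k) (j + a)
    backward x = walk (λ k → x ⊕ o (j + a ∸ k)) (j + a)

    forward-arc : ∀ {x u v} → ArcIn u v (forward x) → Arc x u v
    forward-arc {x} p with walk-arc (λ k → x ⊕ o k) (j + a) p
    ... | k , k< , refl , refl = arc x k k<

    private
      L∸k : ∀ {L k} → k < L → L ∸ k ≡ suc (L ∸ suc k)
      L∸k {L} k<L = +-∸-assoc 1 k<L

      L∸sk< : ∀ {L k} → k < L → L ∸ suc k < L
      L∸sk< {L} {k} k<L = ≤-trans (≤-reflexive (sym (L∸k k<L))) (m∸n≤m L k)

      backArc : ∀ (x : Fin n) k → k < j + a → Arc x (x ⊕ o (j + a ∸ suc k)) (x ⊕ o (j + a ∸ k))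
      backArc x k k< = subst (λ t → Arc x (x ⊕ o (j + a ∸ suc k)) (x ⊕ o t)) (sym (L∸k k<))
        (arc x (j + a ∸ suc k) (L∸sk< k<))

    backward-arc : ∀ {x u v} → ArcIn u v (backward x) → Arc x v u
    backward-arc {x} p with walk-arc (λ k → x ⊕ o (j + a ∸ k)) (j + a) p
    ... | k , k< , refl , refl = backArc x k k<

    forward-isPath : ∀ x → IsPath n s x (x ⊕ ahead σ (j * s) a) (forward x)
    forward-isPath x =
      trans (walk-head (λ k → x ⊕ o k) (j + a)) (cong just (trans (cong (x ⊕_) (o-up {0} z≤n)) (⊕-identityʳ x))) ,
      trans (walk-last (λ k → x ⊕ o k) (j + a)) (cong (λ t → just (x ⊕ t)) (o-turn a)) ,
      walk-linked _ (j + a) (λ k k< → Arc⇒Adj (arc x k k<)) ,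
      walk-unique _ (j + a) (λ k l k<l l≤ eq →
        o-injective k l k<l l≤ (⊕-injective x (o<n (≤-trans (<⇒≤ k<l) l≤)) (o<n l≤) eq))

    backward-isPath : ∀ x → IsPath n s (x ⊕ ahead σ (j * s) a) x (backward x)
    backward-isPath x =
      trans (walk-head f (j + a)) (cong (λ t → just (x ⊕ t)) (o-turn a)) ,
      trans (walk-last f (j + a))
        (cong just (trans (cong (x ⊕_) (trans (cong o (n∸n≡0 (j + a))) (o-up {0} z≤n))) (⊕-identityʳ x))) ,
      walk-linked _ (j + a) (λ k k< → Adj-sym (Arc⇒Adj (backArc x k k<))) ,
      walk-unique _ (j + a) (λ k l k<l l≤ eq →
        o-injective (j + a ∸ l) (j + a ∸ k) (∸-monoʳ-< k<l l≤) (m∸n≤m (j + a) k)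
          (sym (⊕-injective x (o<n (m∸n≤m (j + a) k)) (o<n (m∸n≤m (j + a) l)) eq)))
      where
      f : ℕ → Fin n
      f k = x ⊕ o (j + a ∸ k)

-- Routing and colouring

module Colouring (n s m : ℕ) .{{_ : NonZero n}} .{{_ : NonZero s}} (1<s : 1 < s) (2s<n : 2 * s < n)
                 (2m≤s : 2 * m ≤ s) (s≤2m+1 : s ≤ suc (2 * m)) where

  open Routes n s 1<s 2s<n

  private
    0<m : 0 < m
    0<m = *-cancelˡ-< 2 0 m (≤-pred (≤-trans 1<s s≤2m+1))

  -- A displacement d is written as row * s ± deviation, where e = d + m = row * s + column
  -- and the deviation is the distance from the column to m, at most s / 2.
  row deviation : ℕ → ℕ
  row e       = e / s
  deviation e = ∣ e % s - m ∣

  sign : ℕ → Bool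
  sign e with m ≤? e % s
  ... | yes _ = true
  ... | no _  = false

  private
    deviation≤m : ∀ e → deviation e ≤ m
    deviation≤m e with ≤-total m (e % s)
    ... | inj₁ m≤ = ≤-trans (≤-reflexive (m≤n⇒∣n-m∣≡n∸m m≤))
          (m≤n+o⇒m∸n≤o (e % s) m (≤-trans (≤-pred (≤-trans (m%n<n e s) s≤2m+1))
            (≤-reflexive (cong (m +_) (+-identityʳ m)))))
    ... | inj₂ ≤m = ≤-trans (≤-reflexive (m≤n⇒∣m-n∣≡n∸m ≤m)) (m∸n≤m m (e % s))

    e≡ : ∀ e → row e * s + e % s ≡ e
    e≡ e = trans (+-comm (row e * s) _) (sym (m≡m%n+[m/n]*n e s))

    sign-spec : ∀ e → (sign e ≡ true × m ≤ e % s) ⊎ (sign e ≡ false × e % s < m)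
    sign-spec e with m ≤? e % s
    ... | yes m≤ = inj₁ (refl , m≤)
    ... | no m≰  = inj₂ (refl , ≰⇒> m≰)

    ahead≡ : ∀ d → 0 < d → ahead (sign (d + m)) (row (d + m) * s) (deviation (d + m)) ≡ d
    ahead≡ d 0<d with sign-spec (d + m)
    ... | inj₁ (σ≡ , m≤) = trans (cong (λ σ → ahead σ (row (d + m) * s) (deviation (d + m))) σ≡) (+-cancelʳ-≡ m _ d (begin
      rs + deviation (d + m) + m       ≡⟨ cong (λ t → rs + t + m) (m≤n⇒∣n-m∣≡n∸m m≤) ⟩
      rs + ((d + m) % s ∸ m) + m       ≡⟨ +-assoc rs _ m ⟩
      rs + ((d + m) % s ∸ m + m)       ≡⟨ cong (rs +_) (m∸n+n≡m m≤) ⟩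
      rs + (d + m) % s                 ≡⟨ e≡ (d + m) ⟩
      d + m                            ∎))
      where
      open ≡-Reasoning
      rs = row (d + m) * s
    ... | inj₂ (σ≡ , u<m) = trans (cong (λ σ → ahead σ (row (d + m) * s) (deviation (d + m))) σ≡) (begin
      rs ∸ deviation (d + m)              ≡⟨ cong (rs ∸_) (m≤n⇒∣m-n∣≡n∸m u≤m) ⟩
      rs ∸ (m ∸ u)                        ≡⟨ [m+n]∸[m+o]≡n∸o u rs (m ∸ u) ⟨
      (u + rs) ∸ (u + (m ∸ u))            ≡⟨ cong₂ _∸_ (trans (+-comm u rs) (e≡ (d + m))) (m+[n∸m]≡n u≤m) ⟩
      d + m ∸ m                           ≡⟨ m+n∸n≡m d m ⟩
      d                                   ∎)
      where
      open ≡-Reasoning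
      rs = row (d + m) * s
      u = (d + m) % s
      u≤m : u ≤ m
      u≤m = <⇒≤ u<m

    sign-false : ∀ e → sign e ≡ false → e % s < m
    sign-false e eq with sign-spec e
    ... | inj₂ (_ , u<m)   = u<m
    ... | inj₁ (σ≡ , _) with () ← trans (sym σ≡) eq

  -- The proofs are irrelevant arguments, so the route depends on `d` alone and two classes with
  -- equal `d` share one `Path`; decidability recovers the proofs inside.
  turn : ∀ d → .(0 < d) → .(2 * d ≤ n) → Turn (sign (d + m)) (row (d + m)) (deviation (d + m))
  turn d 0<d′ 2d≤n′ = record
    { 2a≤s   = ≤-trans (*-monoʳ-≤ 2 (deviation≤m (d + m))) 2m≤s
    ; 2js≤   = begin
        2 * (row (d + m) * s)   ≤⟨ *-monoʳ-≤ 2 (m/n*n≤m (d + m) s) ⟩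
        2 * (d + m)             ≡⟨ *-distribˡ-+ 2 d m ⟩
        2 * d + 2 * m           ≤⟨ +-mono-≤ 2d≤n 2m≤s ⟩
        n + s                   ∎
    ; back⇒j = λ eq → n≢0⇒n>0 (λ j≡0 → <⇒≱ (sign-false (d + m) eq) (begin
        m                           ≤⟨ m≤n+m m d ⟩
        d + m                       ≡⟨ e≡ (d + m) ⟨
        row (d + m) * s + (d + m) % s ≡⟨ cong (λ t → t * s + (d + m) % s) j≡0 ⟩
        (d + m) % s                 ∎))
    }
    where
    open ≤-Reasoning
    0<d : 0 < d
    0<d = recompute (0 <? d) 0<d′
    2d≤n : 2 * d ≤ n
    2d≤n = recompute (2 * d ≤? n) 2d≤n′

  -- The maximum with 1 covers deviation 0, where there is no short step but `LineColouring` still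
  -- needs a nonzero block length.
  spacing paletteSize : ℕ → ℕ
  spacing e     = 1 ⊔ deviation e
  paletteSize e = 2 * spacing e ⊔ row e

  instance
    spacing-nonZero : ∀ {e} → NonZero (spacing e)
    spacing-nonZero {e} = >-nonZero (m≤m⊔n 1 (deviation e))

    paletteSize-nonZero : ∀ {e} → NonZero (paletteSize e)
    paletteSize-nonZero {e} = >-nonZero (≤-trans (m≤m⊔n 1 (deviation e))
      (≤-trans (m≤m+n (spacing e) _) (m≤m⊔n (2 * spacing e) (row e))))

  private
    2spacing≤s : ∀ e → 2 * spacing e ≤ s
    2spacing≤s e = ≤-trans (*-monoʳ-≤ 2 (⊔-lub 0<m (deviation≤m e))) 2m≤s

    module Line (e : ℕ) = LineColouring s (spacing e) (paletteSize e)
                                   (2spacing≤s e) (m≤m⊔n (2 * spacing e) (row e))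

  half : Fin n → ℕ
  half z with 2 * toℕ z <? n
  ... | yes _ = 0
  ... | no _  = 1

  localColour : ℕ → Fin n → ℕ
  localColour e z = half z * paletteSize e + Line.lineColour e (toℕ z)

  private
    half≤1 : ∀ z → half z ≤ 1
    half≤1 z with 2 * toℕ z <? n
    ... | yes _ = z≤n
    ... | no _  = ≤-refl

    half-near : ∀ x x' → half x ≡ half x' → 2 * toℕ x < 2 * toℕ x' + n
    half-near x x' eq with 2 * toℕ x <? n | 2 * toℕ x' <? n
    ... | yes p | _     = <-≤-trans p (m≤n+m n _)
    half-near x x' () | no _ | yes _
    half-near x x' eq | no p | no p' = begin-strict
      2 * toℕ x             ≡⟨ cong (toℕ x +_) (+-identityʳ _) ⟩
      toℕ x + toℕ x         <⟨ +-mono-< (toℕ<n x) (toℕ<n x) ⟩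
      n + n                 ≤⟨ +-monoˡ-≤ n (≮⇒≥ p') ⟩
      2 * toℕ x' + n        ∎
      where open ≤-Reasoning

  localColour< : ∀ e z → localColour e z < 2 * paletteSize e
  localColour< e z = begin-strict
    half z * paletteSize e + Line.lineColour e (toℕ z)  <⟨ +-monoʳ-< _ (Line.lineColour<M e (toℕ z)) ⟩
    half z * paletteSize e + paletteSize e    ≤⟨ +-monoˡ-≤ _ (*-monoˡ-≤ (paletteSize e) (half≤1 z)) ⟩
    1 * paletteSize e + paletteSize e         ≡⟨ +-comm (1 * paletteSize e) _ ⟩
    2 * paletteSize e                         ∎
    where open ≤-Reasoning

  private
    -- Bases less than n/2 apart and shifts of at most n/2 leave the two sides less than `n` apart.
    near⇒≡ : ∀ (x x' : Fin n) A B → half x ≡ half x' → 2 * A ≤ n → 2 * B ≤ n →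
      Cong n (toℕ x + A) (toℕ x' + B) → toℕ x + A ≡ toℕ x' + B
    near⇒≡ x x' A B h 2A≤n 2B≤n = Cong⇒≡ (close x x' A B h 2A≤n) (close x' x B A (sym h) 2B≤n)
      where
      close : ∀ (x x' : Fin n) A B → half x ≡ half x' → 2 * A ≤ n → toℕ x + A < toℕ x' + B + n
      close x x' A B h 2A≤n = *-cancelˡ-< 2 _ _ (begin-strict
        2 * (toℕ x + A)            ≡⟨ *-distribˡ-+ 2 (toℕ x) A ⟩
        2 * toℕ x + 2 * A          <⟨ +-mono-<-≤ (half-near x x' h) 2A≤n ⟩
        2 * toℕ x' + n + n         ≤⟨ m≤m+n _ (2 * B) ⟩
        2 * toℕ x' + n + n + 2 * B ≡⟨ lem (toℕ x') n B ⟩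
        2 * (toℕ x' + B + n)       ∎)
        where
        open ≤-Reasoning
        lem : ∀ x n b → 2 * x + n + n + 2 * b ≡ 2 * (x + b + n)
        lem = solve-∀

  localColour-≢ : ∀ d .(0<d : 0 < d) .(2d≤n : 2 * d ≤ n) {x x'} → Path.Shift (turn d 0<d 2d≤n) x x' →
    x ≢ x' → localColour (d + m) x ≢ localColour (d + m) x'
  localColour-≢ d 0<d 2d≤n {x} {x'} shift x≢x' eq = go shift
    where
    module P = Path (turn d 0<d 2d≤n)
    open Turn (turn d 0<d 2d≤n)
    e M j a : ℕ
    e = d + m
    M = paletteSize e
    j = row e
    a = deviation e
    coords : ∀ z → (localColour e z / M ≡ half z) × (localColour e z % M ≡ Line.lineColour e (toℕ z))
    coords z = /%-unique M (Line.lineColour<M e (toℕ z))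
    half≡ : half x ≡ half x'
    half≡ = trans (sym (proj₁ (coords x))) (trans (cong (_/ M) eq) (proj₁ (coords x')))
    line≡ : Line.lineColour e (toℕ x) ≡ Line.lineColour e (toℕ x')
    line≡ = trans (sym (proj₂ (coords x))) (trans (cong (_% M) eq) (proj₂ (coords x')))
    s≤n : s ≤ n
    s≤n = ≤-trans (m≤m+n s _) (<⇒≤ 2s<n)

    column-clash : ∀ (x x' : Fin n) κ κ' → κ < κ' → κ' < j → Line.lineColour e (toℕ x) ≡ Line.lineColour e (toℕ x') →
      toℕ x + κ * s ≡ toℕ x' + κ' * s → ⊥
    column-clash x x' κ κ' κ<κ' κ'<j l≡ p = Line.lineColour-column e (toℕ x') (κ' ∸ κ) (m<n⇒0<n∸m κ<κ')
      (≤-<-trans (m∸n≤m κ' κ) (<-≤-trans κ'<j (m≤n⊔m (2 * spacing e) j)))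
      (trans (sym l≡) (cong (Line.lineColour e) (+-cancelʳ-≡ (κ * s) _ _ (trans p (begin
        toℕ x' + κ' * s                      ≡⟨ cong (λ t → toℕ x' + t * s) (m∸n+n≡m (<⇒≤ κ<κ')) ⟨
        toℕ x' + (κ' ∸ κ + κ) * s            ≡⟨ cong (toℕ x' +_) (*-distribʳ-+ s (κ' ∸ κ) κ) ⟩
        toℕ x' + ((κ' ∸ κ) * s + κ * s)      ≡⟨ +-assoc (toℕ x') _ _ ⟨
        toℕ x' + (κ' ∸ κ) * s + κ * s        ∎)))))
      where open ≡-Reasoning

    row-clash : ∀ (x x' : Fin n) κ κ' → κ < κ' → κ' < a → Line.lineColour e (toℕ x) ≡ Line.lineColour e (toℕ x') →
      toℕ x + κ ≡ toℕ x' + κ' → ⊥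
    row-clash x x' κ κ' κ<κ' κ'<a l≡ p = Line.lineColour-row e (toℕ x') (κ' ∸ κ) (m<n⇒0<n∸m κ<κ')
      (≤-<-trans (m∸n≤m κ' κ) (<-≤-trans κ'<a (m≤n⊔m 1 a)))
      (trans (sym l≡) (cong (Line.lineColour e) (+-cancelʳ-≡ κ _ _ (trans p (begin
        toℕ x' + κ'              ≡⟨ cong (toℕ x' +_) (m∸n+n≡m (<⇒≤ κ<κ')) ⟨
        toℕ x' + (κ' ∸ κ + κ)    ≡⟨ +-assoc (toℕ x') _ _ ⟨
        toℕ x' + (κ' ∸ κ) + κ    ∎)))))
      where open ≡-Reasoning

    -- The bound `2js≤` exceeds `n` by `s`; κ < j frees 2 s, which absorbs the excess.
    2κs≤n : ∀ {κ} → κ < j → 2 * (κ * s) ≤ n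
    2κs≤n {κ} κ<j = +-cancelʳ-≤ s _ _ (begin
      2 * (κ * s) + s         ≤⟨ +-monoʳ-≤ (2 * (κ * s)) (m≤m+n s _) ⟩
      2 * (κ * s) + 2 * s     ≡⟨ lem κ s ⟩
      2 * (suc κ * s)         ≤⟨ *-monoʳ-≤ 2 (*-monoˡ-≤ s κ<j) ⟩
      2 * (j * s)             ≤⟨ 2js≤ ⟩
      n + s                   ∎)
      where
      open ≤-Reasoning
      lem : ∀ k s → 2 * (k * s) + 2 * s ≡ 2 * (suc k * s)
      lem = solve-∀

    2κ≤n : ∀ {κ} → κ < a → 2 * κ ≤ n
    2κ≤n κ<a = ≤-trans (*-monoʳ-≤ 2 (<⇒≤ κ<a)) (≤-trans 2a≤s s≤n)

    go : P.Shift x x' → ⊥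
    go (P.along κ κ' κ<j κ'<j c) with near⇒≡ x x' _ _ half≡ (2κs≤n κ<j) (2κs≤n κ'<j) c | <-cmp κ κ'
    ... | p | tri< κ<κ' _ _ = column-clash x x' κ κ' κ<κ' κ'<j line≡ p
    ... | p | tri≈ _ refl _ = x≢x' (toℕ-injective (+-cancelʳ-≡ (κ * s) _ _ p))
    ... | p | tri> _ _ κ'<κ = column-clash x' x κ' κ κ'<κ κ<j (sym line≡) (sym p)
    go (P.aside κ κ' κ<a κ'<a c) with near⇒≡ x x' _ _ half≡ (2κ≤n κ<a) (2κ≤n κ'<a) c | <-cmp κ κ'
    ... | p | tri< κ<κ' _ _ = row-clash x x' κ κ' κ<κ' κ'<a line≡ p
    ... | p | tri≈ _ refl _ = x≢x' (toℕ-injective (+-cancelʳ-≡ κ _ _ p))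
    ... | p | tri> _ _ κ'<κ = row-clash x' x κ' κ κ'<κ κ<a (sym line≡) (sym p)

  -- The pair (x , y) is the displacement d from base, or the reverse of it.
  record Class : Set where
    constructor mkClass
    field
      fwd  : Bool
      d    : ℕ
      base : Fin n
      .0<d  : 0 < d
      .2d≤n : 2 * d ≤ n

  Joins : Class → Fin n → Fin n → Set
  Joins (mkClass true  d z _ _) x y = z ≡ x × z ⊕ d ≡ y
  Joins (mkClass false d z _ _) x y = z ≡ y × z ⊕ d ≡ x

  private
    -- Both ordered pairs receive the same `d` and base and differ only in `fwd`, so their paths are
    -- reverses of each other. The base is the end from which the shorter way round goes upwards.
    gap : ∀ (x y : Fin n) → toℕ x < toℕ y →
      Σ Class (λ c → Joins c x y) × Σ Class (λ c → Joins c y x)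
    gap x y x<y with 2 * (toℕ y ∸ toℕ x) ≤? n
    ... | yes 2δ≤n =
        (mkClass true  (toℕ y ∸ toℕ x) x (m<n⇒0<n∸m x<y) 2δ≤n , refl , x⊕)
      , (mkClass false (toℕ y ∸ toℕ x) x (m<n⇒0<n∸m x<y) 2δ≤n , refl , x⊕)
      where
      x⊕ : x ⊕ (toℕ y ∸ toℕ x) ≡ y
      x⊕ = ⊕-unique {x = x} {y} {toℕ y ∸ toℕ x} (Cong-refl (m+[n∸m]≡n (<⇒≤ x<y)))
    ... | no 2δ≰n =
        (mkClass false (n ∸ δ) y (m<n⇒0<n∸m δ<n) 2δ′≤n , refl , y⊕)
      , (mkClass true  (n ∸ δ) y (m<n⇒0<n∸m δ<n) 2δ′≤n , refl , y⊕)
      where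
      δ : ℕ
      δ = toℕ y ∸ toℕ x
      δ<n : δ < n
      δ<n = ≤-<-trans (m∸n≤m (toℕ y) (toℕ x)) (toℕ<n y)
      2δ′≤n : 2 * (n ∸ δ) ≤ n
      2δ′≤n = begin
        2 * (n ∸ δ)        ≡⟨ *-distribˡ-∸ 2 n δ ⟩
        2 * n ∸ 2 * δ      ≤⟨ ∸-monoʳ-≤ (2 * n) (<⇒≤ (≰⇒> 2δ≰n)) ⟩
        2 * n ∸ n          ≡⟨ m+n∸m≡n n (n + 0) ⟩
        n + 0              ≡⟨ +-identityʳ n ⟩
        n                  ∎
        where open ≤-Reasoning
      y⊕ : y ⊕ (n ∸ δ) ≡ x
      y⊕ = ⊕-unique {x = y} {x} {n ∸ δ} (0 , 1 , (begin
        toℕ y + (n ∸ δ) + 0       ≡⟨ +-identityʳ _ ⟩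
        toℕ y + (n ∸ δ)           ≡⟨ cong (_+ (n ∸ δ)) (m+[n∸m]≡n (<⇒≤ x<y)) ⟨
        toℕ x + δ + (n ∸ δ)       ≡⟨ +-assoc (toℕ x) δ _ ⟩
        toℕ x + (δ + (n ∸ δ))     ≡⟨ cong (toℕ x +_) (m+[n∸m]≡n (<⇒≤ δ<n)) ⟩
        toℕ x + n                 ≡⟨ cong (toℕ x +_) (+-identityʳ n) ⟨
        toℕ x + 1 * n             ∎))
        where open ≡-Reasoning

  classify : Fin n → Fin n → Class
  classify x y with <-cmp (toℕ x) (toℕ y)
  ... | tri< x<y _ _ = proj₁ (proj₁ (gap x y x<y))
  -- A default for the diagonal, which no conflict condition inspects.
  ... | tri≈ _ _ _   = mkClass true 1 x ≤-refl (≤-trans (*-monoʳ-≤ 2 (<⇒≤ 1<s)) (<⇒≤ 2s<n))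
  ... | tri> _ _ y<x = proj₁ (proj₂ (gap y x y<x))

  classify-joins : ∀ {x y} → x ≢ y → Joins (classify x y) x y
  classify-joins {x} {y} x≢y with <-cmp (toℕ x) (toℕ y)
  ... | tri< x<y _ _ = proj₂ (proj₁ (gap x y x<y))
  ... | tri≈ _ x≡y _ = ⊥-elim (x≢y (toℕ-injective x≡y))
  ... | tri> _ _ y<x = proj₂ (proj₂ (gap y x y<x))

  path : Class → List (Fin n)
  path (mkClass true  d z 0<d 2d≤n) = Path.forward (turn d 0<d 2d≤n) z
  path (mkClass false d z 0<d 2d≤n) = Path.backward (turn d 0<d 2d≤n) z

  path-isPath : ∀ c {x y} → Joins c x y → IsPath n s x y (path c)
  path-isPath (mkClass true d z 0<d 2d≤n) (refl , refl) =
    subst (λ t → IsPath n s z (z ⊕ t) (Path.forward (turn d 0<d 2d≤n) z))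
      (ahead≡ d (recompute (0 <? d) 0<d)) (Path.forward-isPath (turn d 0<d 2d≤n) z)
  path-isPath (mkClass false d z 0<d 2d≤n) (refl , refl) =
    subst (λ t → IsPath n s (z ⊕ t) z (Path.backward (turn d 0<d 2d≤n) z))
      (ahead≡ d (recompute (0 <? d) 0<d)) (Path.backward-isPath (turn d 0<d 2d≤n) z)

  routing : Routing n s
  routing = (λ x y → path (classify x y)) , λ x y x≢y → path-isPath (classify x y) (classify-joins x≢y)

  -- Indexed by e = d + m, row j is the interval from js to (j + 1)s. The entries e ≤ m come from no
  -- positive displacement and stay empty, so that sums can start at 0 and be cut into rows.
  classSize : ℕ → ℕ
  classSize e with e ≤? m
  ... | yes _ = 0
  ... | no _  = 2 * paletteSize e

  colourCount : ℕ
  colourCount = sum< classSize (suc (n / 2 + m))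

  private
    classSize≡ : ∀ {d} → 0 < d → classSize (d + m) ≡ 2 * paletteSize (d + m)
    classSize≡ {d} 0<d with d + m ≤? m
    ... | yes d+m≤m = ⊥-elim (<⇒≱ (m<n+m m {d} 0<d) d+m≤m)
    ... | no _      = refl

  colour : Class → ℕ
  colour (mkClass _ d z _ _) = sum< classSize (d + m) + localColour (d + m) z

  private
    localColour<classSize : ∀ d z → .(0 < d) → localColour (d + m) z < classSize (d + m)
    localColour<classSize d z 0<d = <-≤-trans (localColour< (d + m) z)
      (≤-reflexive (sym (classSize≡ (recompute (0 <? d) 0<d))))

  colour< : ∀ c → colour c < colourCount
  colour< (mkClass _ d z 0<d 2d≤n) = block-< classSize
    (s≤s (+-monoˡ-≤ m (≤-trans (≤-reflexive (sym (m*n/n≡m d 2)))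
      (/-monoˡ-≤ 2 (≤-trans (≤-reflexive (*-comm d 2)) (recompute (2 * d ≤? n) 2d≤n))))))
    (localColour<classSize d z 0<d)

  private
    -- The blocks of different displacements are disjoint, so equal colours give equal `d`. Opposite
    -- directions are then excluded by `Arc-reverse`, and equal ones force equal bases by
    -- `localColour-≢`.
    shared-arc : ∀ c c' {u v} → ArcIn u v (path c) → ArcIn u v (path c') → colour c ≡ colour c' →
      Class.fwd c ≡ Class.fwd c' × Class.d c ≡ Class.d c' × Class.base c ≡ Class.base c'
    shared-arc c@(mkClass b d z 0<d 2d≤n) c'@(mkClass b' d' z' 0<d' 2d≤n') A A' eq
      with block-injective classSize (localColour<classSize d z 0<d) (localColour<classSize d' z' 0<d') eq
    ... | d+m≡ , local≡ with +-cancelʳ-≡ m d d' d+m≡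
    shared-arc (mkClass b d z 0<d 2d≤n) (mkClass b' .d z' _ _) A A' eq | _ , local≡ | refl = go b b' A A'
      where
      module P = Path (turn d 0<d 2d≤n)
      base≡ : P.Shift z z' → z ≡ z'
      base≡ sh with z Fin.≟ z'
      ... | yes p = p
      ... | no z≢z' = ⊥-elim (localColour-≢ d 0<d 2d≤n sh z≢z' local≡)
      go : ∀ b b' {u v} → ArcIn u v (path (mkClass b d z 0<d 2d≤n)) →
        ArcIn u v (path (mkClass b' d z' 0<d 2d≤n)) → b ≡ b' × d ≡ d × z ≡ z'
      go true  true  A A' = refl , refl , base≡ (P.Arc-shared (P.forward-arc A) (P.forward-arc A'))
      go false false A A' = refl , refl , base≡ (P.Arc-shared (P.backward-arc A) (P.backward-arc A'))
      go true  false A A' = ⊥-elim (P.Arc-reverse (P.forward-arc A) (P.backward-arc A'))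
      go false true  A A' = ⊥-elim (P.Arc-reverse (P.backward-arc A) (P.forward-arc A'))

    -- Needed for undirected conflicts: the second copy of the colours separates different values of
    -- `fwd`, and `Arc-reverse` settles equal ones.
    reversed-arc : ∀ c c' {u v} → ArcIn u v (path c) → ArcIn v u (path c') → Class.fwd c ≡ Class.fwd c' →
      colour c ≢ colour c'
    reversed-arc (mkClass b d z 0<d 2d≤n) (mkClass b' d' z' 0<d' 2d≤n') A A' b≡ eq
      with block-injective classSize (localColour<classSize d z 0<d) (localColour<classSize d' z' 0<d') eq
    ... | d+m≡ , local≡ with +-cancelʳ-≡ m d d' d+m≡
    reversed-arc (mkClass true  d z 0<d 2d≤n) (mkClass true .d z' _ _)  A A' refl eq | _ | refl =
      Path.Arc-reverse (turn d 0<d 2d≤n) (Path.forward-arc (turn d 0<d 2d≤n) A) (Path.forward-arc (turn d 0<d 2d≤n) A')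
    reversed-arc (mkClass false d z 0<d 2d≤n) (mkClass false .d z' _ _) A A' refl eq | _ | refl =
      Path.Arc-reverse (turn d 0<d 2d≤n) (Path.backward-arc (turn d 0<d 2d≤n) A') (Path.backward-arc (turn d 0<d 2d≤n) A)

    same-pair : ∀ c c' {x y x' y'} → Joins c x y → Joins c' x' y' →
      Class.fwd c ≡ Class.fwd c' × Class.d c ≡ Class.d c' × Class.base c ≡ Class.base c' → x ≡ x' × y ≡ y'
    same-pair (mkClass true  _ _ _ _) (mkClass _ _ _ _ _) (refl , refl) (refl , refl) (refl , refl , refl) = refl , refl
    same-pair (mkClass false _ _ _ _) (mkClass _ _ _ _ _) (refl , refl) (refl , refl) (refl , refl , refl) = refl , refl

  dirColourable : DirColourable n s colourCount
  dirColourable = routing , (λ x y → fromℕ< (colour< (classify x y))) ,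
    λ x y x' y' x≢y x'≢y' ≢pair (u , v , A , A') eq → ≢pair
      (same-pair (classify x y) (classify x' y') (classify-joins x≢y) (classify-joins x'≢y')
        (shared-arc (classify x y) (classify x' y') A A'
          (fromℕ<-injective _ _ (colour< (classify x y)) (colour< (classify x' y')) eq)))

  private
    bit : Bool → ℕ
    bit true  = 0
    bit false = 1

    bit-injective : ∀ b b' → bit b ≡ bit b' → b ≡ b'
    bit-injective true  true  _ = refl
    bit-injective false false _ = refl

    biColour : Class → ℕ
    biColour c = bit (Class.fwd c) * colourCount + colour c

    biColour< : ∀ c → biColour c < 2 * colourCount
    biColour< c@(mkClass true  _ _ _ _) = <-≤-trans (colour< c) (m≤m+n colourCount _)
    biColour< c@(mkClass false _ _ _ _) = ≤-trans (+-monoʳ-< (1 * colourCount) (colour< c))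
      (≤-reflexive (+-comm (1 * colourCount) colourCount))

    biColour-injective : ∀ c c' → biColour c ≡ biColour c' → Class.fwd c ≡ Class.fwd c' × colour c ≡ colour c'
    biColour-injective c c' eq =
        bit-injective _ _ (trans (sym (proj₁ (co c))) (trans (cong (_/ colourCount) eq) (proj₁ (co c'))))
      , trans (sym (proj₂ (co c))) (trans (cong (_% colourCount) eq) (proj₂ (co c')))
      where
      instance
        colourCount-nonZero : NonZero colourCount
        colourCount-nonZero = >-nonZero (≤-<-trans z≤n (colour< c))
      co : ∀ c → (biColour c / colourCount ≡ bit (Class.fwd c)) × (biColour c % colourCount ≡ colour c)
      co c = /%-unique colourCount (colour< c)

  undirColourable : UndirColourable n s (2 * colourCount)
  undirColourable = routing , (λ x y → fromℕ< (biColour< (classify x y))) ,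
    λ x y x' y' x≢y x'≢y' ≢pair conf eq → clash x y x' y' x≢y x'≢y' ≢pair conf
      (biColour-injective (classify x y) (classify x' y')
        (fromℕ<-injective _ _ (biColour< (classify x y)) (biColour< (classify x' y')) eq))
    where
    clash : ∀ x y x' y' → x ≢ y → x' ≢ y' → ¬ (x ≡ x' × y ≡ y') →
      SharesEdge (path (classify x y)) (path (classify x' y')) →
      Class.fwd (classify x y) ≡ Class.fwd (classify x' y') × colour (classify x y) ≡ colour (classify x' y') → ⊥
    clash x y x' y' x≢y x'≢y' ≢pair (u , v , A , inj₁ A') (_ , eq) = ≢pair
      (same-pair (classify x y) (classify x' y') (classify-joins x≢y) (classify-joins x'≢y')
        (shared-arc (classify x y) (classify x' y') A A' eq))
    clash x y x' y' x≢y x'≢y' ≢pair (u , v , A , inj₂ A') (b≡ , eq) =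
      reversed-arc (classify x y) (classify x' y') A A' b≡ eq

-- Counting the colours

sum<-reverse : ∀ (f : ℕ → ℕ) k → sum< (λ u → f (k ∸ u)) k ≡ sum< (f ∘ suc) k
sum<-reverse f zero    = refl
sum<-reverse f (suc k) = trans (sum<-split (λ u → f (suc k ∸ u)) 1 k)
  (trans (cong (f (suc k) +_) (sum<-reverse f k)) (+-comm (f (suc k)) _))

-- This and the next three inequalities are polynomial identities at j = 0. As suc t ∸ suc j = t ∸
-- j, induction on both arguments leads there or to a truncated case.
∸-square₁ : ∀ t j → (suc t ∸ j) * (suc t ∸ j) ≤ (t ∸ j) * (t ∸ j) + (2 * t + 1)
∸-square₁ t zero = ≤-reflexive (lem t)
  where
  lem : ∀ t → suc t * suc t ≡ t * t + (2 * t + 1)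
  lem = solve-∀
∸-square₁ zero (suc j) rewrite 0∸n≡0 j = z≤n
∸-square₁ (suc t) (suc j) = ≤-trans (∸-square₁ t j)
  (+-monoʳ-≤ ((t ∸ j) * (t ∸ j)) (+-monoˡ-≤ 1 (*-monoʳ-≤ 2 (n≤1+n t))))

∸-square₂ : ∀ t j → 4 * (suc t ∸ j) + (t ∸ j) * (t ∸ j) ≤ (2 + t ∸ j) * (2 + t ∸ j)
∸-square₂ t zero = ≤-reflexive (lem t)
  where
  lem : ∀ t → 4 * suc t + t * t ≡ (2 + t) * (2 + t)
  lem = solve-∀
∸-square₂ zero (suc j) rewrite 0∸n≡0 j = z≤n
∸-square₂ (suc t) (suc j) = ∸-square₂ t j

∸-square-convex : ∀ t j →
  (2 + t ∸ j) * (2 + t ∸ j) + (t ∸ j) * (t ∸ j) ≤ 2 * ((suc t ∸ j) * (suc t ∸ j)) + 2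
∸-square-convex t zero = ≤-reflexive (lem t)
  where
  lem : ∀ t → (2 + t) * (2 + t) + t * t ≡ 2 * (suc t * suc t) + 2
  lem = solve-∀
∸-square-convex zero (suc zero)    = s≤s z≤n
∸-square-convex zero (suc (suc j)) rewrite 0∸n≡0 j = z≤n
∸-square-convex (suc t) (suc j) = ∸-square-convex t j

∸-square-AM : ∀ s j → 2 * (s * j) + (s ∸ j) * (s ∸ j) ≤ s * s + j * j
∸-square-AM s zero = ≤-reflexive (lem s)
  where
  lem : ∀ s → 2 * (s * 0) + s * s ≡ s * s + 0
  lem = solve-∀
∸-square-AM zero (suc j) = z≤n
∸-square-AM (suc s) (suc j) = begin
  2 * (suc s * suc j) + (s ∸ j) * (s ∸ j)                  ≡⟨ lem₁ s j ((s ∸ j) * (s ∸ j)) ⟩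
  2 * (s * j) + (s ∸ j) * (s ∸ j) + 2 * (s + j + 1)        ≤⟨ +-monoˡ-≤ _ (∸-square-AM s j) ⟩
  s * s + j * j + 2 * (s + j + 1)                          ≡⟨ lem₂ s j ⟩
  suc s * suc s + suc j * suc j                            ∎
  where
  open ≤-Reasoning
  lem₁ : ∀ s j x → 2 * (suc s * suc j) + x ≡ 2 * (s * j) + x + 2 * (s + j + 1)
  lem₁ = solve-∀
  lem₂ : ∀ s j → s * s + j * j + 2 * (s + j + 1) ≡ suc s * suc s + suc j * suc j
  lem₂ = solve-∀

-- Half the size of the palette of a class in row j at deviation a.
cost : ℕ → ℕ → ℕ
cost j a = j + (2 * (1 ⊔ a) ∸ j)

-- The excesses of 2a over `j` sum to about (2k - j)²/4. Using 2k + 1 in the square makes the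
-- induction step the identity (y + 1)² - (y - 1)² = 4 y with y = 2k + 2 - j, as long as nothing is
-- truncated.
cost-sum : ∀ j k → 4 * sum< (cost j ∘ suc) k ≤ 4 * (k * j) + (suc (2 * k) ∸ j) * (suc (2 * k) ∸ j)
cost-sum j zero    = z≤n
cost-sum j (suc k) = begin
  4 * (sum< (cost j ∘ suc) k + cost j (suc k))
    ≡⟨ *-distribˡ-+ 4 (sum< (cost j ∘ suc) k) _ ⟩
  4 * sum< (cost j ∘ suc) k + 4 * cost j (suc k)
    ≤⟨ +-monoˡ-≤ _ (cost-sum j k) ⟩
  4 * (k * j) + (t ∸ j) * (t ∸ j) + 4 * (j + (2 * suc k ∸ j))
    ≡⟨ cong (λ x → 4 * (k * j) + (t ∸ j) * (t ∸ j) + 4 * (j + (x ∸ j))) (lem₀ k) ⟩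
  4 * (k * j) + (t ∸ j) * (t ∸ j) + 4 * (j + (suc t ∸ j))
    ≡⟨ lem₁ k j ((t ∸ j) * (t ∸ j)) (suc t ∸ j) ⟩
  4 * (suc k * j) + (4 * (suc t ∸ j) + (t ∸ j) * (t ∸ j))
    ≤⟨ +-monoʳ-≤ (4 * (suc k * j)) (∸-square₂ t j) ⟩
  4 * (suc k * j) + (2 + t ∸ j) * (2 + t ∸ j)
    ≡⟨ cong (λ x → 4 * (suc k * j) + (suc x ∸ j) * (suc x ∸ j)) (lem₀ k) ⟨
  4 * (suc k * j) + (suc (2 * suc k) ∸ j) * (suc (2 * suc k) ∸ j)
    ∎
  where
  open ≤-Reasoning
  t : ℕ
  t = suc (2 * k)
  lem₀ : ∀ k → 2 * suc k ≡ suc (suc (2 * k))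
  lem₀ = solve-∀
  lem₁ : ∀ k j x y → 4 * (k * j) + x + 4 * (j + y) ≡ 4 * (suc k * j) + (4 * y + x)
  lem₁ = solve-∀

-- A bound for twice the number of colours in row j ≥ 1. Of the 6, 4 come from deviation 0, whose
-- cost can be j + 1, and 2 from rounding when `s` is even.
rowBound : ℕ → ℕ → ℕ
rowBound s j = 4 * (s * j) + 2 * ((s ∸ j) * (s ∸ j)) + 6

rowBounds : ℕ → ℕ → ℕ
rowBounds s P = sum< (λ j → rowBound s (suc j)) P

-- By `∸-square-AM` each row is at most 2 (s² + j²) + 6; the factor 3 clears the denominator in the
-- sum of the squares j².
3*rowBounds≤₁ : ∀ s P → 3 * rowBounds s P ≤ 6 * (P * (s * s)) + P * (P + 1) * (2 * P + 1) + 18 * P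
3*rowBounds≤₁ s zero    = z≤n
3*rowBounds≤₁ s (suc P) = begin
  3 * (rowBounds s P + rowBound s (suc P))
    ≡⟨ lem₁ (rowBounds s P) (s * suc P) ((s ∸ suc P) * (s ∸ suc P)) ⟩
  3 * rowBounds s P + (6 * (2 * (s * suc P) + (s ∸ suc P) * (s ∸ suc P)) + 18)
    ≤⟨ +-mono-≤ (3*rowBounds≤₁ s P) (+-monoˡ-≤ 18 (*-monoʳ-≤ 6 (∸-square-AM s (suc P)))) ⟩
  6 * (P * (s * s)) + P * (P + 1) * (2 * P + 1) + 18 * P + (6 * (s * s + suc P * suc P) + 18)
    ≡⟨ lem₂ (s * s) P ⟩
  6 * (suc P * (s * s)) + suc P * (suc P + 1) * (2 * suc P + 1) + 18 * suc P
    ∎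
  where
  open ≤-Reasoning
  lem₁ : ∀ r a b → 3 * (r + (4 * a + 2 * b + 6)) ≡ 3 * r + (6 * (2 * a + b) + 18)
  lem₁ = solve-∀
  lem₂ : ∀ c P → 6 * (P * c) + P * (P + 1) * (2 * P + 1) + 18 * P + (6 * (c + suc P * suc P) + 18)
               ≡ 6 * (suc P * c) + suc P * (suc P + 1) * (2 * suc P + 1) + 18 * suc P
  lem₂ = solve-∀

-- Meant for `P` large compared with `s`: by 3 y² + y³ ≤ (y + 1)³ the squares (s - j)² telescope to
-- at most s³/3, whatever `P` is.
3*rowBounds≤₂ : ∀ s P → 3 * rowBounds s P ≤ 6 * (s * (P * (P + 1))) + 18 * P + 2 * (s * s * s)
3*rowBounds≤₂ s P = ≤-trans (m≤m+n _ _) (strong P)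
  where
  cube-step : ∀ t j → 3 * ((t ∸ suc j) * (t ∸ suc j)) + (t ∸ suc j) * (t ∸ suc j) * (t ∸ suc j)
                    ≤ (t ∸ j) * (t ∸ j) * (t ∸ j)
  cube-step zero    j       rewrite 0∸n≡0 j = z≤n
  cube-step (suc t) (suc j) = cube-step t j
  cube-step (suc t) zero    = ≤-trans (m≤m+n _ (3 * t + 1)) (≤-reflexive (lem t))
    where
    lem : ∀ t → 3 * (t * t) + t * t * t + (3 * t + 1) ≡ suc t * suc t * suc t
    lem = solve-∀
  strong : ∀ P → 3 * rowBounds s P + 2 * ((s ∸ P) * (s ∸ P) * (s ∸ P))
               ≤ 6 * (s * (P * (P + 1))) + 18 * P + 2 * (s * s * s)
  strong zero    = ≤-reflexive (lem s)
    where
    lem : ∀ s → 2 * (s * s * s) ≡ 6 * (s * 0) + 0 + 2 * (s * s * s)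
    lem = solve-∀
  strong (suc P) = begin
    3 * (rowBounds s P + rowBound s (suc P)) + 2 * (y * y * y)
      ≡⟨ lem₁ (rowBounds s P) (s * suc P) y ⟩
    3 * rowBounds s P + 2 * (3 * (y * y) + y * y * y) + (12 * (s * suc P) + 18)
      ≤⟨ +-monoˡ-≤ _ (+-monoʳ-≤ (3 * rowBounds s P) (*-monoʳ-≤ 2 (cube-step s P))) ⟩
    3 * rowBounds s P + 2 * ((s ∸ P) * (s ∸ P) * (s ∸ P)) + (12 * (s * suc P) + 18)
      ≤⟨ +-monoˡ-≤ _ (strong P) ⟩
    6 * (s * (P * (P + 1))) + 18 * P + 2 * (s * s * s) + (12 * (s * suc P) + 18)
      ≡⟨ lem₂ s P (2 * (s * s * s)) ⟩
    6 * (s * (suc P * (suc P + 1))) + 18 * suc P + 2 * (s * s * s)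
      ∎
    where
    open ≤-Reasoning
    y : ℕ
    y = s ∸ suc P
    lem₁ : ∀ r a y → 3 * (r + (4 * a + 2 * (y * y) + 6)) + 2 * (y * y * y)
                   ≡ 3 * r + 2 * (3 * (y * y) + y * y * y) + (12 * a + 18)
    lem₁ = solve-∀
    lem₂ : ∀ s P c → 6 * (s * (P * (P + 1))) + 18 * P + c + (12 * (s * suc P) + 18)
                   ≡ 6 * (s * (suc P * (suc P + 1))) + 18 * suc P + c
    lem₂ = solve-∀

module ColourCount (n s m : ℕ) .{{_ : NonZero n}} .{{_ : NonZero s}} (1<s : 1 < s) (2s<n : 2 * s < n)
                   (2m≤s : 2 * m ≤ s) (s≤2m+1 : s ≤ suc (2 * m)) where

  open Colouring n s m 1<s 2s<n 2m≤s s≤2m+1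

  private
    m<s : m < s
    m<s = ≰⇒> λ s≤m → <⇒≱ (<-≤-trans (m<m+n s {s} (<-trans (s≤s z≤n) 1<s)) (≤-reflexive (cong (s +_) (sym (+-identityʳ s)))))
        (≤-trans (*-monoʳ-≤ 2 s≤m) 2m≤s)

    -- The number of columns to the right of `m`: there the deviations are 1, ..., m′, to the left
    -- m, ..., 1.
    m′ : ℕ
    m′ = s ∸ suc m

    s≡ : s ≡ m + suc m′
    s≡ = trans (sym (m+[n∸m]≡n m<s)) (sym (+-suc m m′))

    s-odd-or-even : (m′ ≡ m × s ≡ suc (2 * m)) ⊎ (m ≡ suc m′ × s ≡ suc (suc (2 * m′)))
    s-odd-or-even with m≤n⇒m<n∨m≡n s≤2m+1
    ... | inj₂ s≡2m+1 = inj₁ (trans (cong (_∸ suc m) s≡2m+1) (trans (cong (_∸ m) (cong (m +_) (+-identityʳ m))) (m+n∸m≡n m m))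
                             , s≡2m+1)
    ... | inj₁ s<2m+1 = inj₂ (m≡ , trans s≡ (trans (cong (_+ suc m′) m≡) (lem m′)))
      where
      lem : ∀ k → suc k + suc k ≡ suc (suc (2 * k))
      lem = solve-∀
      m≡ : m ≡ suc m′
      m≡ = sym (+-cancelˡ-≡ m _ _ (trans (sym s≡) (trans (≤-antisym (≤-pred s<2m+1) 2m≤s) (cong (m +_) (+-identityʳ m)))))

    lowDeviations : ∀ (f : ℕ → ℕ) → sum< (λ u → f ∣ u - m ∣) m ≡ sum< (f ∘ suc) m
    lowDeviations f = trans (go m ≤-refl) (sum<-reverse f m)
      where
      go : ∀ k → k ≤ m → sum< (λ u → f ∣ u - m ∣) k ≡ sum< (λ u → f (m ∸ u)) k
      go zero    _   = refl
      go (suc k) k<m = cong₂ _+_ (go k (<⇒≤ k<m)) (cong f (m≤n⇒∣m-n∣≡n∸m (<⇒≤ k<m)))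

    deviations : ∀ (f : ℕ → ℕ) → sum< (λ u → f ∣ u - m ∣) s ≡ sum< (f ∘ suc) m + (f 0 + sum< (f ∘ suc) m′)
    deviations f = begin
      sum< (λ u → f ∣ u - m ∣) s
        ≡⟨ cong (sum< (λ u → f ∣ u - m ∣)) s≡ ⟩
      sum< (λ u → f ∣ u - m ∣) (m + suc m′)
        ≡⟨ sum<-split (λ u → f ∣ u - m ∣) m (suc m′) ⟩
      sum< (λ u → f ∣ u - m ∣) m + sum< (λ k → f ∣ m + k - m ∣) (suc m′)
        ≡⟨ cong₂ _+_ (lowDeviations f) (trans (right (suc m′)) (sum<-split f 1 m′)) ⟩
      sum< (f ∘ suc) m + (f 0 + sum< (f ∘ suc) m′)
        ∎
      where
      open ≡-Reasoning
      right : ∀ k → sum< (λ k → f ∣ m + k - m ∣) k ≡ sum< f k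
      right zero    = refl
      right (suc k) = cong₂ _+_ (right k) (cong f (trans (m≤n⇒∣n-m∣≡n∸m (m≤m+n m k)) (m+n∸m≡n m k)))

    classSize≤ : ∀ j u → u < s → classSize (j * s + u) ≤ 2 * cost j ∣ u - m ∣
    classSize≤ j u u<s with j * s + u ≤? m
    ... | yes _ = z≤n
    ... | no _  = *-monoʳ-≤ 2 (≤-reflexive (begin
        2 * (1 ⊔ ∣ (j * s + u) % s - m ∣) ⊔ (j * s + u) / s
          ≡⟨ cong₂ (λ a b → 2 * (1 ⊔ ∣ a - m ∣) ⊔ b) (proj₂ (/%-unique s {j} u<s)) (proj₁ (/%-unique s {j} u<s)) ⟩
        2 * (1 ⊔ ∣ u - m ∣) ⊔ j      ≡⟨ ⊔-comm _ j ⟩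
        j ⊔ 2 * (1 ⊔ ∣ u - m ∣)      ≡⟨ m⊔n≡m+[n∸m] j _ ⟩
        cost j ∣ u - m ∣             ∎))
      where
      open ≡-Reasoning
      m⊔n≡m+[n∸m] : ∀ a b → a ⊔ b ≡ a + (b ∸ a)
      m⊔n≡m+[n∸m] a b with ≤-total a b
      ... | inj₁ a≤b = trans (m≤n⇒m⊔n≡n a≤b) (sym (m+[n∸m]≡n a≤b))
      ... | inj₂ b≤a = trans (m≥n⇒m⊔n≡m b≤a) (sym (trans (cong (a +_) (m≤n⇒m∸n≡0 b≤a)) (+-identityʳ a)))

    rowSum : ℕ → ℕ
    rowSum j = sum< (λ u → classSize (j * s + u)) s

    rowSum-suc : ∀ j → 2 * rowSum (suc j) ≤ rowBound s (suc j)
    rowSum-suc i = begin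
      2 * rowSum j
        ≤⟨ *-monoʳ-≤ 2 (sum<-mono s (classSize≤ j)) ⟩
      2 * sum< (λ u → 2 * cost j ∣ u - m ∣) s
        ≡⟨ cong (2 *_) (sum<-* 2 (λ u → cost j ∣ u - m ∣) s) ⟩
      2 * (2 * sum< (λ u → cost j ∣ u - m ∣) s)
        ≡⟨ cong (λ x → 2 * (2 * x)) (deviations (cost j)) ⟩
      2 * (2 * (A m + (cost j 0 + A m′)))
        ≡⟨ lem₁ (A m) (cost j 0) (A m′) ⟩
      4 * A m + (4 * cost j 0 + 4 * A m′)
        ≤⟨ +-mono-≤ (cost-sum j m) (+-mono-≤ (*-monoʳ-≤ 4 centre) (cost-sum j m′)) ⟩
      4 * (m * j) + sq m + (4 * (j + 1) + (4 * (m′ * j) + sq m′))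
        ≡⟨ lem₂ m m′ j (sq m) (sq m′) ⟩
      4 * ((m + suc m′) * j) + (sq m + sq m′) + 4
        ≤⟨ +-monoˡ-≤ 4 (+-monoʳ-≤ (4 * ((m + suc m′) * j)) squares) ⟩
      4 * ((m + suc m′) * j) + (2 * ((s ∸ j) * (s ∸ j)) + 2) + 4
        ≡⟨ cong (λ t → 4 * (t * j) + (2 * ((s ∸ j) * (s ∸ j)) + 2) + 4) s≡ ⟨
      4 * (s * j) + (2 * ((s ∸ j) * (s ∸ j)) + 2) + 4
        ≡⟨ lem₃ (4 * (s * j)) (2 * ((s ∸ j) * (s ∸ j))) ⟩
      rowBound s j ∎
      where
      open ≤-Reasoning
      j : ℕ
      j = suc i
      A sq : ℕ → ℕ
      A = sum< (cost j ∘ suc)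
      sq k = (suc (2 * k) ∸ j) * (suc (2 * k) ∸ j)
      centre : cost j 0 ≤ j + 1
      centre = +-monoʳ-≤ j (m∸n≤m 1 i)
      -- For odd `s` both squares are (s - j)². For even `s` they are (s + 1 - j)² and (s - 1 - j)²,
      -- and convexity costs 2.
      squares : sq m + sq m′ ≤ 2 * ((s ∸ j) * (s ∸ j)) + 2
      squares with s-odd-or-even
      ... | inj₁ (m′≡m , s≡2m+1) = ≤-trans (≤-reflexive (trans
              (cong₂ (λ a b → (a ∸ j) * (a ∸ j) + (suc (2 * b) ∸ j) * (suc (2 * b) ∸ j)) (sym s≡2m+1) m′≡m)
              (trans (cong (λ a → (s ∸ j) * (s ∸ j) + (a ∸ j) * (a ∸ j)) (sym s≡2m+1))
                (cong ((s ∸ j) * (s ∸ j) +_) (sym (+-identityʳ _)))))) (m≤m+n _ 2)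
      ... | inj₂ (m≡ , s≡2m′+2) = ≤-trans (≤-reflexive (cong (λ a → (a ∸ j) * (a ∸ j) + sq m′)
              (trans (cong (λ a → suc (2 * a)) m≡) (lem m′))))
            (≤-trans (∸-square-convex (suc (2 * m′)) j)
              (≤-reflexive (cong (λ a → 2 * ((a ∸ j) * (a ∸ j)) + 2) (sym s≡2m′+2))))
        where
        lem : ∀ k → 1 + 2 * suc k ≡ 3 + 2 * k
        lem = solve-∀
      lem₁ : ∀ a b c → 2 * (2 * (a + (b + c))) ≡ 4 * a + (4 * b + 4 * c)
      lem₁ = solve-∀
      lem₂ : ∀ m k j x y → 4 * (m * j) + x + (4 * (j + 1) + (4 * (k * j) + y)) ≡ 4 * ((m + suc k) * j) + (x + y) + 4
      lem₂ = solve-∀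
      lem₃ : ∀ a b → a + (b + 2) + 4 ≡ a + b + 6
      lem₃ = solve-∀

    -- Only the columns beyond `m` carry positive displacements in row 0, so just the deviations 1,
    -- ..., m′ contribute.
    rowSum-zero : 2 * rowSum 0 ≤ s * s
    rowSum-zero = begin
      2 * sum< classSize s
        ≡⟨ cong (λ t → 2 * sum< classSize t) s≡ ⟩
      2 * sum< classSize (m + suc m′)
        ≡⟨ cong (2 *_) (sum<-split classSize m (suc m′)) ⟩
      2 * (sum< classSize m + sum< (λ k → classSize (m + k)) (suc m′))
        ≡⟨ cong (λ x → 2 * (x + sum< (λ k → classSize (m + k)) (suc m′))) (small m ≤-refl) ⟩
      2 * sum< (λ k → classSize (m + k)) (suc m′)
        ≤⟨ *-monoʳ-≤ 2 (sum<-mono (suc m′) large) ⟩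
      2 * sum< g (suc m′)
        ≡⟨ cong (2 *_) (sum<-split g 1 m′) ⟩
      2 * sum< (λ k → 2 * cost 0 (suc k)) m′
        ≡⟨ cong (2 *_) (sum<-* 2 (cost 0 ∘ suc) m′) ⟩
      2 * (2 * sum< (cost 0 ∘ suc) m′)
        ≡⟨ *-assoc 2 2 (sum< (cost 0 ∘ suc) m′) ⟨
      4 * sum< (cost 0 ∘ suc) m′
        ≤⟨ cost-sum 0 m′ ⟩
      4 * (m′ * 0) + suc (2 * m′) * suc (2 * m′)
        ≡⟨ cong (λ x → 4 * x + suc (2 * m′) * suc (2 * m′)) (*-zeroʳ m′) ⟩
      suc (2 * m′) * suc (2 * m′)
        ≤⟨ *-mono-≤ 2m′<s 2m′<s ⟩
      s * s ∎
      where
      open ≤-Reasoning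
      g : ℕ → ℕ
      g zero    = 0
      g (suc k) = 2 * cost 0 (suc k)
      classSize-0 : ∀ {u} → u ≤ m → classSize u ≡ 0
      classSize-0 {u} u≤m with u ≤? m
      ... | yes _  = refl
      ... | no u≰m = ⊥-elim (u≰m u≤m)
      small : ∀ k → k ≤ m → sum< classSize k ≡ 0
      small zero    _   = refl
      small (suc k) k<m = cong₂ _+_ (small k (<⇒≤ k<m)) (classSize-0 (<⇒≤ k<m))
      large : ∀ k → k < suc m′ → classSize (m + k) ≤ g k
      large zero    _ = ≤-reflexive (classSize-0 (≤-reflexive (+-identityʳ m)))
      large (suc k) k< = ≤-trans (classSize≤ 0 (m + suc k) (<-≤-trans (+-monoʳ-< m k<) (≤-reflexive (sym s≡))))
        (≤-reflexive (cong (λ a → 2 * cost 0 a) (trans (m≤n⇒∣n-m∣≡n∸m (m≤m+n m (suc k))) (m+n∸m≡n m (suc k)))))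
      2m′<s : suc (2 * m′) ≤ s
      2m′<s with s-odd-or-even
      ... | inj₁ (m′≡m , s≡2m+1) = ≤-reflexive (trans (cong (λ a → suc (2 * a)) m′≡m) (sym s≡2m+1))
      ... | inj₂ (_ , s≡2m′+2)   = ≤-trans (n≤1+n _) (≤-reflexive (sym s≡2m′+2))

    -- For odd `q` the displacements end in the left half of a row. The term 2 s + 1 pays for
    -- replacing s + 1 by `s` in the square.
    halfRow : ∀ j → 2 * sum< (λ u → classSize (j * s + u)) m ≤ 2 * (s * j) + (s ∸ j) * (s ∸ j) + (2 * s + 1)
    halfRow j = begin
      2 * sum< (λ u → classSize (j * s + u)) m
        ≤⟨ *-monoʳ-≤ 2 (sum<-mono m (λ u u<m → classSize≤ j u (<-trans u<m m<s))) ⟩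
      2 * sum< (λ u → 2 * cost j ∣ u - m ∣) m
        ≡⟨ cong (2 *_) (sum<-* 2 (λ u → cost j ∣ u - m ∣) m) ⟩
      2 * (2 * sum< (λ u → cost j ∣ u - m ∣) m)
        ≡⟨ cong (λ x → 2 * (2 * x)) (lowDeviations (cost j)) ⟩
      2 * (2 * sum< (cost j ∘ suc) m)
        ≡⟨ *-assoc 2 2 (sum< (cost j ∘ suc) m) ⟨
      4 * sum< (cost j ∘ suc) m
        ≤⟨ cost-sum j m ⟩
      4 * (m * j) + (suc (2 * m) ∸ j) * (suc (2 * m) ∸ j)
        ≡⟨ cong (_+ (suc (2 * m) ∸ j) * (suc (2 * m) ∸ j)) (lem m j) ⟩
      2 * (2 * m * j) + (suc (2 * m) ∸ j) * (suc (2 * m) ∸ j)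
        ≤⟨ +-mono-≤ (*-monoʳ-≤ 2 (*-monoˡ-≤ j 2m≤s)) (*-mono-≤ (∸-monoˡ-≤ j (s≤s 2m≤s)) (∸-monoˡ-≤ j (s≤s 2m≤s))) ⟩
      2 * (s * j) + (suc s ∸ j) * (suc s ∸ j)
        ≤⟨ +-monoʳ-≤ (2 * (s * j)) (∸-square₁ s j) ⟩
      2 * (s * j) + ((s ∸ j) * (s ∸ j) + (2 * s + 1))
        ≡⟨ +-assoc (2 * (s * j)) _ _ ⟨
      2 * (s * j) + (s ∸ j) * (s ∸ j) + (2 * s + 1)
        ∎
      where
      open ≤-Reasoning
      lem : ∀ m j → 4 * (m * j) ≡ 2 * (2 * m * j)
      lem = solve-∀

    fullRows : ∀ P → 2 * sum< classSize (suc P * s) ≤ s * s + rowBounds s P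
    fullRows P = begin
      2 * sum< classSize (suc P * s)
        ≡⟨ cong (2 *_) (trans (sum<-blocks classSize s (suc P)) (sum<-split rowSum 1 P)) ⟩
      2 * (rowSum 0 + sum< (rowSum ∘ suc) P)
        ≡⟨ *-distribˡ-+ 2 (rowSum 0) _ ⟩
      2 * rowSum 0 + 2 * sum< (rowSum ∘ suc) P
        ≡⟨ cong (2 * rowSum 0 +_) (sum<-* 2 (rowSum ∘ suc) P) ⟨
      2 * rowSum 0 + sum< (λ j → 2 * rowSum (suc j)) P
        ≤⟨ +-mono-≤ rowSum-zero (sum<-mono P (λ j _ → rowSum-suc j)) ⟩
      s * s + rowBounds s P
        ∎
      where open ≤-Reasoning

    2[n/2]≤n : 2 * (n / 2) ≤ n
    2[n/2]≤n = ≤-trans (≤-reflexive (*-comm 2 (n / 2))) (m/n*n≤m n 2)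

  -- Here n/2 < (P + 1/2) s, and the shift by m ≤ s/2 stays within row `P`.
  colourCount-even : ∀ P r → r < s → n ≡ 2 * P * s + r → 2 * colourCount ≤ s * s + rowBounds s P
  colourCount-even P r r<s n≡ = ≤-trans (*-monoʳ-≤ 2 (sum<-mono-range classSize E≤)) (fullRows P)
    where
    open ≤-Reasoning
    lem₁ : ∀ a m → 2 * suc (a + m) ≡ 2 * a + (2 * m + 2)
    lem₁ = solve-∀
    lem₂ : ∀ P s → 2 * P * s + s + (s + 2) ≡ 2 * suc (suc P * s)
    lem₂ = solve-∀
    E≤ : suc (n / 2 + m) ≤ suc P * s
    E≤ = ≤-pred (*-cancelˡ-< 2 _ _ (begin-strict
      2 * suc (n / 2 + m)             ≡⟨ lem₁ (n / 2) m ⟩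
      2 * (n / 2) + (2 * m + 2)       ≤⟨ +-mono-≤ 2[n/2]≤n (+-monoˡ-≤ 2 2m≤s) ⟩
      n + (s + 2)                     ≡⟨ cong (_+ (s + 2)) n≡ ⟩
      2 * P * s + r + (s + 2)         <⟨ +-monoˡ-< (s + 2) (+-monoʳ-< (2 * P * s) r<s) ⟩
      2 * P * s + s + (s + 2)         ≡⟨ lem₂ P s ⟩
      2 * suc (suc P * s)             ∎))

  -- Here n/2 < (P + 1) s, so the shift by `m` reaches at most `m` columns into row P + 1.
  colourCount-odd : ∀ P r → r < s → n ≡ suc (2 * P) * s + r →
    2 * colourCount ≤ s * s + rowBounds s P + (2 * (s * suc P) + (s ∸ suc P) * (s ∸ suc P) + (2 * s + 1))
  colourCount-odd P r r<s n≡ = begin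
    2 * colourCount
      ≤⟨ *-monoʳ-≤ 2 (sum<-mono-range classSize E≤) ⟩
    2 * sum< classSize (suc P * s + m)
      ≡⟨ cong (2 *_) (sum<-split classSize (suc P * s) m) ⟩
    2 * (sum< classSize (suc P * s) + sum< (λ u → classSize (suc P * s + u)) m)
      ≡⟨ *-distribˡ-+ 2 (sum< classSize (suc P * s)) _ ⟩
    2 * sum< classSize (suc P * s) + 2 * sum< (λ u → classSize (suc P * s + u)) m
      ≤⟨ +-mono-≤ (fullRows P) (halfRow (suc P)) ⟩
    _ ∎
    where
    open ≤-Reasoning
    lem : ∀ P s → suc (2 * P) * s + s ≡ 2 * (suc P * s)
    lem = solve-∀
    E≤ : suc (n / 2 + m) ≤ suc P * s + m
    E≤ = +-monoˡ-≤ m (*-cancelˡ-< 2 (n / 2) _ (begin-strict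
      2 * (n / 2)               ≤⟨ 2[n/2]≤n ⟩
      n                         ≡⟨ n≡ ⟩
      suc (2 * P) * s + r       <⟨ +-monoʳ-< (suc (2 * P) * s) r<s ⟩
      suc (2 * P) * s + s       ≡⟨ lem P s ⟩
      2 * (suc P * s)           ∎))

-- Bounds for 24 times the colour count, from `3*rowBounds≤₁` and `3*rowBounds≤₂`. The lower
-- coefficients are rounded up so that one polynomial serves both parities of `q`.
squareBound longBound : ℕ → ℕ → ℕ
squareBound s q = 12 * (q * (s * s)) + 12 * (s * s) + q * q * q + 3 * (q * q) + 24 * s + 41 * q
longBound s q = 12 * (s * s) + 6 * (s * (q * q)) + 12 * (s * q) + 30 * s + 36 * q + 8 * (s * s * s)

data Parity : ℕ → Set where
  even : ∀ P → Parity (2 * P)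
  odd  : ∀ P → Parity (suc (2 * P))

parity? : ∀ q → Parity q
parity? zero = even 0
parity? (suc q) with parity? q
... | even P = odd P
... | odd P  = subst Parity (cong suc (+-suc P (P + 0))) (even (suc P))

module _ (n s q r : ℕ) .{{_ : NonZero n}} .{{_ : NonZero s}} (1<s : 1 < s) (2s<n : 2 * s < n)
         (m : ℕ) (2m≤s : 2 * m ≤ s) (s≤2m+1 : s ≤ suc (2 * m))
         (r<s : r < s) (n≡ : n ≡ q * s + r) where

  open Colouring n s m 1<s 2s<n 2m≤s s≤2m+1 using (colourCount)
  open ColourCount n s m 1<s 2s<n 2m≤s s≤2m+1

  colourCount≤squareBound : 24 * colourCount ≤ squareBound s q
  colourCount≤squareBound with parity? q
  ... | even P = begin
      24 * colourCount
        ≡⟨ *-assoc 12 2 colourCount ⟩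
      12 * (2 * colourCount)
        ≤⟨ *-monoʳ-≤ 12 (colourCount-even P r r<s n≡) ⟩
      12 * (s * s + rowBounds s P)
        ≡⟨ lem₁ (s * s) (rowBounds s P) ⟩
      12 * (s * s) + 4 * (3 * rowBounds s P)
        ≤⟨ +-monoʳ-≤ (12 * (s * s)) (*-monoʳ-≤ 4 (3*rowBounds≤₁ s P)) ⟩
      12 * (s * s) + 4 * (6 * (P * (s * s)) + P * (P + 1) * (2 * P + 1) + 18 * P)
        ≤⟨ m≤m+n _ (24 * s + 6 * P) ⟩
      12 * (s * s) + 4 * (6 * (P * (s * s)) + P * (P + 1) * (2 * P + 1) + 18 * P) + (24 * s + 6 * P)
        ≡⟨ lem₂ s P ⟩
      squareBound s (2 * P) ∎
    where
    open ≤-Reasoning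
    lem₁ : ∀ a b → 12 * (a + b) ≡ 12 * a + 4 * (3 * b)
    lem₁ = solve-∀
    lem₂ : ∀ s P → 12 * (s * s) + 4 * (6 * (P * (s * s)) + P * (P + 1) * (2 * P + 1) + 18 * P) + (24 * s + 6 * P)
      ≡ 12 * ((2 * P) * (s * s)) + 12 * (s * s) + (2 * P) * (2 * P) * (2 * P) + 3 * ((2 * P) * (2 * P)) + 24 * s + 41 * (2 * P)
    lem₂ = solve-∀
  ... | odd P = begin
      24 * colourCount
        ≡⟨ *-assoc 12 2 colourCount ⟩
      12 * (2 * colourCount)
        ≤⟨ *-monoʳ-≤ 12 (colourCount-odd P r r<s n≡) ⟩
      12 * (s * s + rowBounds s P + (2 * (s * suc P) + (s ∸ suc P) * (s ∸ suc P) + (2 * s + 1)))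
        ≡⟨ lem₁ (s * s) (rowBounds s P) (2 * (s * suc P) + (s ∸ suc P) * (s ∸ suc P)) (2 * s + 1) ⟩
      12 * (s * s) + 12 * (2 * s + 1) + (4 * (3 * rowBounds s P) + 12 * (2 * (s * suc P) + (s ∸ suc P) * (s ∸ suc P)))
        ≤⟨ +-monoʳ-≤ (12 * (s * s) + 12 * (2 * s + 1))
             (+-mono-≤ (*-monoʳ-≤ 4 (3*rowBounds≤₁ s P)) (*-monoʳ-≤ 12 (∸-square-AM s (suc P)))) ⟩
      12 * (s * s) + 12 * (2 * s + 1) + (4 * (6 * (P * (s * s)) + P * (P + 1) * (2 * P + 1) + 18 * P)
        + 12 * (s * s + suc P * suc P))
        ≤⟨ m≤m+n _ 21 ⟩
      12 * (s * s) + 12 * (2 * s + 1) + (4 * (6 * (P * (s * s)) + P * (P + 1) * (2 * P + 1) + 18 * P)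
        + 12 * (s * s + suc P * suc P)) + 21
        ≡⟨ lem₂ s P ⟩
      squareBound s (suc (2 * P)) ∎
    where
    open ≤-Reasoning
    lem₁ : ∀ a b c d → 12 * (a + b + (c + d)) ≡ 12 * a + 12 * d + (4 * (3 * b) + 12 * c)
    lem₁ = solve-∀
    lem₂ : ∀ s P → 12 * (s * s) + 12 * (2 * s + 1) + (4 * (6 * (P * (s * s)) + P * (P + 1) * (2 * P + 1) + 18 * P)
        + 12 * (s * s + suc P * suc P)) + 21
      ≡ 12 * ((suc (2 * P)) * (s * s)) + 12 * (s * s) + (suc (2 * P)) * (suc (2 * P)) * (suc (2 * P))
        + 3 * ((suc (2 * P)) * (suc (2 * P))) + 24 * s + 41 * (suc (2 * P))
    lem₂ = solve-∀

  colourCount≤longBound : 4 * s ≤ q → 24 * colourCount ≤ longBound s q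
  colourCount≤longBound 4s≤q with parity? q
  ... | even P = begin
      24 * colourCount
        ≡⟨ *-assoc 12 2 colourCount ⟩
      12 * (2 * colourCount)
        ≤⟨ *-monoʳ-≤ 12 (colourCount-even P r r<s n≡) ⟩
      12 * (s * s + rowBounds s P)
        ≡⟨ lem₁ (s * s) (rowBounds s P) ⟩
      12 * (s * s) + 4 * (3 * rowBounds s P)
        ≤⟨ +-monoʳ-≤ (12 * (s * s)) (*-monoʳ-≤ 4 (3*rowBounds≤₂ s P)) ⟩
      12 * (s * s) + 4 * (6 * (s * (P * (P + 1))) + 18 * P + 2 * (s * s * s))
        ≤⟨ m≤m+n _ (30 * s) ⟩
      12 * (s * s) + 4 * (6 * (s * (P * (P + 1))) + 18 * P + 2 * (s * s * s)) + 30 * s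
        ≡⟨ lem₂ s P ⟩
      longBound s (2 * P) ∎
    where
    open ≤-Reasoning
    lem₁ : ∀ a b → 12 * (a + b) ≡ 12 * a + 4 * (3 * b)
    lem₁ = solve-∀
    lem₂ : ∀ s P → 12 * (s * s) + 4 * (6 * (s * (P * (P + 1))) + 18 * P + 2 * (s * s * s)) + 30 * s
      ≡ 12 * (s * s) + 6 * (s * ((2 * P) * (2 * P))) + 12 * (s * (2 * P)) + 30 * s + 36 * (2 * P) + 8 * (s * s * s)
    lem₂ = solve-∀
  ... | odd P = begin
      24 * colourCount
        ≡⟨ *-assoc 12 2 colourCount ⟩
      12 * (2 * colourCount)
        ≤⟨ *-monoʳ-≤ 12 (colourCount-odd P r r<s n≡) ⟩
      12 * (s * s + rowBounds s P + (2 * (s * suc P) + (s ∸ suc P) * (s ∸ suc P) + (2 * s + 1)))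
        -- Since 4 s ≤ q, row P + 1 is not below `s` and its square vanishes.
        ≡⟨ cong (λ x → 12 * (s * s + rowBounds s P + (2 * (s * suc P) + x * x + (2 * s + 1)))) (m≤n⇒m∸n≡0 s≤P+1) ⟩
      12 * (s * s + rowBounds s P + (2 * (s * suc P) + 0 + (2 * s + 1)))
        ≡⟨ lem₁ (s * s) (rowBounds s P) (2 * (s * suc P)) (2 * s + 1) ⟩
      12 * (s * s) + 12 * (2 * s + 1) + 12 * (2 * (s * suc P)) + 4 * (3 * rowBounds s P)
        ≤⟨ +-monoʳ-≤ (12 * (s * s) + 12 * (2 * s + 1) + 12 * (2 * (s * suc P))) (*-monoʳ-≤ 4 (3*rowBounds≤₂ s P)) ⟩
      12 * (s * s) + 12 * (2 * s + 1) + 12 * (2 * (s * suc P)) + 4 * (6 * (s * (P * (P + 1))) + 18 * P + 2 * (s * s * s))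
        ≤⟨ m≤m+n _ 24 ⟩
      12 * (s * s) + 12 * (2 * s + 1) + 12 * (2 * (s * suc P)) + 4 * (6 * (s * (P * (P + 1))) + 18 * P + 2 * (s * s * s)) + 24
        ≡⟨ lem₂ s P ⟩
      longBound s (suc (2 * P)) ∎
    where
    open ≤-Reasoning
    s≤P+1 : s ≤ suc P
    s≤P+1 = ≤-pred (*-cancelˡ-< 2 s (suc (suc P)) (begin-strict
      2 * s                  ≤⟨ *-monoˡ-≤ s (s≤s (s≤s (z≤n {2}))) ⟩
      4 * s                  ≤⟨ 4s≤q ⟩
      suc (2 * P)            <⟨ m≤m+n _ 2 ⟩
      suc (suc (2 * P)) + 2  ≡⟨ lem P ⟩
      2 * suc (suc P)        ∎))
      where
      lem : ∀ P → suc (suc (2 * P)) + 2 ≡ 2 * suc (suc P)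
      lem = solve-∀
    lem₁ : ∀ a b c d → 12 * (a + b + (c + 0 + d)) ≡ 12 * a + 12 * d + 12 * c + 4 * (3 * b)
    lem₁ = solve-∀
    lem₂ : ∀ s P → 12 * (s * s) + 12 * (2 * s + 1) + 12 * (2 * (s * suc P))
        + 4 * (6 * (s * (P * (P + 1))) + 18 * P + 2 * (s * s * s)) + 24
      ≡ 12 * (s * s) + 6 * (s * (suc (2 * P) * suc (2 * P))) + 12 * (s * suc (2 * P)) + 30 * s + 36 * suc (2 * P) + 8 * (s * s * s)
    lem₂ = solve-∀

-- Comparison with the upper bounds of (a), (b) and (c)

squareBound≤C : ∀ s q → 1 ≤ s → squareBound s q ≤ q * (q + 2) * (q + 10) + 12 * (s * (s + 2) * (q + 1))
squareBound≤C (suc t) q _ = ≤-trans (m≤m+n _ (9 * (q * q) + 3 * q + 24 * (t * q))) (≤-reflexive (lem t q))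
  where
  lem : ∀ t q → 12 * (q * (suc t * suc t)) + 12 * (suc t * suc t) + q * q * q + 3 * (q * q) + 24 * suc t + 41 * q
          + (9 * (q * q) + 3 * q + 24 * (t * q))
    ≡ q * (q + 2) * (q + 10) + 12 * (suc t * (suc t + 2) * (q + 1))
  lem = solve-∀

-- 5q³ + 8s³ − 12qs² − q³ = 4 (q − s)² (q + 2s).
squareBound≤B : ∀ s q → 2 ≤ s → squareBound s q ≤ q * (q + 2) * (5 * q + 2) + 4 * (s * (s + 2) * (2 * s + 5))
squareBound≤B s q 2≤s = begin
  squareBound s q                ≤⟨ +-monoʳ-≤ base 41q≤ ⟩
  base + (9 * (q * q) + 24 * (s * s) + 16 * s + 4 * q)    ≤⟨ comparison ⟩
  q * (q + 2) * (5 * q + 2) + 4 * (s * (s + 2) * (2 * s + 5)) ∎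
  where
  open ≤-Reasoning
  base : ℕ
  base = 12 * (q * (s * s)) + 12 * (s * s) + q * q * q + 3 * (q * q) + 24 * s
  -- Apart from the nonnegative cubic part, 9q² + 24s² + 16s + 4q is what remains to absorb 41q. The
  -- quadratic 9q² - 37q + 39 is positive at every integer, being 1 at q = 2, and s ≥ 2 pays for the
  -- 39.
  37q≤ : ∀ q → 37 * q ≤ 9 * (q * q) + 39
  37q≤ 0 = z≤n
  37q≤ 1 = ≤ᵇ⇒≤ 37 48 _
  37q≤ 2 = ≤ᵇ⇒≤ 74 75 _
  37q≤ 3 = ≤ᵇ⇒≤ 111 120 _
  37q≤ 4 = ≤ᵇ⇒≤ 148 183 _
  37q≤ (suc (suc (suc (suc (suc k))))) = ≤-trans (m≤m+n _ (9 * (k * k) + 53 * k + 79)) (≤-reflexive (lem k))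
    where
    lem : ∀ k → 37 * (5 + k) + (9 * (k * k) + 53 * k + 79) ≡ 9 * ((5 + k) * (5 + k)) + 39
    lem = solve-∀
  41q≤ : 41 * q ≤ 9 * (q * q) + 24 * (s * s) + 16 * s + 4 * q
  41q≤ = begin
    41 * q                            ≡⟨ *-distribʳ-+ q 37 4 ⟩
    37 * q + 4 * q                    ≤⟨ +-monoˡ-≤ (4 * q) (37q≤ q) ⟩
    9 * (q * q) + 39 + 4 * q          ≤⟨ +-monoˡ-≤ (4 * q) (+-monoʳ-≤ (9 * (q * q)) (≤-trans (≤ᵇ⇒≤ 39 128 _)
                                           (+-mono-≤ (*-monoʳ-≤ 24 (*-mono-≤ 2≤s 2≤s)) (*-monoʳ-≤ 16 2≤s)))) ⟩
    9 * (q * q) + (24 * (s * s) + 16 * s) + 4 * q ≡⟨ cong (_+ 4 * q) (+-assoc (9 * (q * q)) _ _) ⟨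
    9 * (q * q) + 24 * (s * s) + 16 * s + 4 * q ∎
  comparison : base + (9 * (q * q) + 24 * (s * s) + 16 * s + 4 * q)
          ≤ q * (q + 2) * (5 * q + 2) + 4 * (s * (s + 2) * (2 * s + 5))
  comparison with ≤-total s q
  ... | inj₁ s≤q = subst (λ q → 12 * (q * (s * s)) + 12 * (s * s) + q * q * q + 3 * (q * q) + 24 * s
              + (9 * (q * q) + 24 * (s * s) + 16 * s + 4 * q) ≤ q * (q + 2) * (5 * q + 2) + 4 * (s * (s + 2) * (2 * s + 5)))
            (m+[n∸m]≡n s≤q) (≤-trans (m≤m+n _ _) (≤-reflexive (lem s (q ∸ s))))
    where
    lem : ∀ s a → 12 * ((s + a) * (s * s)) + 12 * (s * s) + (s + a) * (s + a) * (s + a) + 3 * ((s + a) * (s + a)) + 24 * s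
              + (9 * ((s + a) * (s + a)) + 24 * (s * s) + 16 * s + 4 * (s + a)) + 4 * (a * a * (3 * s + a))
            ≡ (s + a) * ((s + a) + 2) * (5 * (s + a) + 2) + 4 * (s * (s + 2) * (2 * s + 5))
    lem = solve-∀
  ... | inj₂ q≤s = subst (λ s → 12 * (q * (s * s)) + 12 * (s * s) + q * q * q + 3 * (q * q) + 24 * s
              + (9 * (q * q) + 24 * (s * s) + 16 * s + 4 * q) ≤ q * (q + 2) * (5 * q + 2) + 4 * (s * (s + 2) * (2 * s + 5)))
            (m+[n∸m]≡n q≤s) (≤-trans (m≤m+n _ _) (≤-reflexive (lem q (s ∸ q))))
    where
    lem : ∀ q a → 12 * (q * ((q + a) * (q + a))) + 12 * ((q + a) * (q + a)) + q * q * q + 3 * (q * q) + 24 * (q + a)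
              + (9 * (q * q) + 24 * ((q + a) * (q + a)) + 16 * (q + a) + 4 * q) + 4 * (a * a * (3 * q + 2 * a))
            ≡ q * (q + 2) * (5 * q + 2) + 4 * ((q + a) * ((q + a) + 2) * (2 * (q + a) + 5))
    lem = solve-∀

-- 24 times the upper bound of (a) at ε(q) = 0.
baseA : ℕ → ℕ → ℕ
baseA s q = (s + 2) * (6 * q * q + 3 * q * (s + 4) + s * (4 * s + 10))

-- 6q²s + 3qs² + 4s³ − 12qs² − q³ = (q − s)² (4s − q).
squareBound≤A : ∀ s q → 2 ≤ s → q ≤ 4 * s → squareBound s q ≤ baseA s q
squareBound≤A (suc (suc t)) q (s≤s (s≤s _)) q≤4s = +-cancelʳ-≤ (9 * (q * (s * s))) _ _ (begin
  squareBound s q + 9 * (q * (s * s))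
    ≡⟨ lem₁ s q ⟩
  q * q * q + 9 * (q * (s * s)) + rest
    ≤⟨ +-monoˡ-≤ rest cubic ⟩
  6 * (q * q * s) + 4 * (s * s * s) + rest
    ≤⟨ m≤m+n _ _ ⟩
  6 * (q * q * s) + 4 * (s * s * s) + rest + (9 * (q * q) + 18 * (t * q) + 19 * q + 6 * (t * t) + 20 * t + 16)
    ≡⟨ lem₂ t q ⟩
  baseA s q + 9 * (q * (s * s)) ∎)
  where
  open ≤-Reasoning
  s rest : ℕ
  s = suc (suc t)
  rest = 12 * (q * (s * s)) + 12 * (s * s) + 3 * (q * q) + 24 * s + 41 * q
  lem₁ : ∀ s q → 12 * (q * (s * s)) + 12 * (s * s) + q * q * q + 3 * (q * q) + 24 * s + 41 * q + 9 * (q * (s * s))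
    ≡ q * q * q + 9 * (q * (s * s)) + (12 * (q * (s * s)) + 12 * (s * s) + 3 * (q * q) + 24 * s + 41 * q)
  lem₁ = solve-∀
  lem₂ : ∀ t q → 6 * (q * q * (2 + t)) + 4 * ((2 + t) * (2 + t) * (2 + t))
      + (12 * (q * ((2 + t) * (2 + t))) + 12 * ((2 + t) * (2 + t)) + 3 * (q * q) + 24 * (2 + t) + 41 * q)
      + (9 * (q * q) + 18 * (t * q) + 19 * q + 6 * (t * t) + 20 * t + 16)
    ≡ ((2 + t) + 2) * (6 * q * q + 3 * q * ((2 + t) + 4) + (2 + t) * (4 * (2 + t) + 10)) + 9 * (q * ((2 + t) * (2 + t)))
  lem₂ = solve-∀
  -- This is (q - s)² (4s - q) ≥ 0 without subtraction; for q = s + a it reduces to a³ ≤ 3 a² s.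
  cubic : q * q * q + 9 * (q * (s * s)) ≤ 6 * (q * q * s) + 4 * (s * s * s)
  cubic with ≤-total s q
  ... | inj₂ q≤s = subst (λ s → q * q * q + 9 * (q * (s * s)) ≤ 6 * (q * q * s) + 4 * (s * s * s))
                     (m+[n∸m]≡n q≤s) (≤-trans (m≤m+n _ _) (≤-reflexive (lem q (s ∸ q))))
    where
    lem : ∀ q a → q * q * q + 9 * (q * ((q + a) * (q + a))) + a * a * (3 * q + 4 * a)
                ≡ 6 * (q * q * (q + a)) + 4 * ((q + a) * (q + a) * (q + a))
    lem = solve-∀
  ... | inj₁ s≤q = subst (λ q → q * q * q + 9 * (q * (s * s)) ≤ 6 * (q * q * s) + 4 * (s * s * s))
                     (m+[n∸m]≡n s≤q) (+-cancelʳ-≤ (3 * (a * a * s)) _ _ (begin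
    (s + a) * (s + a) * (s + a) + 9 * ((s + a) * (s * s)) + 3 * (a * a * s)
      ≡⟨ lem s a ⟩
    6 * ((s + a) * (s + a) * s) + 4 * (s * s * s) + a * a * a
      ≤⟨ +-monoʳ-≤ (6 * ((s + a) * (s + a) * s) + 4 * (s * s * s)) (≤-trans (*-monoʳ-≤ (a * a) a≤3s) (≤-reflexive (lem′ (a * a) s))) ⟩
    6 * ((s + a) * (s + a) * s) + 4 * (s * s * s) + 3 * (a * a * s) ∎))
    where
    a : ℕ
    a = q ∸ s
    a≤3s : a ≤ 3 * s
    a≤3s = +-cancelˡ-≤ s _ _ (≤-trans (≤-reflexive (m+[n∸m]≡n s≤q)) q≤4s)
    lem : ∀ s a → (s + a) * (s + a) * (s + a) + 9 * ((s + a) * (s * s)) + 3 * (a * a * s)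
                ≡ 6 * ((s + a) * (s + a) * s) + 4 * (s * s * s) + a * a * a
    lem = solve-∀
    lem′ : ∀ c s → c * (3 * s) ≡ 3 * (c * s)
    lem′ = solve-∀

-- The terms 6 s q² agree, and 3 q s² outweighs the difference 4 s³ because q ≥ 4 s. In terms of b =
-- q - 4 s and t = s - 1 every coefficient of the difference is nonnegative.
longBound≤A : ∀ s q → 1 ≤ s → 4 * s ≤ q → longBound s q ≤ baseA s q
longBound≤A (suc t) q _ 4s≤q = subst (λ q → longBound (suc t) q ≤ baseA (suc t) q) (m+[n∸m]≡n 4s≤q)
  (≤-trans (m≤m+n _ _) (≤-reflexive (lem t (q ∸ 4 * suc t))))
  where
  lem : ∀ t b → 12 * (suc t * suc t) + 6 * (suc t * ((4 * suc t + b) * (4 * suc t + b))) + 12 * (suc t * (4 * suc t + b))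
       + 30 * suc t + 36 * (4 * suc t + b) + 8 * (suc t * suc t * suc t)
       + (3 * (b * t * t) + 8 * (t * t * t) + 12 * (b * b) + 108 * (b * t) + 246 * (t * t) + 93 * b + 410 * t + 172)
     ≡ (suc t + 2) * (6 * (4 * suc t + b) * (4 * suc t + b) + 3 * (4 * suc t + b) * (suc t + 4) + suc t * (4 * suc t + 10))
  lem = solve-∀

-- The cut bound

linked-head : ∀ {A : Set} {R : A → A → Set} {u v xs} → Linked R (u ∷ v ∷ xs) → R u v
linked-head (r ∷ _) = r

linked-tail : ∀ {A : Set} {R : A → A → Set} {u v xs} → Linked R (u ∷ v ∷ xs) → Linked R (v ∷ xs)
linked-tail (_ ∷ l) = l

crossing : ∀ {A : Set} {E : A → A → Set} {P : A → Set} → Decidable P → ∀ {x y} p →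
  head p ≡ just x → last p ≡ just y → Linked E p → P x → ¬ P y →
  ∃₂ λ u v → ArcIn u v p × E u v × P u × ¬ P v
crossing {E = E} {P} P? {x} {y} (u ∷ xs) refl = go u xs
  where
  go : ∀ u xs → last (u ∷ xs) ≡ just y → Linked E (u ∷ xs) → P u → ¬ P y →
    ∃₂ λ u' v → ArcIn u' v (u ∷ xs) × E u' v × P u' × ¬ P v
  go u []       refl lk Pu ¬Py = ⊥-elim (¬Py Pu)
  go u (v ∷ xs) lt   lk Pu ¬Py with P? v | go v xs lt (linked-tail lk)
  ... | no ¬Pv | _  = u , v , here , linked-head lk , Pu , ¬Pv
  ... | yes Pv | ih with ih Pv ¬Py
  ...   | u' , v' , arc , rest = u' , v' , there arc , rest

OrientedIn : {A : Set} → Bool → A → A → List A → Set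
OrientedIn true  u v p = ArcIn u v p
OrientedIn false u v p = ArcIn v u p

-- `D` is the number of directions counted together: 1 for arcs, and 2 for edges, where paths
-- crossing in opposite directions also conflict. This produces the factor 1/2 in w/2.
module Cut (n s : ℕ) .{{_ : NonZero n}} (2s<n : 2 * s < n) (1<n : 1 < n)
           (D : ℕ) (orient : Fin D → Bool) (orient-injective : ∀ t t' → orient t ≡ orient t' → t ≡ t')
           (Conf : List (Fin n) → List (Fin n) → Set)
           (conf : ∀ t t' {u v p p'} → OrientedIn (orient t) u v p → OrientedIn (orient t') u v p' → Conf p p')
           (k : ℕ) (R : Routing n s) (c : Fin n → Fin n → Fin k) (cf : ConflictFree Conf (proj₁ R) c) where

  h : ℕ
  h = n / 2

  private
    2h≤n : h + h ≤ n
    2h≤n = ≤-trans (≤-reflexive (trans (cong (h +_) (sym (+-identityʳ h))) (*-comm 2 h))) (m/n*n≤m n 2)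

    0<h : 0 < h
    0<h = m≥n⇒m/n>0 1<n

    h<n : h < n
    h<n = <-≤-trans (m<m+n h {h} 0<h) 2h≤n

    s≤h : s ≤ h
    s≤h = ≤-trans (≤-reflexive (sym (m*n/n≡m s 2))) (/-monoˡ-≤ 2 (≤-trans (≤-reflexive (*-comm s 2)) (<⇒≤ 2s<n)))

  -- The indices number the 2 (s + 1) edges of the cut: the first tells whether the crossing is at
  -- `h` or at 0, the second separates the edge of length 1 from the `s` long ones.
  data CutArc (u v : Fin n) : Fin 2 → Fin (suc s) → Set where
    near-1 : suc (toℕ u) ≡ h → toℕ v ≡ h → CutArc u v zero zero
    near-s : ∀ κ → toℕ v ≡ h + toℕ κ → toℕ u + s ≡ toℕ v → CutArc u v zero (suc κ)
    far-1  : toℕ u ≡ 0 → suc (toℕ v) ≡ n → CutArc u v (suc zero) zero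
    far-s  : ∀ κ → toℕ u ≡ toℕ κ → toℕ v + s ≡ toℕ u + n → CutArc u v (suc zero) (suc κ)

  cutArc-injective : ∀ {u v u' v' i κ} → CutArc u v i κ → CutArc u' v' i κ → u ≡ u' × v ≡ v'
  cutArc-injective (near-1 p q) (near-1 p' q') =
    toℕ-injective (suc-injective (trans p (sym p'))) , toℕ-injective (trans q (sym q'))
  cutArc-injective (near-s κ p q) (near-s .κ p' q') =
    toℕ-injective (+-cancelʳ-≡ s _ _ (trans q (trans v≡ (sym q')))) , toℕ-injective v≡
    where v≡ = trans p (sym p')
  cutArc-injective (far-1 p q) (far-1 p' q') =
    toℕ-injective (trans p (sym p')) , toℕ-injective (suc-injective (trans q (sym q')))
  cutArc-injective (far-s κ p q) (far-s .κ p' q') =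
    toℕ-injective u≡ , toℕ-injective (+-cancelʳ-≡ s _ _ (trans q (trans (cong (_+ n) u≡) (sym q'))))
    where u≡ = trans p (sym p')

  cutArc : ∀ u v → Adj n s u v → toℕ u < h → ¬ toℕ v < h → ∃₂ (CutArc u v)
  cutArc u v (inj₁ (inj₁ p)) u<h v≮h = zero , zero , near-1 su≡h (trans v≡su su≡h)
    where
    v≡su : toℕ v ≡ suc (toℕ u)
    v≡su = trans (sym p) (+-comm (toℕ u) 1)
    su≡h : suc (toℕ u) ≡ h
    su≡h = ≤-antisym u<h (≤-trans (≮⇒≥ v≮h) (≤-reflexive v≡su))
  cutArc u v (inj₁ (inj₂ p)) u<h v≮h = ⊥-elim (<⇒≱ h<n
    (≤-trans (m≤n+m n (toℕ v)) (≤-trans (≤-reflexive (trans (sym p) (+-comm (toℕ u) 1))) u<h)))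
  cutArc u v (inj₂ (inj₁ (inj₁ p))) u<h v≮h = ⊥-elim (v≮h (≤-<-trans (m≤m+n _ 1) (≤-<-trans (≤-reflexive p) u<h)))
  cutArc u v (inj₂ (inj₁ (inj₂ p))) u<h v≮h = suc zero , zero , far-1 u≡0 (trans sv≡ (cong (_+ n) u≡0))
    where
    sv≡ : suc (toℕ v) ≡ toℕ u + n
    sv≡ = trans (+-comm 1 (toℕ v)) p
    u≡0 : toℕ u ≡ 0
    u≡0 = n≤0⇒n≡0 (+-cancelʳ-≤ n _ _ (≤-trans (≤-reflexive (sym sv≡)) (toℕ<n v)))
  cutArc u v (inj₂ (inj₂ (inj₁ (inj₁ p)))) u<h v≮h = zero , suc (fromℕ< κ<s) ,
    near-s (fromℕ< κ<s) (trans (sym (m+[n∸m]≡n (≮⇒≥ v≮h))) (cong (h +_) (sym (toℕ-fromℕ< κ<s)))) p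
    where
    κ<s : toℕ v ∸ h < s
    κ<s = +-cancelˡ-< h _ _ (≤-<-trans (≤-reflexive (trans (m+[n∸m]≡n (≮⇒≥ v≮h)) (sym p))) (+-monoˡ-< s u<h))
  cutArc u v (inj₂ (inj₂ (inj₁ (inj₂ p)))) u<h v≮h = ⊥-elim (<⇒≱ (<-≤-trans (+-mono-<-≤ u<h s≤h) 2h≤n)
    (≤-trans (m≤n+m n (toℕ v)) (≤-reflexive (sym p))))
  cutArc u v (inj₂ (inj₂ (inj₂ (inj₁ p)))) u<h v≮h = ⊥-elim (v≮h (≤-<-trans (m≤m+n _ s) (≤-<-trans (≤-reflexive p) u<h)))
  cutArc u v (inj₂ (inj₂ (inj₂ (inj₂ p)))) u<h v≮h = suc zero , suc (fromℕ< u<s) ,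
    far-s (fromℕ< u<s) (sym (toℕ-fromℕ< u<s)) p
    where
    u<s : toℕ u < s
    u<s = +-cancelʳ-< n _ _ (≤-<-trans (≤-reflexive (sym p)) (≤-<-trans (≤-reflexive (+-comm (toℕ v) s)) (+-monoʳ-< s (toℕ<n v))))

  private
    left : Fin h → Fin n
    left a = fromℕ< (<-trans (toℕ<n a) h<n)

    right< : ∀ (b : Fin (n ∸ h)) → h + toℕ b < n
    right< b = <-≤-trans (+-monoʳ-< h (toℕ<n b)) (≤-reflexive (m+[n∸m]≡n (<⇒≤ h<n)))

    right : Fin (n ∸ h) → Fin n
    right b = fromℕ< (right< b)

    left<h : ∀ a → toℕ (left a) < h
    left<h a = ≤-<-trans (≤-reflexive (toℕ-fromℕ< _)) (toℕ<n a)

    right≮h : ∀ b → ¬ toℕ (right b) < h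
    right≮h b = ≤⇒≯ (≤-trans (m≤m+n h (toℕ b)) (≤-reflexive (sym (toℕ-fromℕ< (right< b)))))

    left-injective : ∀ {a a'} → left a ≡ left a' → a ≡ a'
    left-injective {a} {a'} eq = toℕ-injective
      (trans (sym (toℕ-fromℕ< (<-trans (toℕ<n a) h<n))) (trans (cong toℕ eq) (toℕ-fromℕ< (<-trans (toℕ<n a') h<n))))

    right-injective : ∀ {b b'} → right b ≡ right b' → b ≡ b'
    right-injective {b} {b'} eq = toℕ-injective (+-cancelˡ-≡ h _ _
      (trans (sym (toℕ-fromℕ< (right< b))) (trans (cong toℕ eq) (toℕ-fromℕ< (right< b')))))

    left≢right : ∀ {a b} → left a ≢ right b
    left≢right {a} {b} eq = right≮h b (subst (λ z → toℕ z < h) eq (left<h a))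

    source target : Bool → Fin h → Fin (n ∸ h) → Fin n
    source true  a b = left a
    source false a b = right b
    target true  a b = right b
    target false a b = left a

    source≢target : ∀ o {a b} → source o a b ≢ target o a b
    source≢target true  = left≢right
    source≢target false = left≢right ∘ sym

    ends-injective : ∀ o o' {a b a' b'} → source o a b ≡ source o' a' b' → target o a b ≡ target o' a' b' →
      o ≡ o' × a ≡ a' × b ≡ b'
    ends-injective true  true  p q = refl , left-injective p , right-injective q
    ends-injective false false p q = refl , left-injective q , right-injective p
    ends-injective true  false p q = ⊥-elim (left≢right p)
    ends-injective false true  p q = ⊥-elim (left≢right (sym p))

    Crosses : Bool → Fin h → Fin (n ∸ h) → Set
    Crosses o a b = ∃₂ λ u v → OrientedIn o u v (proj₁ R (source o a b) (target o a b)) × ∃₂ (CutArc u v)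

    crosses : ∀ o a b → Crosses o a b
    crosses true a b with proj₂ R (left a) (right b) left≢right
    ... | hd , lt , lk , _ with crossing (λ z → toℕ z <? h) (proj₁ R (left a) (right b)) hd lt lk (left<h a) (right≮h b)
    ...   | u , v , arc , adj , u<h , v≮h = u , v , arc , cutArc u v adj u<h v≮h
    crosses false a b with proj₂ R (right b) (left a) (left≢right ∘ sym)
    -- A path from right to left is followed until it leaves the right side, and the crossing arc is
    -- then read backwards.
    ... | hd , lt , lk , _ with crossing (λ z → h ≤? toℕ z) (proj₁ R (right b) (left a)) hd lt lk
                                  (≮⇒≥ (right≮h b)) (<⇒≱ (left<h a))
    ...   | u , v , arc , adj , h≤u , h≰v = v , u , arc , cutArc v u (Adj-sym adj) (≰⇒> h≰v) (≤⇒≯ h≤u)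

    code : Fin D × Fin h × Fin (n ∸ h) → Fin (2 * suc s * k)
    code (t , a , b) with crosses (orient t) a b
    ... | u , v , _ , i , κ , _ = combine (combine i κ) (c (source (orient t) a b) (target (orient t) a b))

    -- Two different paths through the same cut edge with the same colour would conflict.
    code-injective : ∀ {z z'} → code z ≡ code z' → z ≡ z'
    code-injective {t , a , b} {t' , a' , b'} eq with crosses (orient t) a b | crosses (orient t') a' b'
    ... | u , v , A , i , κ , C | u' , v' , A' , i' , κ' , C' with combine-injective (combine i κ) _ (combine i' κ') _ eq
    ... | iκ≡ , c≡ with combine-injective i κ i' κ' iκ≡
    ... | refl , refl with cutArc-injective C C'
    ... | refl , refl with source (orient t) a b Fin.≟ source (orient t') a' b' | target (orient t) a b Fin.≟ target (orient t') a' b'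
    ... | yes p | yes q with ends-injective (orient t) (orient t') p q
    ...   | o≡ , refl , refl = cong (_, a , b) (orient-injective t t' o≡)
    code-injective {t , a , b} {t' , a' , b'} eq | u , v , A , i , κ , C | u' , v' , A' , i' , κ' , C' | iκ≡ , c≡
      | refl , refl | refl , refl | no p | _ =
      ⊥-elim (cf _ _ _ _ (source≢target (orient t)) (source≢target (orient t')) (p ∘ proj₁) (conf t t' A A') c≡)
    code-injective {t , a , b} {t' , a' , b'} eq | u , v , A , i , κ , C | u' , v' , A' , i' , κ' , C' | iκ≡ , c≡
      | refl , refl | refl , refl | _ | no q =
      ⊥-elim (cf _ _ _ _ (source≢target (orient t)) (source≢target (orient t')) (q ∘ proj₂) (conf t t' A A') c≡)

    decode : Fin (D * (h * (n ∸ h))) → Fin D × Fin h × Fin (n ∸ h)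
    decode i = proj₁ (remQuot {D} (h * (n ∸ h)) i) , remQuot {h} (n ∸ h) (proj₂ (remQuot {D} (h * (n ∸ h)) i))

    decode-injective : ∀ {i j} → decode i ≡ decode j → i ≡ j
    decode-injective {i} {j} eq = trans (sym (back i)) (trans (cong encode eq) (back j))
      where
      encode : Fin D × Fin h × Fin (n ∸ h) → Fin (D * (h * (n ∸ h)))
      encode (t , a , b) = combine t (combine a b)
      back : ∀ i → encode (decode i) ≡ i
      back i = trans (cong (combine (proj₁ (remQuot {D} (h * (n ∸ h)) i)))
        (combine-remQuot {h} (n ∸ h) (proj₂ (remQuot {D} (h * (n ∸ h)) i)))) (combine-remQuot {D} (h * (n ∸ h)) i)

  cut-bound : D * (h * (n ∸ h)) ≤ 2 * suc s * k
  cut-bound = injective⇒≤ {f = code ∘ decode} (λ eq → decode-injective (code-injective eq))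

  lower₁ : Lower₁ n s k D
  lower₁ = begin
    D * (n * n ∸ ε n)            ≡⟨ cong (D *_) square ⟩
    D * (4 * (h * (n ∸ h)))      ≡⟨ lem₁ D (h * (n ∸ h)) ⟩
    4 * (D * (h * (n ∸ h)))      ≤⟨ *-monoʳ-≤ 4 cut-bound ⟩
    4 * (2 * suc s * k)          ≡⟨ lem₂ s k ⟩
    8 * (s + 1) * k              ∎
    where
    open ≤-Reasoning
    lem₁ : ∀ d a → d * (4 * a) ≡ 4 * (d * a)
    lem₁ = solve-∀
    lem₂ : ∀ s k → 4 * (2 * suc s * k) ≡ 8 * (s + 1) * k
    lem₂ = solve-∀
    n≡ : n ≡ ε n + (h + h)
    n≡ = trans (m≡m%n+[m/n]*n n 2) (cong (n % 2 +_) (trans (*-comm h 2) (cong (h +_) (+-identityʳ h))))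
    n∸h≡ : n ∸ h ≡ ε n + h
    n∸h≡ = trans (cong (_∸ h) (trans n≡ (sym (+-assoc (ε n) h h)))) (m+n∸n≡m (ε n + h) h)
    -- As e² = e, the difference (2h + e)² - e is 4h (h + e).
    square-of : ∀ e → e < 2 → (e + (h + h)) * (e + (h + h)) ∸ e ≡ 4 * (h * (e + h))
    square-of 0 _ = lem h
      where
      lem : ∀ h → (h + h) * (h + h) ≡ 4 * (h * h)
      lem = solve-∀
    square-of 1 _ = trans (cong (_∸ 1) (lem h)) (m+n∸m≡n 1 _)
      where
      lem : ∀ h → (1 + (h + h)) * (1 + (h + h)) ≡ 1 + 4 * (h * (1 + h))
      lem = solve-∀
    square-of (suc (suc _)) (s≤s (s≤s ()))
    square : n * n ∸ ε n ≡ 4 * (h * (n ∸ h))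
    square = trans (cong (λ x → x * x ∸ ε n) n≡) (trans (square-of (ε n) (m%n<n n 2)) (cong (λ x → 4 * (h * x)) (sym n∸h≡)))

-- The distance bound

module _ {A : Set} where

  arcCount : List A → ℕ
  arcCount []           = 0
  arcCount (u ∷ [])     = 0
  arcCount (u ∷ v ∷ xs) = suc (arcCount (v ∷ xs))

  data At (u : A) : ℕ → List A → Set where
    here  : ∀ {xs} → At u 0 (u ∷ xs)
    there : ∀ {r w xs} → At u r xs → At u (suc r) (w ∷ xs)

  data ArcAt (u v : A) : ℕ → List A → Set where
    here  : ∀ {xs} → ArcAt u v 0 (u ∷ v ∷ xs)
    there : ∀ {r w xs} → ArcAt u v r xs → ArcAt u v (suc r) (w ∷ xs)

  ArcAt⇒ArcIn : ∀ {u v r p} → ArcAt u v r p → ArcIn u v p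
  ArcAt⇒ArcIn here      = here
  ArcAt⇒ArcIn (there a) = there (ArcAt⇒ArcIn a)

  ArcAt⇒At₁ : ∀ {u v r p} → ArcAt u v r p → At u r p
  ArcAt⇒At₁ here      = here
  ArcAt⇒At₁ (there a) = there (ArcAt⇒At₁ a)

  ArcAt⇒At₂ : ∀ {u v r p} → ArcAt u v r p → At v (suc r) p
  ArcAt⇒At₂ here      = there here
  ArcAt⇒At₂ (there a) = there (ArcAt⇒At₂ a)

  All-At : ∀ {P : A → Set} {u r p} → All P p → At u r p → P u
  All-At (px ∷ _)  here      = px
  All-At (_ ∷ pxs) (there a) = All-At pxs a

  At-unique : ∀ {u r r' p} → Unique p → At u r p → At u r' p → r ≡ r'
  At-unique uq       here      here       = refl
  At-unique (_ ∷ uq) (there a) (there a') = cong suc (At-unique uq a a')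
  At-unique (x∉ ∷ _) here      (there a') = ⊥-elim (All-At x∉ a' refl)
  At-unique (x∉ ∷ _) (there a) here       = ⊥-elim (All-At x∉ a refl)

  -- A simple path uses an edge at most once: reversed use would give both r = r' + 1 and r + 1 =
  -- r'. So path and edge together determine the position.
  ArcAt-unique : ∀ {u v u' v' r r' p} → Unique p → ArcAt u v r p → ArcAt u' v' r' p →
    (u ≡ u' × v ≡ v') ⊎ (u ≡ v' × v ≡ u') → r ≡ r'
  ArcAt-unique uq a a' (inj₁ (refl , refl)) = At-unique uq (ArcAt⇒At₁ a) (ArcAt⇒At₁ a')
  ArcAt-unique {r = r} {r'} uq a a' (inj₂ (refl , refl)) = ⊥-elim (<⇒≢ (m<n+m r (s≤s (z≤n {1})))
    (trans (At-unique uq (ArcAt⇒At₁ a) (ArcAt⇒At₂ a')) (cong suc (sym (At-unique uq (ArcAt⇒At₂ a) (ArcAt⇒At₁ a'))))))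

  arcAt : ∀ {E : A → A → Set} p → Linked E p → ∀ r → r < arcCount p → ∃₂ λ u v → ArcAt u v r p × E u v
  arcAt (u ∷ v ∷ xs) lk zero    _        = u , v , here , linked-head lk
  arcAt (u ∷ v ∷ xs) lk (suc r) (s≤s r<) with arcAt (v ∷ xs) (linked-tail lk) r r<
  ... | u' , v' , a , e = u' , v' , there a , e
  arcAt (_ ∷ []) _ _ ()

module _ {n s : ℕ} where

  private
    extend⁺ : ∀ {L X d} {u v : Fin n} γ → Cong n L (toℕ v + X) → Step n d u v →
      Cong n (L + γ) (toℕ u + (X + (d + γ)))
    extend⁺ {L} {X} {d} {u} {v} γ p st = Cong-cancel (toℕ v) (toℕ v) refl
      (subst₂ (Cong n) (lem₁ L γ (toℕ v)) (lem₂ (toℕ v) X (toℕ u) d γ)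
        (Cong-+ (Cong-+ p (Cong-sym (Step⇒Cong {i = u} {j = v} st))) (Cong-refl {a = γ} refl)))
      where
      lem₁ : ∀ L γ v → L + v + γ ≡ v + (L + γ)
      lem₁ = solve-∀
      lem₂ : ∀ v X u d γ → v + X + (u + d) + γ ≡ v + (u + (X + (d + γ)))
      lem₂ = solve-∀

    extend⁻ : ∀ {L X d} {u v : Fin n} γ → Cong n L (toℕ v + X) → Step n d v u →
      Cong n (L + (d + γ)) (toℕ u + (X + γ))
    extend⁻ {L} {X} {d} {u} {v} γ p st = Cong-cancel (toℕ v) (toℕ v) refl
      (subst₂ (Cong n) (lem₁ L d γ (toℕ v)) (lem₂ (toℕ v) X (toℕ u) γ)
        (Cong-+ (Cong-+ p (Step⇒Cong {i = v} {j = u} st)) (Cong-refl {a = γ} refl)))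
      where
      lem₁ : ∀ L d γ v → L + (v + d) + γ ≡ v + (L + (d + γ))
      lem₁ = solve-∀
      lem₂ : ∀ v X u γ → v + X + u + γ ≡ v + (u + (X + γ))
      lem₂ = solve-∀

  -- P counts the steps +1 and +s, Q the steps +1 and -s, so that the displacement is
  -- (P + Q - length) + (P - Q) s.
  displacement : ∀ u xs {y : Fin n} → last (u ∷ xs) ≡ just y → Linked (Adj n s) (u ∷ xs) →
    let ℓ = arcCount (u ∷ xs) in
    ∃₂ λ P Q → P ≤ ℓ × Q ≤ ℓ × Cong n (toℕ y + (ℓ + Q * s)) (toℕ u + (P + Q + P * s))
  displacement u []       refl lk = 0 , 0 , z≤n , z≤n , Cong-refl refl
  displacement u (v ∷ xs) {y} lt lk with displacement v xs lt (linked-tail lk) | linked-head lk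
  ... | P , Q , P≤ , Q≤ , c | inj₁ p = suc P , suc Q , s≤s P≤ , s≤s Q≤ ,
        subst₂ (Cong n) (lem₁ (toℕ y) (arcCount (v ∷ xs)) Q s) (lem₂ (toℕ u) P Q s)
          (extend⁺ {u = u} {v} (1 + s) c p)
    where
    lem₁ : ∀ y ℓ Q s → y + (ℓ + Q * s) + (1 + s) ≡ y + (suc ℓ + suc Q * s)
    lem₁ = solve-∀
    lem₂ : ∀ u P Q s → u + (P + Q + P * s + (1 + (1 + s))) ≡ u + (suc P + suc Q + suc P * s)
    lem₂ = solve-∀
  ... | P , Q , P≤ , Q≤ , c | inj₂ (inj₁ p) = P , Q , m≤n⇒m≤1+n P≤ , m≤n⇒m≤1+n Q≤ ,
        subst₂ (Cong n) (lem₁ (toℕ y) (arcCount (v ∷ xs)) Q s) (lem₂ (toℕ u) P Q s)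
          (extend⁻ {u = u} {v} 0 c p)
    where
    lem₁ : ∀ y ℓ Q s → y + (ℓ + Q * s) + (1 + 0) ≡ y + (suc ℓ + Q * s)
    lem₁ = solve-∀
    lem₂ : ∀ u P Q s → u + (P + Q + P * s + 0) ≡ u + (P + Q + P * s)
    lem₂ = solve-∀
  ... | P , Q , P≤ , Q≤ , c | inj₂ (inj₂ (inj₁ p)) = suc P , Q , s≤s P≤ , m≤n⇒m≤1+n Q≤ ,
        subst₂ (Cong n) (lem₁ (toℕ y) (arcCount (v ∷ xs)) Q s) (lem₂ (toℕ u) P Q s)
          (extend⁺ {u = u} {v} 1 c p)
    where
    lem₁ : ∀ y ℓ Q s → y + (ℓ + Q * s) + 1 ≡ y + (suc ℓ + Q * s)
    lem₁ = solve-∀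
    lem₂ : ∀ u P Q s → u + (P + Q + P * s + (s + 1)) ≡ u + (suc P + Q + suc P * s)
    lem₂ = solve-∀
  ... | P , Q , P≤ , Q≤ , c | inj₂ (inj₂ (inj₂ p)) = P , suc Q , m≤n⇒m≤1+n P≤ , s≤s Q≤ ,
        subst₂ (Cong n) (lem₁ (toℕ y) (arcCount (v ∷ xs)) Q s) (lem₂ (toℕ u) P Q s)
          (extend⁻ {u = u} {v} 1 c p)
    where
    lem₁ : ∀ y ℓ Q s → y + (ℓ + Q * s) + (s + 1) ≡ y + (suc ℓ + suc Q * s)
    lem₁ = solve-∀
    lem₂ : ∀ u P Q s → u + (P + Q + P * s + 1) ≡ u + (P + suc Q + P * s)
    lem₂ = solve-∀

-- y is within distance r of x: a path shorter than r is prolonged to length r or r - 1 by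
-- going back and forth, and bit records which.
record InBall (n s r : ℕ) (x y : Fin n) : Set where
  constructor inBall
  field
    bit : Fin 2
    P Q : Fin (suc r)
    displaced : Cong n (toℕ y + (r + toℕ Q * s)) (toℕ x + (toℕ P + toℕ Q + toℕ bit + toℕ P * s))

module _ {n s : ℕ} .{{_ : NonZero n}} where

  -- A detour +1, -1 raises P and Q by 1 and the length by 2; `g` counts the detours and `b` is the
  -- parity left over.
  padded : ∀ {x y : Fin n} {ℓ P Q} r → ℓ ≤ r → P ≤ ℓ → Q ≤ ℓ →
    Cong n (toℕ y + (ℓ + Q * s)) (toℕ x + (P + Q + P * s)) → InBall n s r x y
  padded {x} {y} {ℓ} {P} {Q} r ℓ≤r P≤ℓ Q≤ℓ c = inBall (fromℕ< b<2) (fromℕ< (s≤s P+g≤r)) (fromℕ< (s≤s Q+g≤r))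
    (subst₂ (Cong n)
      (trans (lem₁ (toℕ y) ℓ Q g b s) (cong₂ (λ t w → toℕ y + (t + w * s)) r≡ (sym (toℕ-fromℕ< (s≤s Q+g≤r)))))
      (trans (lem₂ (toℕ x) P Q g b s)
        (trans (cong₂ (λ t w → toℕ x + (t + (Q + g) + w + t * s)) (sym (toℕ-fromℕ< (s≤s P+g≤r))) (sym (toℕ-fromℕ< b<2)))
          (cong (λ t → toℕ x + (toℕ (fromℕ< (s≤s P+g≤r)) + t + toℕ (fromℕ< b<2) + toℕ (fromℕ< (s≤s P+g≤r)) * s))
            (sym (toℕ-fromℕ< (s≤s Q+g≤r))))))
      (Cong-+ c (Cong-refl {a = g + g + b + g * s} refl)))
    where
    b g : ℕ
    b = (r ∸ ℓ) % 2
    g = (r ∸ ℓ) / 2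
    b<2 : b < 2
    b<2 = m%n<n (r ∸ ℓ) 2
    r≡ : ℓ + (g + g + b) ≡ r
    r≡ = trans (cong (ℓ +_) (trans (lem g b) (sym (m≡m%n+[m/n]*n (r ∸ ℓ) 2)))) (m+[n∸m]≡n ℓ≤r)
      where
      lem : ∀ g b → g + g + b ≡ b + g * 2
      lem = solve-∀
    ℓ+g≤r : ℓ + g ≤ r
    ℓ+g≤r = ≤-trans (+-monoʳ-≤ ℓ (≤-trans (m≤m+n g g) (m≤m+n (g + g) b))) (≤-reflexive r≡)
    P+g≤r : P + g ≤ r
    P+g≤r = ≤-trans (+-monoˡ-≤ g P≤ℓ) ℓ+g≤r
    Q+g≤r : Q + g ≤ r
    Q+g≤r = ≤-trans (+-monoˡ-≤ g Q≤ℓ) ℓ+g≤r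
    lem₁ : ∀ y ℓ Q g b s → y + (ℓ + Q * s) + (g + g + b + g * s) ≡ y + (ℓ + (g + g + b) + (Q + g) * s)
    lem₁ = solve-∀
    lem₂ : ∀ x P Q g b s → x + (P + Q + P * s) + (g + g + b + g * s) ≡ x + (P + g + (Q + g) + b + (P + g) * s)
    lem₂ = solve-∀

ballSize : ℕ → ℕ
ballSize r = 2 * (suc r * suc r)

-- `Code` labels arcs in the directed case and edges in the undirected one, so a label need fix its
-- arc only up to reversal.
module Load (n s : ℕ) .{{_ : NonZero n}} (A : ℕ) (Conf : List (Fin n) → List (Fin n) → Set)
            (Code : Fin n → Fin n → Fin A → Set)
            (encode : ∀ {u v} → Adj n s u v → ∃ (Code u v))
            (Code-injective : ∀ {u v u' v' a} → Code u v a → Code u' v' a → (u ≡ u' × v ≡ v') ⊎ (u ≡ v' × v ≡ u'))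
            (conf : ∀ {u v u' v' a p p'} → Code u v a → Code u' v' a → ArcIn u v p → ArcIn u' v' p' → Conf p p')
            (k : ℕ) (R : Routing n s) (c : Fin n → Fin n → Fin k) (cf : ConflictFree Conf (proj₁ R) c)
            (K : ℕ) where

  private
    V : ℕ
    V = sum< ballSize K

    Traverses : Fin n → Fin n → ℕ → Set
    Traverses x y r = x ≢ y × ∃₂ λ u v → ArcAt u v r (proj₁ R x y) × ∃ (Code u v)

    along : ∀ {x y} r p → IsPath n s x y p →
      (∃₂ λ u v → ArcAt u v r p × ∃ (Code u v)) ⊎ InBall n s r x y
    along r p@(u ∷ xs) (refl , lt , lk , _) with r <? arcCount p
    ... | yes r< with arcAt p lk r r<
    ...   | u' , v' , a , adj = inj₁ (u' , v' , a , encode adj)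
    along r p@(u ∷ xs) (refl , lt , lk , _) | no r≮ with displacement u xs lt lk
    ...   | P , Q , P≤ , Q≤ , cg = inj₂ (padded r (≮⇒≥ r≮) P≤ Q≤ cg)

    spot : ∀ x y r → Traverses x y r ⊎ InBall n s r x y
    spot x y r with x Fin.≟ y
    ... | yes refl = inj₂ (padded {ℓ = 0} {0} {0} r z≤n z≤n z≤n (Cong-refl refl))
    ... | no x≢y with along r (proj₁ R x y) (proj₂ R x y x≢y)
    ...   | inj₁ (u , v , a , cd) = inj₁ (x≢y , u , v , a , cd)
    ...   | inj₂ b = inj₂ b

    ballCode : ∀ {x y r} → InBall n s r x y → Fin (ballSize r)
    ballCode (inBall bit P Q _) = combine bit (combine P Q)

    ballCode-injective : ∀ {x y y' r} (b : InBall n s r x y) (b' : InBall n s r x y') →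
      ballCode b ≡ ballCode b' → y ≡ y'
    ballCode-injective {x} {y} {y'} (inBall bit P Q cg) (inBall bit' P' Q' cg') eq
      with combine-injective bit (combine P Q) bit' (combine P' Q') eq
    ... | refl , eq' with combine-injective P Q P' Q' eq'
    ... | refl , refl = Cong-summand {y = y} {y'} cg cg'

    block< : ∀ {x y} (r : Fin K) (b : InBall n s (toℕ r) x y) → sum< ballSize (toℕ r) + toℕ (ballCode b) < V
    block< r b = block-< ballSize (toℕ<n r) (toℕ<n (ballCode b))

    code : ∀ x y (r : Fin K) → Traverses x y (toℕ r) ⊎ InBall n s (toℕ r) x y → Fin (A * k) ⊎ Fin (n * V)
    code x y r (inj₁ (_ , _ , _ , _ , a , _)) = inj₁ (combine a (c x y))
    code x y r (inj₂ b)                       = inj₂ (combine x (fromℕ< (block< r b)))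

    code-injective : ∀ {x y r x' y' r'} t t' → code x y r t ≡ code x' y' r' t' → x ≡ x' × y ≡ y' × r ≡ r'
    code-injective {x} {y} {r} {x'} {y'} {r'} (inj₁ (x≢y , u , v , at , a , cd)) (inj₁ (x'≢y' , u' , v' , at' , a' , cd')) eq
      with combine-injective a (c x y) a' (c x' y') (inj₁-injective eq)
    ... | refl , c≡ with x Fin.≟ x' | y Fin.≟ y'
    ...   | yes refl | yes refl = refl , refl , toℕ-injective
            (ArcAt-unique (proj₂ (proj₂ (proj₂ (proj₂ R x y x≢y)))) at at' (Code-injective cd cd'))
    ...   | no x≢x' | _ = ⊥-elim (cf x y x' y' x≢y x'≢y' (x≢x' ∘ proj₁)
            (conf cd cd' (ArcAt⇒ArcIn at) (ArcAt⇒ArcIn at')) c≡)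
    ...   | _ | no y≢y' = ⊥-elim (cf x y x' y' x≢y x'≢y' (y≢y' ∘ proj₂)
            (conf cd cd' (ArcAt⇒ArcIn at) (ArcAt⇒ArcIn at')) c≡)
    code-injective {x} {y} {r} {x'} {y'} {r'} (inj₂ b) (inj₂ b') eq
      with combine-injective x (fromℕ< (block< r b)) x' (fromℕ< (block< r' b')) (inj₂-injective eq)
    ... | refl , eq' with block-injective ballSize {toℕ r} {toℕ r'} (toℕ<n (ballCode b)) (toℕ<n (ballCode b'))
                            (fromℕ<-injective _ _ (block< r b) (block< r' b') eq')
    ... | r≡ , code≡ with toℕ-injective r≡
    ... | refl = refl , ballCode-injective b b' (toℕ-injective code≡) , refl

    triple : Fin (n * (n * K)) → Fin n × Fin n × Fin K
    triple i = proj₁ (remQuot {n} (n * K) i) , remQuot {n} K (proj₂ (remQuot {n} (n * K) i))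

    triple-injective : ∀ {i j} → triple i ≡ triple j → i ≡ j
    triple-injective {i} {j} eq = trans (sym (back i)) (trans (cong untriple eq) (back j))
      where
      untriple : Fin n × Fin n × Fin K → Fin (n * (n * K))
      untriple (x , y , r) = combine x (combine y r)
      back : ∀ i → untriple (triple i) ≡ i
      back i = trans (cong (combine (proj₁ (remQuot {n} (n * K) i)))
        (combine-remQuot {n} K (proj₂ (remQuot {n} (n * K) i)))) (combine-remQuot {n} (n * K) i)

    tripleCode : Fin n × Fin n × Fin K → Fin (A * k + n * V)
    tripleCode (x , y , r) = join (A * k) (n * V) (code x y r (spot x y (toℕ r)))

    tripleCode-injective : ∀ {t t'} → tripleCode t ≡ tripleCode t' → t ≡ t'
    tripleCode-injective {x , y , r} {x' , y' , r'} eq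
      with code-injective (spot x y (toℕ r)) (spot x' y' (toℕ r'))
             (trans (sym (splitAt-join (A * k) (n * V) _)) (trans (cong (Fin.splitAt (A * k)) eq) (splitAt-join (A * k) (n * V) _)))
    ... | refl , refl , refl = refl

  -- A triple (x , y , r < K) yields the r-th arc of the path from x to y with its colour, or else
  -- y is one of the few vertices at distance at most r from x.
  load-bound : n * (n * K) ≤ A * k + n * sum< ballSize K
  load-bound = injective⇒≤ {f = tripleCode ∘ triple} (λ eq → triple-injective (tripleCode-injective eq))

module _ {n s : ℕ} .{{_ : NonZero n}} where

  private
    stride : Fin 2 → ℕ
    stride zero       = 1
    stride (suc zero) = s

    Step-target : ∀ {d} {u v v' : Fin n} → Step n d u v → Step n d u v' → v ≡ v'
    Step-target {d} {u} {v} {v'} p p' = Cong⇒Fin≡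
      (Cong-trans (Cong-sym (Step⇒Cong {i = u} {j = v} p)) (Step⇒Cong {i = u} {j = v'} p'))

    Step-source : ∀ {d} {u u' v : Fin n} → Step n d u v → Step n d u' v → u ≡ u'
    Step-source {d} {u} {u'} {v} p p' = Cong-summand {y = u} {u'} {d} {toℕ v}
      (Step⇒Cong {i = u} {j = v} p) (Step⇒Cong {i = u'} {j = v} p')

  ArcCode : Fin n → Fin n → Fin (2 * 2 * n) → Set
  ArcCode u v a = ∃ λ κ → (a ≡ combine {2 * 2} {n} (combine {2} {2} zero κ) u × Step n (stride κ) u v)
                        ⊎ (a ≡ combine {2 * 2} {n} (combine {2} {2} (suc zero) κ) u × Step n (stride κ) v u)

  arcCode : ∀ {u v} → Adj n s u v → ∃ (ArcCode u v)
  arcCode (inj₁ p)               = _ , zero     , inj₁ (refl , p)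
  arcCode (inj₂ (inj₁ p))        = _ , zero     , inj₂ (refl , p)
  arcCode (inj₂ (inj₂ (inj₁ p))) = _ , suc zero , inj₁ (refl , p)
  arcCode (inj₂ (inj₂ (inj₂ p))) = _ , suc zero , inj₂ (refl , p)

  ArcCode-injective : ∀ {u v u' v' a} → ArcCode u v a → ArcCode u' v' a → u ≡ u' × v ≡ v'
  ArcCode-injective {u} {v} {u'} {v'} (κ , inj₁ (refl , p)) (κ' , inj₁ (eq , p'))
    with combine-injective {2 * 2} {n} (combine {2} {2} zero κ) u (combine {2} {2} zero κ') u' eq
  ... | eq' , refl with combine-injective {2} {2} zero κ zero κ' eq'
  ... | _ , refl = refl , Step-target {u = u} {v} {v'} p p'
  ArcCode-injective {u} {v} {u'} {v'} (κ , inj₂ (refl , p)) (κ' , inj₂ (eq , p'))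
    with combine-injective {2 * 2} {n} (combine {2} {2} (suc zero) κ) u (combine {2} {2} (suc zero) κ') u' eq
  ... | eq' , refl with combine-injective {2} {2} (suc zero) κ (suc zero) κ' eq'
  ... | _ , refl = refl , Step-source {u = v} {v'} {u} p p'
  ArcCode-injective {u} {v} {u'} {v'} (κ , inj₁ (refl , p)) (κ' , inj₂ (eq , p'))
    with combine-injective {2 * 2} {n} (combine {2} {2} zero κ) u (combine {2} {2} (suc zero) κ') u' eq
  ... | eq' , _ with combine-injective {2} {2} zero κ (suc zero) κ' eq'
  ... | () , _
  ArcCode-injective {u} {v} {u'} {v'} (κ , inj₂ (refl , p)) (κ' , inj₁ (eq , p'))
    with combine-injective {2 * 2} {n} (combine {2} {2} (suc zero) κ) u (combine {2} {2} zero κ') u' eq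
  ... | eq' , _ with combine-injective {2} {2} (suc zero) κ zero κ' eq'
  ... | () , _

  EdgeCode : Fin n → Fin n → Fin (2 * n) → Set
  EdgeCode u v a = ∃ λ κ → (a ≡ combine κ u × Step n (stride κ) u v) ⊎ (a ≡ combine κ v × Step n (stride κ) v u)

  edgeCode : ∀ {u v} → Adj n s u v → ∃ (EdgeCode u v)
  edgeCode (inj₁ p)               = _ , zero     , inj₁ (refl , p)
  edgeCode (inj₂ (inj₁ p))        = _ , zero     , inj₂ (refl , p)
  edgeCode (inj₂ (inj₂ (inj₁ p))) = _ , suc zero , inj₁ (refl , p)
  edgeCode (inj₂ (inj₂ (inj₂ p))) = _ , suc zero , inj₂ (refl , p)

  EdgeCode-injective : ∀ {u v u' v' a} → EdgeCode u v a → EdgeCode u' v' a →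
    (u ≡ u' × v ≡ v') ⊎ (u ≡ v' × v ≡ u')
  EdgeCode-injective {u} {v} {u'} {v'} (κ , inj₁ (refl , p)) (κ' , inj₁ (eq , p'))
    with combine-injective κ u κ' u' eq
  ... | refl , refl = inj₁ (refl , Step-target {u = u} {v} {v'} p p')
  EdgeCode-injective {u} {v} {u'} {v'} (κ , inj₁ (refl , p)) (κ' , inj₂ (eq , p'))
    with combine-injective κ u κ' v' eq
  ... | refl , refl = inj₂ (refl , Step-target {u = u} {v} {u'} p p')
  EdgeCode-injective {u} {v} {u'} {v'} (κ , inj₂ (refl , p)) (κ' , inj₁ (eq , p'))
    with combine-injective κ v κ' u' eq
  ... | refl , refl = inj₂ (Step-target {u = v} {u} {v'} p p' , refl)
  EdgeCode-injective {u} {v} {u'} {v'} (κ , inj₂ (refl , p)) (κ' , inj₂ (eq , p'))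
    with combine-injective κ v κ' v' eq
  ... | refl , refl = inj₁ (Step-target {u = v} {u} {u'} p p' , refl)

3*ballSizes : ∀ K → 3 * sum< ballSize K ≡ K * (K + 1) * (2 * K + 1)
3*ballSizes zero    = refl
3*ballSizes (suc K) = trans (lem₁ (sum< ballSize K) K) (trans (cong (_+ 6 * (suc K * suc K)) (3*ballSizes K)) (lem₂ K))
  where
  lem₁ : ∀ v K → 3 * (v + 2 * (suc K * suc K)) ≡ 3 * v + 6 * (suc K * suc K)
  lem₁ = solve-∀
  lem₂ : ∀ K → K * (K + 1) * (2 * K + 1) + 6 * (suc K * suc K) ≡ suc K * (suc K + 1) * (2 * suc K + 1)
  lem₂ = solve-∀

AM-GM : ∀ a b → 4 * (a * b) ≤ (a + b) * (a + b)
AM-GM a b with ≤-total a b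
... | inj₁ a≤b = subst (λ b → 4 * (a * b) ≤ (a + b) * (a + b)) (m+[n∸m]≡n a≤b)
                   (≤-trans (m≤m+n _ _) (≤-reflexive (lem a (b ∸ a))))
  where
  lem : ∀ a d → 4 * (a * (a + d)) + d * d ≡ (a + (a + d)) * (a + (a + d))
  lem = solve-∀
... | inj₂ b≤a = subst (λ a → 4 * (a * b) ≤ (a + b) * (a + b)) (m+[n∸m]≡n b≤a)
                   (≤-trans (m≤m+n _ _) (≤-reflexive (lem b (a ∸ b))))
  where
  lem : ∀ b d → 4 * ((b + d) * b) + d * d ≡ ((b + d) + b) * ((b + d) + b)
  lem = solve-∀

-- √x ≤ (x + c²) / 2c.
MulSqrtLe-AM-GM : ∀ M c x B .{{_ : NonZero c}} → M * (x + c * c) ≤ 2 * c * B → MulSqrtLe M x B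
MulSqrtLe-AM-GM M c x B le = *-cancelʳ-≤ _ _ (4 * (c * c)) {{m*n≢0 4 (c * c) {{_}} {{m*n≢0 c c}}}} (begin
  M * M * x * (4 * (c * c))                      ≡⟨ lem₁ M x (c * c) ⟩
  M * M * (4 * (x * (c * c)))                    ≤⟨ *-monoʳ-≤ (M * M) (AM-GM x (c * c)) ⟩
  M * M * ((x + c * c) * (x + c * c))            ≡⟨ lem₂ M (x + c * c) ⟩
  M * (x + c * c) * (M * (x + c * c))            ≤⟨ *-mono-≤ le le ⟩
  2 * c * B * (2 * c * B)                        ≡⟨ lem₃ c B ⟩
  B * B * (4 * (c * c))                          ∎)
  where
  open ≤-Reasoning
  lem₁ : ∀ M x d → M * M * x * (4 * d) ≡ M * M * (4 * (x * d))
  lem₁ = solve-∀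
  lem₂ : ∀ M y → M * M * (y * y) ≡ M * y * (M * y)
  lem₂ = solve-∀
  lem₃ : ∀ c B → 2 * c * B * (2 * c * B) ≡ B * B * (4 * (c * c))
  lem₃ = solve-∀

-- This choice gives 2K ≤ √(2n) < 2K + 2.
radius : ∀ n → ∃ λ K → 2 * (K * K) ≤ n × n < 2 * (suc K * suc K)
radius zero = 0 , z≤n , s≤s z≤n
radius (suc n) with radius n
... | K , lo , hi with suc n <? 2 * (suc K * suc K)
...   | yes lt = K , m≤n⇒m≤1+n lo , lt
...   | no ≮  = suc K , ≮⇒≥ ≮ , ≤-<-trans hi (*-monoʳ-< 2 (*-mono-< (n<1+n (suc K)) (n<1+n (suc K))))

private
  -- By AM-GM, (2n + c²) / 2c bounds √(2n); after division by 2c this is Lower₂ with 24 n T replaced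
  -- by its lower bound 6 n K - 2 K (K + 1) (2K + 1), moved to the other side.
  radius-inequality : ∀ k f → f ≤ 4 * k + 9 → let K = 2 + k; n = 2 * (K * K) + f; c = 2 * K + 1 in
    (2 * n + 147) * (2 * n + c * c) + 2 * c * (2 * (K * (K + 1) * (2 * K + 1)))
      ≤ 2 * c * (6 * n * K + (42 * n + 343))
  radius-inequality k f f≤ = +-cancelʳ-≤ (4 * (f * f)) _ _ (≤-trans
    -- The left side has an extra 4f², the only quadratic term in f; the bound on f trades it for a
    -- linear one.
    (+-monoʳ-≤ ((2 * n + 147) * (2 * n + c * c) + 2 * c * (2 * (K * (K + 1) * (2 * K + 1))))
      (*-monoʳ-≤ 4 (*-monoʳ-≤ f f≤)))
    (≤-trans (m≤m+n _ (312 * (k * k * k) + 156 * (f * k) + 840 * (k * k) + 96 * f + 396 * k + 467)) (≤-reflexive (lem k f))))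
    where
    K n c : ℕ
    K = 2 + k
    n = 2 * (K * K) + f
    c = 2 * K + 1
    lem : ∀ k f →
      (2 * (2 * ((2 + k) * (2 + k)) + f) + 147)
          * (2 * (2 * ((2 + k) * (2 + k)) + f) + (2 * (2 + k) + 1) * (2 * (2 + k) + 1))
        + 2 * (2 * (2 + k) + 1) * (2 * ((2 + k) * ((2 + k) + 1) * (2 * (2 + k) + 1)))
        + 4 * (f * (4 * k + 9))
        + (312 * (k * k * k) + 156 * (f * k) + 840 * (k * k) + 96 * f + 396 * k + 467)
      ≡ 2 * (2 * (2 + k) + 1) * (6 * (2 * ((2 + k) * (2 + k)) + f) * (2 + k) + (42 * (2 * ((2 + k) * (2 + k)) + f) + 343))
        + 4 * (f * f)
    lem = solve-∀

-- The hypothesis expresses (√(2n) - 7)³ ≤ 0, in squared form; the lower bound is then not positive.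
lower₂-trivial : ∀ n T D → (2 * n + 147) * (2 * n + 147) * (2 * n) ≤ (42 * n + 343) * (42 * n + 343) → Lower₂ n T D
lower₂-trivial n T D le = begin
  d * a * (d * a) * (2 * n)       ≡⟨ lem₁ d a (2 * n) ⟩
  d * d * (a * a * (2 * n))       ≤⟨ *-monoʳ-≤ (d * d) le ⟩
  d * d * (b * b)                 ≡⟨ lem₂ d b ⟩
  d * b * (d * b)                 ≤⟨ *-mono-≤ (m≤n+m (d * b) (24 * n * T)) (m≤n+m (d * b) (24 * n * T)) ⟩
  (24 * n * T + d * b) * (24 * n * T + d * b) ∎
  where
  open ≤-Reasoning
  a b d : ℕ
  a = 2 * n + 147
  b = 42 * n + 343
  d = D * (n ∸ 1)
  lem₁ : ∀ d a x → d * a * (d * a) * x ≡ d * d * (a * a * x)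
  lem₁ = solve-∀
  lem₂ : ∀ d b → d * d * (b * b) ≡ d * b * (d * b)
  lem₂ = solve-∀

lower₂ : ∀ n T D → 5 ≤ n → (∀ K → D * (n * K) ≤ 4 * T + D * sum< ballSize K) → Lower₂ n T D
lower₂ n T D 5≤n load with radius n
... | 0 , _ , hi = ⊥-elim (<⇒≱ hi (≤-trans (≤ᵇ⇒≤ 2 5 _) 5≤n))
... | 1 , _ , hi = small n 5≤n hi
  where
  small : ∀ n → 5 ≤ n → n < 8 → Lower₂ n T D
  small 5 _ _ = lower₂-trivial 5 T D (≤ᵇ⇒≤ _ _ _)
  small 6 _ _ = lower₂-trivial 6 T D (≤ᵇ⇒≤ _ _ _)
  small 7 _ _ = lower₂-trivial 7 T D (≤ᵇ⇒≤ _ _ _)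
  small 0 () _
  small 1 (s≤s ()) _
  small 2 (s≤s (s≤s ())) _
  small 3 (s≤s (s≤s (s≤s ()))) _
  small 4 (s≤s (s≤s (s≤s (s≤s ())))) _
  small (suc (suc (suc (suc (suc (suc (suc (suc m)))))))) _ hi = ⊥-elim (<⇒≱ hi (m≤m+n 8 m))
... | suc (suc k) , lo , hi = MulSqrtLe-AM-GM (d * a) c (2 * n) (24 * n * T + d * b) {{c≢0}} (+-cancelʳ-≤ (2 * c * (d * W)) _ _ (begin
  d * a * (2 * n + c * c) + 2 * c * (d * W)       ≡⟨ lem₁ d a (2 * n + c * c) c W ⟩
  d * (a * (2 * n + c * c) + 2 * c * W)           ≤⟨ *-monoʳ-≤ d poly ⟩
  d * (2 * c * (6 * n * K + b))                   ≡⟨ lem₂ d c (6 * n * K) b ⟩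
  2 * c * (d * (6 * n * K)) + 2 * c * (d * b)     ≤⟨ +-monoˡ-≤ _ (*-monoʳ-≤ (2 * c) distances) ⟩
  2 * c * (24 * n * T + d * W) + 2 * c * (d * b)  ≡⟨ lem₃ c (24 * n * T) (d * W) (d * b) ⟩
  2 * c * (24 * n * T + d * b) + 2 * c * (d * W)  ∎))
  where
  open ≤-Reasoning
  K a b c d W : ℕ
  K = 2 + k
  a = 2 * n + 147
  b = 42 * n + 343
  -- The midpoint of the interval [2K, 2K + 2) that contains √(2n), so the AM-GM estimate is nearly
  -- sharp.
  c = 2 * K + 1
  d = D * (n ∸ 1)
  W = 2 * (K * (K + 1) * (2 * K + 1))
  c≢0 : NonZero c
  c≢0 = >-nonZero (m≤n+m 1 (2 * K))
  lem₁ : ∀ d a y c w → d * a * y + 2 * c * (d * w) ≡ d * (a * y + 2 * c * w)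
  lem₁ = solve-∀
  lem₂ : ∀ d c x b → d * (2 * c * (x + b)) ≡ 2 * c * (d * x) + 2 * c * (d * b)
  lem₂ = solve-∀
  lem₃ : ∀ c t w b → 2 * c * (t + w) + 2 * c * b ≡ 2 * c * (t + b) + 2 * c * w
  lem₃ = solve-∀
  f : ℕ
  f = n ∸ 2 * (K * K)
  n≡ : 2 * (K * K) + f ≡ n
  n≡ = m+[n∸m]≡n lo
  f≤ : f ≤ 4 * k + 9
  f≤ = ≤-pred (+-cancelˡ-< (2 * (K * K)) _ _ (<-≤-trans (≤-<-trans (≤-reflexive n≡) hi) (≤-reflexive (lem k))))
    where
    lem : ∀ k → 2 * (suc (2 + k) * suc (2 + k)) ≡ 2 * ((2 + k) * (2 + k)) + suc (4 * k + 9)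
    lem = solve-∀
  poly : a * (2 * n + c * c) + 2 * c * W ≤ 2 * c * (6 * n * K + b)
  poly = subst (λ n → (2 * n + 147) * (2 * n + c * c) + 2 * c * W ≤ 2 * c * (6 * n * K + (42 * n + 343)))
           n≡ (radius-inequality k f f≤)
  total : D * n * (6 * n * K) ≤ 24 * n * T + D * n * W
  total = begin
    D * n * (6 * n * K)                                     ≡⟨ lem₄ D n K ⟩
    6 * n * (D * (n * K))                                   ≤⟨ *-monoʳ-≤ (6 * n) (load K) ⟩
    6 * n * (4 * T + D * sum< ballSize K)                   ≡⟨ lem₅ n T D (sum< ballSize K) ⟩
    24 * n * T + D * n * (2 * (3 * sum< ballSize K))        ≡⟨ cong (λ v → 24 * n * T + D * n * (2 * v)) (3*ballSizes K) ⟩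
    24 * n * T + D * n * W                                  ∎
    where
    lem₄ : ∀ D n K → D * n * (6 * n * K) ≡ 6 * n * (D * (n * K))
    lem₄ = solve-∀
    lem₅ : ∀ n T D v → 6 * n * (4 * T + D * v) ≡ 24 * n * T + D * n * (2 * (3 * v))
    lem₅ = solve-∀
  -- The load has the factor `n` where the bound has n - 1. Lowering it is sound when 6 n K ≥ W; in
  -- the other case the claim is immediate.
  distances : d * (6 * n * K) ≤ 24 * n * T + d * W
  distances with ≤-total (6 * n * K) W
  ... | inj₁ ≤W = ≤-trans (*-monoʳ-≤ d ≤W) (m≤n+m (d * W) (24 * n * T))
  ... | inj₂ W≤ = begin
    d * (6 * n * K)                      ≡⟨ cong (d *_) (m+[n∸m]≡n W≤) ⟨
    d * (W + e)                          ≡⟨ *-distribˡ-+ d W e ⟩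
    d * W + d * e                        ≤⟨ +-monoʳ-≤ (d * W) (≤-trans (*-monoˡ-≤ e (*-monoʳ-≤ D (m∸n≤m n 1))) excess) ⟩
    d * W + 24 * n * T                   ≡⟨ +-comm (d * W) (24 * n * T) ⟩
    24 * n * T + d * W                   ∎
    where
    e : ℕ
    e = 6 * n * K ∸ W
    excess : D * n * e ≤ 24 * n * T
    excess = +-cancelʳ-≤ (D * n * W) _ _ (begin
      D * n * e + D * n * W              ≡⟨ *-distribˡ-+ (D * n) e W ⟨
      D * n * (e + W)                    ≡⟨ cong (D * n *_) (m∸n+n≡m W≤) ⟩
      D * n * (6 * n * K)                ≤⟨ total ⟩
      24 * n * T + D * n * W             ∎)

-- The bounds for the directed and the undirected index

module Main (n s : ℕ) .{{_ : NonZero s}} (5≤n : 5 ≤ n) (1<s : 1 < s) (2s<n : 2 * s < n) where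

  private
    instance
      n≢0 : NonZero n
      n≢0 = >-nonZero (≤-trans (s≤s z≤n) 5≤n)

    q m : ℕ
    q = n / s
    m = s / 2

    2m≤s : 2 * m ≤ s
    2m≤s = ≤-trans (≤-reflexive (*-comm 2 m)) (m/n*n≤m s 2)

    s≤2m+1 : s ≤ suc (2 * m)
    s≤2m+1 = begin
      s                ≡⟨ m≡m%n+[m/n]*n s 2 ⟩
      s % 2 + m * 2    ≤⟨ +-monoˡ-≤ (m * 2) (≤-pred (m%n<n s 2)) ⟩
      suc (m * 2)      ≡⟨ cong suc (*-comm m 2) ⟩
      suc (2 * m)      ∎
      where open ≤-Reasoning

    n≡ : n ≡ q * s + n % s
    n≡ = trans (m≡m%n+[m/n]*n n s) (+-comm (n % s) _)

    module C = Colouring n s m 1<s 2s<n 2m≤s s≤2m+1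

    1≤s : 1 ≤ s
    1≤s = <⇒≤ 1<s

    square : 24 * C.colourCount ≤ squareBound s q
    square = colourCount≤squareBound n s q (n % s) 1<s 2s<n m 2m≤s s≤2m+1 (m%n<n n s) n≡

    colourCount≤baseA : 24 * C.colourCount ≤ baseA s q
    colourCount≤baseA with ≤-total q (4 * s)
    ... | inj₁ q≤4s = ≤-trans square (squareBound≤A s q 1<s q≤4s)
    ... | inj₂ 4s≤q = ≤-trans (colourCount≤longBound n s q (n % s) 1<s 2s<n m 2m≤s s≤2m+1 (m%n<n n s) n≡ 4s≤q)
                        (longBound≤A s q 1≤s 4s≤q)

    module _ (T D : ℕ) (T≤ : T ≤ D * C.colourCount) where

      scale : ∀ {B} → 24 * C.colourCount ≤ B → 24 * T ≤ D * B
      scale {B} le = begin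
        24 * T                        ≤⟨ *-monoʳ-≤ 24 T≤ ⟩
        24 * (D * C.colourCount)      ≡⟨ lem D C.colourCount ⟩
        D * (24 * C.colourCount)      ≤⟨ *-monoʳ-≤ D le ⟩
        D * B                         ∎
        where
        open ≤-Reasoning
        lem : ∀ d c → 24 * (d * c) ≡ d * (24 * c)
        lem = solve-∀

      upperA : UpperA s q T D
      upperA = scale (≤-trans colourCount≤baseA (*-monoʳ-≤ (s + 2) (m≤m+n _ _)))

      upperB : UpperB s q T D
      upperB = scale (≤-trans square (≤-trans (squareBound≤B s q 1<s) (m≤m+n _ _)))

      upperC : UpperC s q T D
      upperC = scale (≤-trans square (≤-trans (squareBound≤C s q 1≤s) (m≤m+n _ _)))

      bounds : Lower₁ n s T D → Lower₂ n T D → Bounds n s q (n ∸ q * s) T D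
      bounds l₁ l₂ = (λ _ → l₁ , upperA) , (λ _ → l₁ , upperB) , (λ _ → (l₁ , l₂) , upperC)

    -- With 4n arcs and D = 1, or 2n edges and D = 2, the product D a is 4, so both indices satisfy
    -- the same inequality for T/D.
    perVertex : ∀ D a T K → D * a ≡ 4 → n * (n * K) ≤ a * n * T + n * sum< ballSize K →
      D * (n * K) ≤ 4 * T + D * sum< ballSize K
    perVertex D a T K Da≡4 le = begin
      D * (n * K)                          ≤⟨ *-monoʳ-≤ D (*-cancelˡ-≤ n (≤-trans le (≤-reflexive (lem₁ a n T (sum< ballSize K))))) ⟩
      D * (a * T + sum< ballSize K)        ≡⟨ lem₂ D a T (sum< ballSize K) ⟩
      D * a * T + D * sum< ballSize K      ≡⟨ cong (λ x → x * T + D * sum< ballSize K) Da≡4 ⟩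
      4 * T + D * sum< ballSize K          ∎
      where
      open ≤-Reasoning
      lem₁ : ∀ a n T v → a * n * T + n * v ≡ n * (a * T + v)
      lem₁ = solve-∀
      lem₂ : ∀ D a T v → D * (a * T + v) ≡ D * a * T + D * v
      lem₂ = solve-∀

    1<n : 1 < n
    1<n = ≤-trans (s≤s (s≤s z≤n)) 5≤n

    forwards : Fin 1 → Bool
    forwards _ = true

    orientation : Fin 2 → Bool
    orientation zero       = true
    orientation (suc zero) = false

    orientation-injective : ∀ t t' → orientation t ≡ orientation t' → t ≡ t'
    orientation-injective zero       zero       _ = refl
    orientation-injective (suc zero) (suc zero) _ = refl
    orientation-injective zero       (suc zero) ()
    orientation-injective (suc zero) zero       ()

  directed : ∀ W → IsDirOpticalIndex n s W → Bounds n s q (n ∸ q * s) W 1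
  directed W ((R , c , cf) , least) = bounds W 1
    (≤-trans (least _ C.dirColourable) (≤-reflexive (sym (+-identityʳ _))))
    (Cut.lower₁ n s 2s<n 1<n 1 forwards (λ { zero zero _ → refl }) SharesArc
      (λ _ _ A A' → _ , _ , A , A') W R c cf)
    (lower₂ n W 1 5≤n (λ K → perVertex 1 4 W K refl
      (Load.load-bound n s (4 * n) SharesArc (ArcCode {n} {s}) arcCode
        (λ cd cd' → inj₁ (ArcCode-injective cd cd')) conf W R c cf K)))
    where
    conf : ∀ {u v u' v' a p p'} → ArcCode {n} {s} u v a → ArcCode {n} {s} u' v' a →
      ArcIn u v p → ArcIn u' v' p' → SharesArc p p'
    conf cd cd' A A' with ArcCode-injective cd cd'
    ... | refl , refl = _ , _ , A , A'

  undirected : ∀ w → IsUndirOpticalIndex n s w → Bounds n s q (n ∸ q * s) w 2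
  undirected w ((R , c , cf) , least) = bounds w 2
    (least _ C.undirColourable)
    (Cut.lower₁ n s 2s<n 1<n 2 orientation orientation-injective SharesEdge shares w R c cf)
    (lower₂ n w 2 5≤n (λ K → perVertex 2 2 w K refl
      (Load.load-bound n s (2 * n) SharesEdge (EdgeCode {n} {s}) edgeCode
        EdgeCode-injective conf w R c cf K)))
    where
    shares : ∀ t t' {u v p p'} → OrientedIn (orientation t) u v p → OrientedIn (orientation t') u v p' → SharesEdge p p'
    shares zero       zero       A A' = _ , _ , A , inj₁ A'
    shares zero       (suc zero) A A' = _ , _ , A , inj₂ A'
    shares (suc zero) zero       A A' = _ , _ , A , inj₂ A'
    shares (suc zero) (suc zero) A A' = _ , _ , A , inj₁ A'
    conf : ∀ {u v u' v' a p p'} → EdgeCode {n} {s} u v a → EdgeCode {n} {s} u' v' a →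
      ArcIn u v p → ArcIn u' v' p' → SharesEdge p p'
    conf cd cd' A A' with EdgeCode-injective cd cd'
    ... | inj₁ (refl , refl) = _ , _ , A , inj₁ A'
    ... | inj₂ (refl , refl) = _ , _ , A , inj₂ A'

theorem1p4 : (n s : ℕ) → {{_ : NonZero s}} → 5 ≤ n → 1 < s → 2 * s < n →
    (∀ W → IsDirOpticalIndex n s W →
    Bounds n s (n / s) (n ∸ (n / s) * s) W 1)
    × (∀ w → IsUndirOpticalIndex n s w →
    Bounds n s (n / s) (n ∸ (n / s) * s) w 2)
theorem1p4 n s 5≤n 1<s 2s<n = Main.directed n s 5≤n 1<s 2s<n , Main.undirected n s 5≤n 1<s 2s<n
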